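{- Every set in $\mathrm{NP}\cap\mathrm{Fair\text{ - }S}(n-1,1)$ belongs to $\mathrm{Low}_2$.
   Context: Sets are languages over $\Sigma=\{0,1\}$; FP is the class of polynomial-time computable functions. $\mathrm{Fair\text{ - }S}(n-1,1)$ is the class of sets $L$ for which there is an FP function $f$ such that for every $n\geq 1$ and all distinct strings $y_1,\dots,y_n$ each of length at most $n$ (given as a tuple in lexicographic order): $f(y_1,\dots,y_n)\subseteq\{y_1,\dots,y_n\}$, and if $\|L\cap\{y_1,\dots,y_n\}\|\geq n-1$ then $f(y_1,\dots,y_n)\subseteq L$ and $\|f(y_1,\dots,y_n)\|\geq 1$. $\mathrm{Low}_2=\{L\in\mathrm{NP}:\Sigma_2^{p,L}=\Sigma_2^p\}$, where $\Sigma_2^p=\mathrm{NP}^{\mathrm{NP}}$ is the second $\Sigma$ level of the polynomial hierarchy and $\Sigma_2^{p,L}=\mathrm{NP}^{\mathrm{NP}^L}$. -}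

module Defs where

open import Data.Nat using (ℕ; zero; suc; _+_; _*_; _^_; _≤_; _≥_; _∸_)
open import Data.Fin using (Fin)
open import Data.Bool using (Bool; true; false; if_then_else_)
open import Data.List using (List; []; _∷_; _++_; length; filter)
open import Data.Maybe using (Maybe; just; nothing)
open import Data.Product using (_×_; _,_; Σ; ∃)
open import Data.Empty using (⊥)
open import Data.Unit using (⊤)
open import Data.List.Membership.Propositional using (_∈_)
open import Data.List.Relation.Unary.All using (All)
open import Data.List.Relation.Unary.Unique.Propositional using (Unique)
open import Data.List.Relation.Unary.Linked using (Linked)
open import Relation.Binary.PropositionalEquality using (_≡_)
open import Function.Bundles using (_⇔_)

-- Languages over Σ = {0,1}.  A string is a List Bool (false = 0, true = 1);
-- a language is given by its characteristic function.

Str : Set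
Str = List Bool

Lang : Set
Lang = Str → Bool

_∈L_ : Str → Lang → Set
x ∈L A = A x ≡ true

emptyLang : Lang
emptyLang _ = false

poly : ℕ → ℕ → ℕ → ℕ
poly c k n = c * n ^ k + c

data Sym : Set where
  blank b0 b1 mark : Sym

data Move : Set where
  left right stay : Move

data Kind : Set where
  normal accept reject query : Kind

-- States are Fin (suc nStates); the start state is Fin.zero.
-- In a query state, the oracle is asked about the maximal run of 0/1
-- symbols starting at the head; the machine then goes to qYes or qNo.
-- Accept and reject states are halting (absorbing).
record OTM : Set where
  field
    nStates : ℕ
    kind    : Fin (suc nStates) → Kind
    δ       : Fin (suc nStates) → Sym → Fin (suc nStates) × Sym × Move
    qYes    : Fin (suc nStates)
    qNo     : Fin (suc nStates)

-- tape zipper: cells left of the head (nearest first), the scanned cell,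
-- cells right of the head; everything beyond is blank.
record Tape : Set where
  constructor tape
  field
    lft  : List Sym
    here : Sym
    rgt  : List Sym

write : Sym → Tape → Tape
write s (tape l _ r) = tape l s r

moveHead : Move → Tape → Tape
moveHead left  (tape []      h r) = tape [] blank (h ∷ r)
moveHead left  (tape (a ∷ l) h r) = tape l a (h ∷ r)
moveHead right (tape l h [])      = tape (h ∷ l) blank []
moveHead right (tape l h (a ∷ r)) = tape (h ∷ l) a r
moveHead stay  t                  = t

bitsOf : List Sym → Str
bitsOf (b0 ∷ s) = false ∷ bitsOf s
bitsOf (b1 ∷ s) = true ∷ bitsOf s
bitsOf _        = []

readWord : Tape → Str
readWord (tape _ h r) = bitsOf (h ∷ r)

toSym : Bool → Sym
toSym false = b0
toSym true  = b1

initTape : Str → Tape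
initTape []       = tape [] blank []
initTape (b ∷ bs) = tape [] (toSym b) (Data.List.map toSym bs)

Config : OTM → Set
Config M = Fin (suc (OTM.nStates M)) × Tape

initConfig : (M : OTM) → Str → Config M
initConfig M x = Fin.zero , initTape x

stepK : (M : OTM) → Lang → Kind → Config M → Config M
stepK M O normal (q , t) with OTM.δ M q (Tape.here t)
... | (q' , s , m) = q' , moveHead m (write s t)
stepK M O accept c = c
stepK M O reject c = c
stepK M O query  (q , t) =
  (if O (readWord t) then OTM.qYes M else OTM.qNo M) , t

step : (M : OTM) → Lang → Config M → Config M
step M O (q , t) = stepK M O (OTM.kind M q) (q , t)

run : (M : OTM) → Lang → ℕ → Config M → Config M
run M O zero    c = c
run M O (suc n) c = run M O n (step M O c)

resultK : Kind → Maybe Bool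
resultK accept = just true
resultK reject = just false
resultK _      = nothing

result : (M : OTM) → Config M → Maybe Bool
result M (q , _) = resultK (OTM.kind M q)

output : (M : OTM) → Config M → Str
output M (_ , t) = readWord t

P^ : Lang → Lang → Set
P^ O A = Σ OTM λ M → Σ ℕ λ c → Σ ℕ λ k →
  (x : Str) → result M (run M O (poly c k (length x)) (initConfig M x)) ≡ just (A x)

encStr : Str → Str
encStr []       = []
encStr (b ∷ bs) = b ∷ b ∷ encStr bs

pair : Str → Str → Str
pair x y = encStr x ++ (false ∷ true ∷ y)

-- A ∈ NP^O : x ∈ A iff some polynomially short certificate y makes (x,y)
-- belong to a set in P^O  (equivalent to nondeterministic poly-time
-- oracle machines).
NP^ : Lang → Lang → Set
NP^ O A = Σ Lang λ B → P^ O B × Σ ℕ λ c → Σ ℕ λ k →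
  (x : Str) → (x ∈L A) ⇔ (Σ Str λ y → length y ≤ poly c k (length x) × pair x y ∈L B)

NP : Lang → Set
NP = NP^ emptyLang

Σ₂ᵖ : Lang → Set
Σ₂ᵖ A = Σ Lang λ B → NP B × NP^ B A

Σ₂ᵖ^ : Lang → Lang → Set
Σ₂ᵖ^ L A = Σ Lang λ B → NP^ L B × NP^ B A

Low₂ : Lang → Set
Low₂ L = NP L × ((A : Lang) → Σ₂ᵖ^ L A ⇔ Σ₂ᵖ A)

FP : (Str → Str) → Set
FP g = Σ OTM λ M → Σ ℕ λ c → Σ ℕ λ k → (x : Str) →
  let cfg = run M emptyLang (poly c k (length x)) (initConfig M x)
  in result M cfg ≡ just true × output M cfg ≡ g x

encList : List Str → Str
encList []       = []
encList (y ∷ ys) = encStr y ++ (false ∷ true ∷ encList ys)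

data _<lex_ : Str → Str → Set where
  []<∷  : ∀ {b bs} → [] <lex (b ∷ bs)
  0<1   : ∀ {xs ys} → (false ∷ xs) <lex (true ∷ ys)
  same  : ∀ {b xs ys} → xs <lex ys → (b ∷ xs) <lex (b ∷ ys)

-- ‖L ∩ {y₁,…,yₙ}‖ for a list of distinct strings
countIn : Lang → List Str → ℕ
countIn L []       = 0
countIn L (y ∷ ys) = (if L y then 1 else 0) + countIn L ys

Admissible : List Str → Set
Admissible ys = 1 ≤ length ys × Unique ys × Linked _<lex_ ys
              × All (λ y → length y ≤ length ys) ys

FairS : Lang → Set
FairS L = Σ (List Str → List Str) λ F → Σ (Str → Str) λ f → FP f ×
  ((ys : List Str) → f (encList ys) ≡ encList (F ys)) ×
  ((ys : List Str) → Admissible ys →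
     All (λ z → z ∈ ys) (F ys) ×
     (countIn L ys ≥ length ys ∸ 1 →
        All (λ z → z ∈L L) (F ys) × 1 ≤ length (F ys)))

{-# OPTIONS --safe #-}

-- Fix a length bound N = k + 1 and let R consist of strings in L of length at most N.  Whenever S
-- is a k-element subset of R and x ∈ L has length at most N, the selector applied to S ∪ {x} returns
-- members of L only; so S ⊆ L certifies x ∈ L if x is selected.  Counting the pairs (S , x)
-- with x selected from S ∪ {x} shows that some S certifies a 1/N fraction of R.  Repeating this
-- on what is left, O(N²) sets S (with NP witnesses for their elements) certify all of L up to
-- length N: they are a polynomial-size advice that can only err by missing members of L.
--
-- Given A ∈ NP^B with B ∈ NP^L, an NP machine guesses such an advice, asks an NP oracle
-- whether it misses a member of L, and, if not, simulates the machine for A.  Queries z to B become NP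
-- queries (z , advice), in which the machine for B gets its answers about L from the advice.
--
-- Time bounds come from register machines: fragments of Turing machines keep a stack of strings
-- on the tape, and the polynomial-time maps on such stacks are closed under composition, case
-- distinction and bounded loops, and contain the clocked simulation of a given machine.
module Submission where

open import Defs
open import Data.Nat using (ℕ; zero; suc; _+_; _*_; _^_; _≤_; _<_; _∸_; z≤n; s≤s)
open import Data.Nat.Properties
open import Data.Nat.Tactic.RingSolver using (solve-∀)
open import Data.Fin as Fin using (Fin; toℕ)
open import Data.Fin.Patterns using (0F; 1F; 2F)
open import Data.Bool using (Bool; true; false; if_then_else_; not; _∧_; _∨_)
open import Data.List using (List; []; _∷_; _++_; length; map; foldl; foldr; replicate; concatMap; _ʳ++_; lookup; take)
open import Data.List.Properties
open import Data.List.Membership.Propositional using (_∈_; find)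
open import Data.List.Membership.Propositional.Properties using (∈-map⁺; ∈-++⁺ˡ; ∈-++⁺ʳ; ∈-concatMap⁺; ∈-map⁻)
open import Data.List.Relation.Unary.Any as Any using (Any; here; there)
import Data.List.Relation.Unary.Any.Properties as AnyP
open AnyP using (lookup-index; reverse⁺)
open import Data.List.Relation.Unary.All as All using (All; []; _∷_)
open import Data.List.Relation.Unary.All.Properties using (++⁺; ++⁻; map⁺)
open import Data.Vec as Vec using (Vec; []; _∷_)
open import Data.List.Relation.Unary.AllPairs as AllPairs using (AllPairs; []; _∷_)
open import Data.List.Relation.Unary.Linked as Linked using (Linked; []; [-]; _∷_)
open import Data.List.Relation.Unary.Linked.Properties using (Linked⇒AllPairs)
open import Data.Maybe using (Maybe; just; nothing)
open import Data.Product using (_×_; _,_; Σ; ∃; proj₁; proj₂; map₁)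
open import Data.Sum using (_⊎_; inj₁; inj₂; [_,_]′)
open import Data.Unit using (⊤; tt)
open import Relation.Binary.PropositionalEquality using (_≡_; _≢_; refl; sym; trans; cong; cong₂; subst; subst₂; module ≡-Reasoning)
open import Relation.Nullary using (yes; no)
open import Function.Bundles using (_⇔_; mk⇔; module Equivalence)
open import Function.Base using (id; case_of_)

-- Fragments of Turing machines

-- The fairness condition dictates the shape of the certificates: the selector is constrained only
-- on tuples at least as long as their longest string. Pairs, the usual tool for selective sets, are
-- thus too short, whereas `k` strings together with `x` form the smallest tuple that admits all
-- strings of length up to `k + 1`. Every `(k+1)`-element sublist of `R` has a selected member, so,
-- with `m` strings in `R`, some `S` sees at least `C(m,k+1) / C(m,k) = (m-k) / (k+1)` strings
-- selected beside it; with its own `k` members it covers at least `m / (k+1)`. Hence `k + 1` rounds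
-- halve the remainder, and fewer than `2^(k+2)` strings need `k + 2` halvings.
--
-- Advice must stay harmless when it is merely guessed. Soundness is therefore proved for every
-- string: witnesses, order and lengths are all tested before a selection counts. The only possible
-- defect is a missed member of `L`, which has a short certificate, so completeness is the negative
-- answer to an NP query. The reverse inclusion amounts to `NP ⊆ NP^L`.

record Finite (A : Set) : Set where
  field
    enum     : List A
    complete : ∀ a → a ∈ enum

open Finite

instance
  finite-⊤ : Finite ⊤
  finite-⊤ = record { enum = tt ∷ [] ; complete = λ _ → here refl }

  finite-Bool : Finite Bool
  finite-Bool = record
    { enum = true ∷ false ∷ []
    ; complete = λ { true → here refl ; false → there (here refl) } }

  finite-Sym : Finite Sym
  finite-Sym = record
    { enum = blank ∷ b0 ∷ b1 ∷ mark ∷ []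
    ; complete = λ { blank → here refl ; b0 → there (here refl)
                   ; b1 → there (there (here refl)) ; mark → there (there (there (here refl))) } }

  finite-Fin : ∀ {n} → Finite (Fin n)
  finite-Fin {n} = record { enum = Data.List.allFin n ; complete = ∈-allFin }
    where open import Data.List.Membership.Propositional.Properties using (∈-allFin)

  finite-Maybe : ∀ {A} → {{Finite A}} → Finite (Maybe A)
  finite-Maybe {{F}} = record
    { enum = nothing ∷ map just (enum F)
    ; complete = λ { nothing → here refl ; (just a) → there (∈-map⁺ just (complete F a)) } }

  finite-⊎ : ∀ {A B} → {{Finite A}} → {{Finite B}} → Finite (A ⊎ B)
  finite-⊎ {{F}} {{G}} = record
    { enum = map inj₁ (enum F) ++ map inj₂ (enum G)
    ; complete = λ { (inj₁ a) → ∈-++⁺ˡ (∈-map⁺ inj₁ (complete F a))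
                   ; (inj₂ b) → ∈-++⁺ʳ (map inj₁ (enum F)) (∈-map⁺ inj₂ (complete G b)) } }

finite-Σ : ∀ {A} {B : A → Set} → Finite A → (∀ a → Finite (B a)) → Finite (Σ A B)
finite-Σ {A} {B} F G = record
  { enum = concatMap (λ a → map (a ,_) (enum (G a))) (enum F)
  ; complete = λ { (a , b) → ∈-concatMap⁺ _ (Any.map (λ { refl → ∈-map⁺ (a ,_) (complete (G a) b) }) (complete F a)) } }

-- A transition either stays inside the fragment or leaves it through one of the exits E.
record Machine (E : Set) : Set₁ where
  field
    Q      : Set
    finite : Finite Q
    start  : Q
    delta  : Q → Sym → (Q ⊎ E) × Sym × Move

open Machine

apply : Sym → Move → Tape → Tape
apply s m t = moveHead m (write s t)

data Runs {E} (M : Machine E) : Q M → Tape → ℕ → E → Tape → Set where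
  exit : ∀ {q t e s m} → Machine.delta M q (Tape.here t) ≡ (inj₂ e , s , m) →
         Runs M q t 1 e (apply s m t)
  next : ∀ {q t q′ s m n e t′} → Machine.delta M q (Tape.here t) ≡ (inj₁ q′ , s , m) →
         Runs M q′ (apply s m t) n e t′ → Runs M q t (suc n) e t′

opaque
  act : ∀ {E} → (Sym → E × Sym × Move) → Machine E
  act f = record { Q = ⊤ ; finite = finite-⊤ ; start = tt ; delta = λ _ s → map₁ inj₂ (f s) }

  act-runs : ∀ {E} (f : Sym → E × Sym × Move) {t e s m} → f (Tape.here t) ≡ (e , s , m) →
             Runs (act f) (start (act f)) t 1 e (apply s m t)
  act-runs f eq = exit (cong (map₁ inj₂) eq)

module _ {E F : Set} (M : Machine E) (k : E → Machine F) where

  -- The exit `e` of `M` stays in the control state, so finite data passes from one fragment to the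
  -- next without touching the tape.
  BindQ : Set
  BindQ = Q M ⊎ Σ E (λ e → Q (k e))

  leaveFirst : Q M ⊎ E → BindQ ⊎ F
  leaveFirst (inj₁ q) = inj₁ (inj₁ q)
  leaveFirst (inj₂ e) = inj₁ (inj₂ (e , start (k e)))

  leaveSecond : ∀ e → Q (k e) ⊎ F → BindQ ⊎ F
  leaveSecond e (inj₁ q) = inj₁ (inj₂ (e , q))
  leaveSecond e (inj₂ f) = inj₂ f

  bindDelta : BindQ → Sym → (BindQ ⊎ F) × Sym × Move
  bindDelta (inj₁ q)       s = map₁ leaveFirst (Machine.delta M q s)
  bindDelta (inj₂ (e , q)) s = map₁ (leaveSecond e) (Machine.delta (k e) q s)

  bindM : {{Finite E}} → Machine F
  bindM {{fin}} = record
    { Q      = BindQ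
    ; finite = finite-⊎ {{Machine.finite M}} {{finite-Σ fin (λ e → Machine.finite (k e))}}
    ; start  = inj₁ (start M)
    ; delta  = bindDelta }

  bindM-second : ∀ {{fin : Finite E}} {e q t n f t′} → Runs (k e) q t n f t′ → Runs bindM (inj₂ (e , q)) t n f t′
  bindM-second (exit eq)   = exit (cong (map₁ (leaveSecond _)) eq)
  bindM-second (next eq r) = next (cong (map₁ (leaveSecond _)) eq) (bindM-second r)

  bindM-first : ∀ {{fin : Finite E}} {q t n e t₁ m f t₂} →
                Runs M q t n e t₁ → Runs (k e) (start (k e)) t₁ m f t₂ → Runs bindM (inj₁ q) t (n + m) f t₂
  bindM-first (exit eq)   r′ = next (cong (map₁ leaveFirst) eq) (bindM-second r′)
  bindM-first (next eq r) r′ = next (cong (map₁ leaveFirst) eq) (bindM-first r r′)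

infixl 1 _>>=_

opaque
  _>>=_ : ∀ {E F} → {{Finite E}} → Machine E → (E → Machine F) → Machine F
  M >>= k = bindM M k

  bind-runs : ∀ {E F} {{fin : Finite E}} (M : Machine E) (k : E → Machine F) {t n e t₁ m f t₂} →
              Runs M (start M) t n e t₁ → Runs (k e) (start (k e)) t₁ m f t₂ →
              Runs (M >>= k) (start (M >>= k)) t (n + m) f t₂
  bind-runs M k = bindM-first M k

infixl 1 _>>_

_>>_ : ∀ {F} → Machine ⊤ → Machine F → Machine F
M >> N = M >>= λ _ → N

module _ {X E : Set} (body : X → Machine (X ⊎ E)) where

  -- An exit `inj₁ y` restarts the loop body with parameter `y`, an exit `inj₂ e` ends the loop;
  -- loop variables of finite type thus live in the control.
  leaveBody : ∀ x → Q (body x) ⊎ (X ⊎ E) → Σ X (λ x → Q (body x)) ⊎ E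
  leaveBody x (inj₁ q)        = inj₁ (x , q)
  leaveBody x (inj₂ (inj₁ y)) = inj₁ (y , start (body y))
  leaveBody x (inj₂ (inj₂ e)) = inj₂ e

  iterM : {{Finite X}} → X → Machine E
  iterM {{fin}} x₀ = record
    { Q      = Σ X (λ x → Q (body x))
    ; finite = finite-Σ fin (λ x → Machine.finite (body x))
    ; start  = x₀ , start (body x₀)
    ; delta  = λ (x , q) s → map₁ (leaveBody x) (Machine.delta (body x) q s) }

  -- the initial parameter only affects the start state
  iterM-relabel : ∀ {{fin : Finite X}} {x y q t n e t′} → Runs (iterM x) q t n e t′ → Runs (iterM y) q t n e t′
  iterM-relabel (exit eq)   = exit eq
  iterM-relabel (next eq r) = next eq (iterM-relabel r)

  iterM-last : ∀ {{fin : Finite X}} {z x q t n e t′} → Runs (body x) q t n (inj₂ e) t′ → Runs (iterM z) (x , q) t n e t′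
  iterM-last (exit eq)   = exit (cong (map₁ (leaveBody _)) eq)
  iterM-last (next eq r) = next (cong (map₁ (leaveBody _)) eq) (iterM-last r)

  iterM-again : ∀ {{fin : Finite X}} {z x q t n y t₁ m e t₂} → Runs (body x) q t n (inj₁ y) t₁ →
                Runs (iterM z) (y , start (body y)) t₁ m e t₂ → Runs (iterM z) (x , q) t (n + m) e t₂
  iterM-again (exit eq)   r′ = next (cong (map₁ (leaveBody _)) eq) r′
  iterM-again (next eq r) r′ = next (cong (map₁ (leaveBody _)) eq) (iterM-again r r′)

opaque
  iter : ∀ {X E} → {{Finite X}} → (X → Machine (X ⊎ E)) → X → Machine E
  iter body x₀ = iterM body x₀

  iter-exit : ∀ {X E} {{fin : Finite X}} (body : X → Machine (X ⊎ E)) {x t n e t′} →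
              Runs (body x) (start (body x)) t n (inj₂ e) t′ →
              Runs (iter body x) (start (iter body x)) t n e t′
  iter-exit body = iterM-last body

  iter-next : ∀ {X E} {{fin : Finite X}} (body : X → Machine (X ⊎ E)) {x t n y t₁ m e t₂} →
              Runs (body x) (start (body x)) t n (inj₁ y) t₁ →
              Runs (iter body y) (start (iter body y)) t₁ m e t₂ →
              Runs (iter body x) (start (iter body x)) t (n + m) e t₂
  iter-next body r r′ = iterM-again body r (iterM-relabel body r′)

-- Registers on a tape

hd : List Sym → Sym
hd []      = blank
hd (a ∷ _) = a

tl : List Sym → List Sym
tl []      = []
tl (_ ∷ l) = l

-- the tape with l to the left of the head (nearest cell first) and r from the head on
at : List Sym → List Sym → Tape
at l r = tape l (hd r) (tl r)

RunTo : ∀ {E} → Machine E → Tape → ℕ → E → Tape → Set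
RunTo M = Runs M (start M)

recount : ∀ {E} {M : Machine E} {q t n n′ e t′} → n ≡ n′ → Runs M q t n e t′ → Runs M q t n′ e t′
recount refl r = r

refrom : ∀ {E} {M : Machine E} {q t u n e t′} → t ≡ u → Runs M q t n e t′ → Runs M q u n e t′
refrom refl r = r

reto : ∀ {E} {M : Machine E} {q t n e t′ u} → t′ ≡ u → Runs M q t n e t′ → Runs M q t n e u
reto refl r = r

if-false : ∀ {A : Set} {b} {x y : A} → b ≡ false → (if b then x else y) ≡ y
if-false refl = refl

move-right : ∀ l s r → moveHead right (tape l s r) ≡ at (s ∷ l) r
move-right l s []      = refl
move-right l s (_ ∷ _) = refl

move-left : ∀ l s r → moveHead left (tape l s r) ≡ at (tl l) (hd l ∷ s ∷ r)
move-left []      s r = refl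
move-left (_ ∷ _) s r = refl

module _ {E : Set} (f : Sym → E × Sym × Move) where

  act-right : ∀ {l r e s} → f (hd r) ≡ (e , s , right) → RunTo (act f) (at l r) 1 e (at (s ∷ l) (tl r))
  act-right {l} {r} {s = s} eq = subst (Runs _ _ _ 1 _) (move-right l s (tl r)) (act-runs f eq)

  act-left : ∀ {l r e s} → f (hd r) ≡ (e , s , left) →
             RunTo (act f) (at l r) 1 e (at (tl l) (hd l ∷ s ∷ tl r))
  act-left {l} {r} {s = s} eq = subst (Runs _ _ _ 1 _) (move-left l s (tl r)) (act-runs f eq)

  act-stay : ∀ {l r e s} → f (hd r) ≡ (e , s , stay) → RunTo (act f) (at l r) 1 e (at l (s ∷ tl r))
  act-stay eq = act-runs f eq

isBlank : Sym → Bool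
isBlank blank = true
isBlank _     = false

Blank NonBlank : Sym → Set
Blank a    = a ≡ blank
NonBlank a = isBlank a ≡ false

hd-blank : ∀ {l} → All Blank l → hd l ≡ blank
hd-blank []       = refl
hd-blank (eq ∷ _) = eq

tl-blank : ∀ {l} → All Blank l → All Blank (tl l)
tl-blank []      = []
tl-blank (_ ∷ p) = p

toSym-nonBlank : ∀ b → NonBlank (toSym b)
toSym-nonBlank false = refl
toSym-nonBlank true  = refl

≤-by : ∀ {m n} k → m + k ≡ n → m ≤ n
≤-by {m} k eq = ≤-trans (m≤m+n m k) (≤-reflexive eq)

cells : List Str → List Sym
cells []      = []
cells (w ∷ s) = map toSym w ++ mark ∷ cells s

sz : List Str → ℕ
sz []      = 0
sz (w ∷ s) = suc (length w + sz s)

cells-nonBlank : ∀ s → All NonBlank (cells s)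
cells-nonBlank []      = []
cells-nonBlank (w ∷ s) = ++⁺ (map⁺ (All.universal toSym-nonBlank w)) (refl ∷ cells-nonBlank s)

cells-++ : ∀ s s′ → cells (s ++ s′) ≡ cells s ++ cells s′
cells-++ []      s′ = refl
cells-++ (w ∷ s) s′ = trans (cong (λ c → map toSym w ++ mark ∷ c) (cells-++ s s′))
                            (sym (++-assoc (map toSym w) _ _))

sz-++ : ∀ s s′ → sz (s ++ s′) ≡ sz s + sz s′
sz-++ []      s′ = refl
sz-++ (w ∷ s) s′ = cong suc (trans (cong (length w +_) (sz-++ s s′)) (sym (+-assoc (length w) _ _)))

length-cells : ∀ s → length (cells s) ≡ sz s
length-cells []      = refl
length-cells (w ∷ s) = trans (length-++ (map toSym w))
  (trans (cong₂ (λ a b → a + suc b) (length-map toSym w) (length-cells s)) (+-suc (length w) (sz s)))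

skipStep : Sym → (⊤ ⊎ ⊤) × Sym × Move
skipStep mark = inj₂ tt , mark , right
skipStep a    = inj₁ tt , a , right

skipMark : Machine ⊤
skipMark = iter (λ _ → act skipStep) tt

skipMark-runs : ∀ w l r → RunTo skipMark (at l (map toSym w ++ mark ∷ r)) (suc (length w)) tt
                                         (at (mark ∷ (map toSym w ʳ++ l)) r)
skipMark-runs []          l r = iter-exit _ (act-right skipStep {l} {mark ∷ r} refl)
skipMark-runs (false ∷ w) l r = iter-next _ (act-right skipStep {l} {b0 ∷ _} refl) (skipMark-runs w (b0 ∷ l) r)
skipMark-runs (true ∷ w)  l r = iter-next _ (act-right skipStep {l} {b1 ∷ _} refl) (skipMark-runs w (b1 ∷ l) r)

goto : ℕ → Machine ⊤
goto zero    = skipMark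
goto (suc i) = skipMark >> goto i

-- The word `w` is what remains of the current register. Callers start on the mark in front of
-- register 0, where `w` is empty, so that passing `length pre + 1` marks leads to the register with
-- index `length pre`.
goto-runs : ∀ w pre l r →
  RunTo (goto (length pre)) (at l (map toSym w ++ mark ∷ cells pre ++ r)) (sz (w ∷ pre)) tt
        (at ((map toSym w ++ mark ∷ cells pre) ʳ++ l) r)
goto-runs w []        l r = recount (cong suc (sym (+-identityʳ _)))
  (reto (cong (λ l′ → at l′ r) (sym (++-ʳ++ (map toSym w)))) (skipMark-runs w l r))
goto-runs w (v ∷ pre) l r = reto (cong (λ l′ → at l′ r) (sym (++-ʳ++ (map toSym w))))
  (bind-runs skipMark _ (skipMark-runs w l _)
    (refrom (cong (at (mark ∷ (map toSym w ʳ++ l))) (sym (++-assoc (map toSym v) (mark ∷ cells pre) r)))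
      (goto-runs v pre (mark ∷ (map toSym w ʳ++ l)) r)))

insertStep : Sym → Sym → (Sym ⊎ ⊤) × Sym × Move
insertStep c a = if isBlank a then (inj₂ tt , c , stay) else (inj₁ a , c , right)

insertHere : Sym → Machine ⊤
insertHere = iter (λ c → act (insertStep c))

-- Each cell receives the symbol displaced from its left neighbour, carried in the loop parameter.
-- The head stops on the last written cell, which is why `c ∷ r` is split into `p` and its last
-- symbol `a`.
insertHere-runs : ∀ r c l {z} → All NonBlank r → All Blank z →
  ∃ λ p → ∃ λ a → c ∷ r ≡ p ++ a ∷ [] ×
    RunTo (insertHere c) (at l (r ++ z)) (suc (length r)) tt (at (p ʳ++ l) (a ∷ tl z))
insertHere-runs [] c l {z} _ bz = [] , c , refl ,
  iter-exit _ (act-stay (insertStep c) {l} {z}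
    (cong (λ a → if isBlank a then (inj₂ tt , c , stay) else (inj₁ a , c , right)) (hd-blank bz)))
insertHere-runs (x ∷ r) c l {z} (nb ∷ nbs) bz with insertHere-runs r x (c ∷ l) nbs bz
... | p , a , eq , run′ = c ∷ p , a , cong (c ∷_) eq ,
  iter-next _ (act-right (insertStep c) {l} {x ∷ r ++ z}
    (if-false nb)) run′

homeStep : Sym → (⊤ ⊎ ⊤) × Sym × Move
homeStep a = if isBlank a then (inj₂ tt , blank , right) else (inj₁ tt , a , left)

home : Machine ⊤
home = iter (λ _ → act homeStep) tt

home-runs : ∀ p {L} a r → All NonBlank (a ∷ p) → All Blank L →
  RunTo home (at (p ++ L) (a ∷ r)) (2 + length p) tt (at (blank ∷ tl L) (p ʳ++ (a ∷ r)))
home-runs [] {L} a r (nb ∷ _) bL =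
  iter-next _ (act-left homeStep {L} {a ∷ r} (if-false nb))
    (iter-exit _ (act-right homeStep {tl L} {hd L ∷ a ∷ r}
       (cong (λ x → if isBlank x then (inj₂ tt , blank , right) else (inj₁ tt , x , left)) (hd-blank bL))))
home-runs (b ∷ p) {L} a r (nb ∷ nbs) bL =
  iter-next _ (act-left homeStep {b ∷ p ++ L} {a ∷ r} (if-false nb))
    (home-runs p b (a ∷ r) nbs bL)

length-ʳ++[] : ∀ {A : Set} (l : List A) → length (l ʳ++ []) ≡ length l
length-ʳ++[] l = trans (length-ʳ++ l) (+-identityʳ _)

All-ʳ++ : ∀ {P : Sym → Set} {xs ys} → All P xs → All P ys → All P (xs ʳ++ ys)
All-ʳ++ []       qs = qs
All-ʳ++ (p ∷ ps) qs = All-ʳ++ ps (p ∷ qs)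

split-ʳ++ : ∀ (p l : List Sym) → p ʳ++ l ≡ (p ʳ++ []) ++ l
split-ʳ++ p l = trans (ʳ++-defn p) (cong (_++ l) (sym (trans (ʳ++-defn p) (++-identityʳ _))))

home-runs′ : ∀ p {L} a r → All NonBlank (p ++ a ∷ []) → All Blank L →
  RunTo home (at (p ʳ++ L) (a ∷ r)) (2 + length p) tt (at (blank ∷ tl L) (p ++ a ∷ r))
home-runs′ p {L} a r nbs bL with ++⁻ p nbs
... | nbp , nba ∷ [] =
  recount (cong (2 +_) (length-ʳ++[] p))
    (refrom (cong (λ l → at l (a ∷ r)) (sym (split-ʳ++ p L)))
      (reto (cong (at (blank ∷ tl L)) (ʳ++-ʳ++ p {[]}))
        (home-runs (p ʳ++ []) a r (nba ∷ All-ʳ++ nbp []) bL)))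

shiftAct : Sym → Sym → (⊤ ⊎ ⊤) × Sym × Move
shiftAct y _ = if isBlank y then (inj₂ tt , blank , left) else (inj₁ tt , y , right)

stepRight : Sym → ⊤ × Sym × Move
stepRight a = tt , a , right

peek : Sym → Sym × Sym × Move
peek a = a , a , left

-- The right neighbour is read and copied into the current cell; repeated up to the first blank,
-- this shifts the tail left by one cell.
shiftBody : ⊤ → Machine (⊤ ⊎ ⊤)
shiftBody _ = act stepRight >>= λ _ → act peek >>= λ y → act (shiftAct y)

deleteHere : Machine ⊤
deleteHere = iter shiftBody tt

deleteHere-runs : ∀ r x l {z} → All NonBlank r → All Blank z →
  ∃ λ z′ → All Blank z′ ×
    RunTo deleteHere (at l (x ∷ r ++ z)) (3 + 3 * length r) tt
          (at (tl (r ʳ++ l)) (hd (r ʳ++ l) ∷ z′))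
deleteHere-runs [] x l {z} _ bz = blank ∷ hd z ∷ tl z , refl ∷ hd-blank bz ∷ tl-blank bz ,
  iter-exit shiftBody
    (bind-runs (act stepRight) _ (act-right stepRight {l} {x ∷ z} refl)
    (bind-runs (act peek) (λ y → act (shiftAct y)) (act-left peek {x ∷ l} {z} refl)
      (act-left (shiftAct (hd z)) {l} {x ∷ hd z ∷ tl z} (cong (λ y → shiftAct y x) (hd-blank bz)))))
deleteHere-runs (y ∷ r) x l {z} (nb ∷ nbs) bz with deleteHere-runs r y (y ∷ l) nbs bz
... | z′ , bz′ , run′ = z′ , bz′ , recount
  (cong (3 +_) (sym (*-suc 3 (length r))))
  (iter-next shiftBody
    (bind-runs (act stepRight) _ (act-right stepRight {l} {x ∷ y ∷ r ++ z} refl)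
    (bind-runs (act peek) (λ y → act (shiftAct y)) (act-left peek {x ∷ l} {y ∷ r ++ z} refl)
      (act-right (shiftAct y) {l} {x ∷ y ∷ r ++ z} (if-false nb)))) run′)

-- The margins are existential because stepping over an end of the tape leaves explicit blank cells
-- behind. No register contains a blank, so blanks delimit the used part; the additional leading
-- mark is the resting place of the head.
record Rep (s : List Str) (t : Tape) : Set where
  constructor rep
  field
    {before after} : List Sym
    before-blank   : All Blank before
    after-blank    : All Blank after
    layout         : t ≡ at before (mark ∷ cells s ++ after)

-- During `n` operations the registers occupy at most `S + n` cells. The factor 10 absorbs one
-- insertion or deletion together with the way to the register and back.
cost : ℕ → ℕ → ℕ
cost S n = n * (10 * (S + n))

-- From a tape holding the registers s, M leaves through e with the registers s′.
-- n counts elementary register operations, each of which takes time linear in the tape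
-- length and lengthens the tape by at most one cell.
record Tri {E : Set} (M : Machine E) (s : List Str) (n : ℕ) (e : E) (s′ : List Str) : Set where
  constructor tri
  field
    runs : ∀ {t} → Rep s t → ∃ λ m → ∃ λ t′ → m ≤ cost (sz s) n × RunTo M t m e t′ × Rep s′ t′
    grow : sz s′ ≤ sz s + n

open Tri

-- The later operations start from at most `S + n` cells, and `cost` already charges every operation
-- for the final size; costs of consecutive fragments therefore add up without loss.
cost-+ : ∀ {S S₁} n m → S₁ ≤ S + n → cost S n + cost S₁ m ≤ cost S (n + m)
cost-+ {S} {S₁} n m le = begin
  n * (10 * (S + n)) + m * (10 * (S₁ + m))
    ≤⟨ +-mono-≤ (*-monoʳ-≤ n (*-monoʳ-≤ 10 (+-monoʳ-≤ S (m≤m+n n m))))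
                (*-monoʳ-≤ m (*-monoʳ-≤ 10 (+-monoˡ-≤ m le))) ⟩
  n * (10 * (S + (n + m))) + m * (10 * (S + n + m))
    ≡⟨ cong (λ z → n * (10 * (S + (n + m))) + m * (10 * z)) (+-assoc S n m) ⟩
  n * (10 * (S + (n + m))) + m * (10 * (S + (n + m)))
    ≡⟨ *-distribʳ-+ (10 * (S + (n + m))) n m ⟨
  (n + m) * (10 * (S + (n + m))) ∎
  where open ≤-Reasoning

cost-mono : ∀ {S n m} → n ≤ m → cost S n ≤ cost S m
cost-mono {S} le = *-mono-≤ le (*-monoʳ-≤ 10 (+-monoʳ-≤ S le))

weaken : ∀ {E} {M : Machine E} {s n m e s′} → n ≤ m → Tri M s n e s′ → Tri M s m e s′
weaken {s = s} le (tri r g) = tri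
  (λ R → let k , t′ , b , rs , R′ = r R in k , t′ , ≤-trans b (cost-mono {sz s} le) , rs , R′)
  (≤-trans g (+-monoʳ-≤ (sz s) le))

tri-bind : ∀ {E F} {{fin : Finite E}} {M : Machine E} {k : E → Machine F} {s n e s₁ m f s₂} →
           Tri M s n e s₁ → Tri (k e) s₁ m f s₂ → Tri (M >>= k) s (n + m) f s₂
tri-bind {M = M} {k} {s} {n} {s₁ = s₁} {m} (tri r g) (tri r′ g′) = tri
  (λ R → let a , t₁ , b , rs , R₁ = r R
             a′ , t₂ , b′ , rs′ , R₂ = r′ R₁
         in a + a′ , t₂ , ≤-trans (+-mono-≤ b b′) (cost-+ {sz s} n m g) , bind-runs M k rs rs′ , R₂)
  (≤-trans g′ (≤-trans (+-monoˡ-≤ m g) (≤-reflexive (+-assoc (sz s) n m))))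

tri-seq : ∀ {F} {M : Machine ⊤} {N : Machine F} {s n s₁ m f s₂} →
          Tri M s n tt s₁ → Tri N s₁ m f s₂ → Tri (M >> N) s (n + m) f s₂
tri-seq = tri-bind

tri-exit : ∀ {X E} {{fin : Finite X}} {body : X → Machine (X ⊎ E)} {x s n e s′} →
           Tri (body x) s n (inj₂ e) s′ → Tri (iter body x) s n e s′
tri-exit {body = body} (tri r g) = tri
  (λ R → let a , t₁ , b , rs , R₁ = r R in a , t₁ , b , iter-exit body rs , R₁) g

tri-next : ∀ {X E} {{fin : Finite X}} {body : X → Machine (X ⊎ E)} {x y s n s₁ m e s₂} →
           Tri (body x) s n (inj₁ y) s₁ → Tri (iter body y) s₁ m e s₂ → Tri (iter body x) s (n + m) e s₂
tri-next {body = body} {s = s} {n} {s₁} {m} (tri r g) (tri r′ g′) = tri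
  (λ R → let a , t₁ , b , rs , R₁ = r R
             a′ , t₂ , b′ , rs′ , R₂ = r′ R₁
         in a + a′ , t₂ , ≤-trans (+-mono-≤ b b′) (cost-+ {sz s} n m g) , iter-next body rs rs′ , R₂)
  (≤-trans g′ (≤-trans (+-monoˡ-≤ m g) (≤-reflexive (+-assoc (sz s) n m))))

tri-from : ∀ {E} {M : Machine E} {s u n e s′} → s ≡ u → Tri M s n e s′ → Tri M u n e s′
tri-from refl T = T

tri-to : ∀ {E} {M : Machine E} {s n e s′ u} → s′ ≡ u → Tri M s n e s′ → Tri M s n e u
tri-to refl T = T

tri-mach : ∀ {E} {M N : Machine E} {s n e s′} → M ≡ N → Tri M s n e s′ → Tri N s n e s′
tri-mach refl T = T

ret : ∀ {E} → E → Machine E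
ret e = act (λ a → e , a , stay)

tri-ret : ∀ {E} (e : E) s → Tri (ret e) s 1 e s
tri-ret e s = tri
  (λ { (rep {L} {z} bL bz refl) → 1 , _ , ≤-by (9 + 10 * sz s) (lemma (sz s)) ,
         act-stay (λ a → e , a , stay) {L} {mark ∷ cells s ++ z} refl , rep bL bz refl })
  (m≤m+n (sz s) 1)
  where
  lemma : ∀ a → 1 + (9 + 10 * a) ≡ 1 * (10 * (a + 1))
  lemma = solve-∀

insertAt : ℕ → Sym → Machine ⊤
insertAt i c = goto i >> insertHere c >> home

tri-insert : ∀ pre post s′ c → NonBlank c → cells s′ ≡ cells pre ++ c ∷ cells post →
             Tri (insertAt (length pre) c) (pre ++ post) 1 tt s′
tri-insert pre post s′ c nb eq = tri go grows
  where
  total : sz s′ ≡ sz pre + suc (sz post)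
  total = trans (sym (length-cells s′)) (trans (cong length eq) (trans (length-++ (cells pre))
            (cong₂ (λ a b → a + suc b) (length-cells pre) (length-cells post))))
  grows : sz s′ ≤ sz (pre ++ post) + 1
  grows = ≤-reflexive (trans total (trans (+-suc _ _) (trans (sym (+-comm _ 1)) (cong (_+ 1) (sym (sz-++ pre post))))))
  arith : ∀ a b → (1 + a + (1 + b)) + (2 + (1 + a + b)) + (5 + 8 * (a + b)) ≡ 1 * (10 * (a + b + 1))
  arith = solve-∀
  go : ∀ {t} → Rep (pre ++ post) t → ∃ λ m → ∃ λ t′ → m ≤ cost (sz (pre ++ post)) 1 ×
         RunTo (insertAt (length pre) c) t m tt t′ × Rep s′ t′
  go (rep {L} {z} bL bz refl) with insertHere-runs (cells post) c ((mark ∷ cells pre) ʳ++ L) (cells-nonBlank post) bz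
  ... | p , a , split , run₂ = _ , _ , bound ,
        bind-runs (goto (length pre) >> insertHere c) _
          (bind-runs (goto (length pre)) _ (refrom (cong (λ l → at L (mark ∷ l)) source) (goto-runs [] pre L (cells post ++ z))) run₂)
          (refrom (cong (λ l → at l (a ∷ tl z)) (++-ʳ++ (mark ∷ cells pre)))
            (home-runs′ (mark ∷ cells pre ++ p) a (tl z) nonBlanks bL)) ,
        rep (refl ∷ tl-blank bL) (tl-blank bz) (cong (λ l → at (blank ∷ tl L) (mark ∷ l)) target)
    where
    source : cells pre ++ (cells post ++ z) ≡ cells (pre ++ post) ++ z
    source = trans (sym (++-assoc (cells pre) _ _)) (cong (_++ z) (sym (cells-++ pre post)))
    whole : (cells pre ++ p) ++ a ∷ [] ≡ cells s′
    whole = trans (++-assoc (cells pre) p _) (trans (cong (cells pre ++_) (sym split)) (sym eq))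
    nonBlanks : All NonBlank (mark ∷ (cells pre ++ p) ++ a ∷ [])
    nonBlanks = refl ∷ subst (All NonBlank) (sym whole) (cells-nonBlank s′)
    target : (cells pre ++ p) ++ a ∷ tl z ≡ cells s′ ++ tl z
    target = trans (sym (++-assoc (cells pre ++ p) (a ∷ []) (tl z))) (cong (_++ tl z) whole)
    length-p : length p ≡ sz post
    length-p = suc-injective (trans (sym (trans (length-++ p) (+-comm _ 1)))
                 (trans (cong length (sym split)) (cong suc (length-cells post))))
    bound : (suc (sz pre) + suc (length (cells post))) + (2 + length (mark ∷ cells pre ++ p)) ≤ cost (sz (pre ++ post)) 1
    bound = subst₂ (λ u v → (suc (sz pre) + suc u) + (2 + suc v) ≤ cost (sz (pre ++ post)) 1)
      (sym (length-cells post))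
      (sym (trans (length-++ (cells pre)) (cong₂ _+_ (length-cells pre) length-p)))
      (subst (λ S → (1 + sz pre + (1 + sz post)) + (2 + (1 + sz pre + sz post)) ≤ cost S 1) (sym (sz-++ pre post))
        (≤-by (5 + 8 * (sz pre + sz post)) (arith (sz pre) (sz post))))

readBit : Sym → Maybe Bool
readBit b0 = just false
readBit b1 = just true
readBit _  = nothing

readStep : Sym → Maybe Bool × Sym × Move
readStep a = readBit a , a , stay

-- On an empty register this deletes the mark that ends it, hence the register itself.
deleteAt : ℕ → Machine (Maybe Bool)
deleteAt i = goto i >> act readStep >>= λ v → deleteHere >> home >> ret v

tri-delete : ∀ pre post s′ c r → cells post ≡ c ∷ r → cells s′ ≡ cells pre ++ r → All NonBlank r →
             Tri (deleteAt (length pre)) (pre ++ post) 1 (readBit c) s′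
tri-delete pre post s′ c r eqc eq nb = tri go (≤-trans shrinks (m≤m+n _ 1))
  where
  post-size : sz post ≡ suc (length r)
  post-size = trans (sym (length-cells post)) (cong length eqc)
  total : sz (pre ++ post) ≡ sz pre + suc (length r)
  total = trans (sz-++ pre post) (cong (sz pre +_) post-size)
  shrinks : sz s′ ≤ sz (pre ++ post)
  shrinks = begin
    sz s′                        ≡⟨ length-cells s′ ⟨
    length (cells s′)            ≡⟨ cong length eq ⟩
    length (cells pre ++ r)      ≡⟨ length-++ (cells pre) ⟩
    length (cells pre) + length r ≡⟨ cong (_+ length r) (length-cells pre) ⟩
    sz pre + length r            ≤⟨ +-monoʳ-≤ (sz pre) (n≤1+n _) ⟩
    sz pre + suc (length r)      ≡⟨ total ⟨
    sz (pre ++ post) ∎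
    where open ≤-Reasoning
  arith : ∀ a b → (1 + a + 1) + (((3 + 3 * b) + (2 + (a + b))) + 1) + (12 + 8 * a + 6 * b) ≡ 1 * (10 * (a + suc b + 1))
  arith = solve-∀
  go : ∀ {t} → Rep (pre ++ post) t → ∃ λ m → ∃ λ t′ → m ≤ cost (sz (pre ++ post)) 1 ×
         RunTo (deleteAt (length pre)) t m (readBit c) t′ × Rep s′ t′
  go (rep {L} {z} bL bz refl)
    with deleteHere-runs r c ((mark ∷ cells pre) ʳ++ L) nb bz
       -- The deletion ends with the head on the last remaining cell. Reversing the contents exposes
       -- that cell as `d`; it exists because of the leading mark.
       | (mark ∷ cells pre ++ r) ʳ++ [] in rev
  ... | z′ , bz′ , run₂ | [] = case trans (sym (length-ʳ++ (mark ∷ cells pre ++ r))) (cong length rev) of λ ()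
  ... | z′ , bz′ , run₂ | d ∷ p = _ , _ , bound ,
        bind-runs (goto (length pre) >> act readStep) (λ v → deleteHere >> home >> ret v)
          (bind-runs (goto (length pre)) (λ _ → act readStep)
            (refrom (cong (λ l → at L (mark ∷ l)) source) (goto-runs [] pre L (c ∷ r ++ z)))
            (act-stay readStep {(mark ∷ cells pre) ʳ++ L} {c ∷ r ++ z} refl))
          (bind-runs (deleteHere >> home) (λ _ → ret (readBit c))
            (bind-runs deleteHere (λ _ → home) run₂
              (refrom (cong (λ l → at (tl l) (hd l ∷ z′)) (sym reversed)) (home-runs p d z′ nonBlanks bL)))
            (refrom (cong (at (blank ∷ tl L)) (sym target))
              (act-stay (λ a → readBit c , a , stay) {blank ∷ tl L} {mark ∷ cells s′ ++ z′} refl))) ,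
        rep (refl ∷ tl-blank bL) bz′ refl
    where
    source : cells pre ++ (c ∷ r ++ z) ≡ cells (pre ++ post) ++ z
    source = trans (cong (λ l → cells pre ++ l ++ z) (sym eqc))
      (trans (sym (++-assoc (cells pre) _ _)) (cong (_++ z) (sym (cells-++ pre post))))
    reversed : r ʳ++ ((mark ∷ cells pre) ʳ++ L) ≡ d ∷ p ++ L
    reversed = trans (sym (++-ʳ++ (mark ∷ cells pre))) (trans (split-ʳ++ (mark ∷ cells pre ++ r) L) (cong (_++ L) rev))
    target : p ʳ++ (d ∷ z′) ≡ mark ∷ cells s′ ++ z′
    target = trans (cong (_ʳ++ z′) (sym rev)) (trans (ʳ++-ʳ++ (mark ∷ cells pre ++ r) {[]})
               (cong (λ l → mark ∷ l ++ z′) (sym eq)))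
    nonBlanks : All NonBlank (d ∷ p)
    nonBlanks = subst (All NonBlank) rev (All-ʳ++ (refl ∷ ++⁺ (cells-nonBlank pre) nb) [])
    length-p : length p ≡ sz pre + length r
    length-p = suc-injective (trans (cong length (sym rev)) (trans (length-ʳ++ (mark ∷ cells pre ++ r))
      (trans (+-identityʳ _) (cong suc (trans (length-++ (cells pre)) (cong (_+ length r) (length-cells pre)))))))
    bound : (suc (sz pre) + 1) + (((3 + 3 * length r) + (2 + length p)) + 1) ≤ cost (sz (pre ++ post)) 1
    bound = subst₂ (λ u S → (suc (sz pre) + 1) + (((3 + 3 * length r) + (2 + u)) + 1) ≤ cost S 1) (sym length-p) (sym total)
      (≤-by (12 + 8 * sz pre + 6 * length r) (arith (sz pre) (length r)))

push : ℕ → Bool → Machine ⊤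
push i b = insertAt i (toSym b)

tri-push : ∀ pre w post b → Tri (push (length pre) b) (pre ++ w ∷ post) 1 tt (pre ++ (b ∷ w) ∷ post)
tri-push pre w post b = tri-insert pre (w ∷ post) _ (toSym b) (toSym-nonBlank b) (cells-++ pre _)

new : ℕ → Machine ⊤
new i = insertAt i mark

tri-new : ∀ pre post → Tri (new (length pre)) (pre ++ post) 1 tt (pre ++ [] ∷ post)
tri-new pre post = tri-insert pre post _ mark refl (cells-++ pre _)

tri-pop : ∀ pre b w post → Tri (deleteAt (length pre)) (pre ++ (b ∷ w) ∷ post) 1 (just b) (pre ++ w ∷ post)
tri-pop pre b w post = subst (λ v → Tri (deleteAt (length pre)) (pre ++ (b ∷ w) ∷ post) 1 v (pre ++ w ∷ post)) (bit b)
  (tri-delete pre ((b ∷ w) ∷ post) (pre ++ w ∷ post) (toSym b) (cells (w ∷ post)) refl (cells-++ pre _) (cells-nonBlank (w ∷ post)))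
  where
  bit : ∀ b → readBit (toSym b) ≡ just b
  bit false = refl
  bit true  = refl

tri-remove : ∀ pre post → Tri (deleteAt (length pre)) (pre ++ [] ∷ post) 1 nothing (pre ++ post)
tri-remove pre post = tri-delete pre ([] ∷ post) (pre ++ post) mark (cells post) refl (cells-++ pre _) (cells-nonBlank post)

-- Loops, and polynomials bounding their cost

drainBody : ℕ → (Bool → Machine ⊤) → ⊤ → Machine (⊤ ⊎ ⊤)
drainBody i body _ = deleteAt i >>= λ { nothing → ret (inj₂ tt) ; (just b) → body b >> ret (inj₁ tt) }

drain : ℕ → (Bool → Machine ⊤) → Machine ⊤
drain i body = iter (drainBody i body) tt

module _ {A : Set} (Inv : ℕ → A → Set) (pre post : A → List Str) (g : A → Bool → A)
         (i C : ℕ) (body : Bool → Machine ⊤) (len : ∀ a → length (pre a) ≡ i)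
         (keep : ∀ k a b → Inv (suc k) a → Inv k (g a b))
         (spec : ∀ k a b w → Inv (suc k) a → length w ≡ k →
                 Tri (body b) (pre a ++ w ∷ post a) C tt (pre (g a b) ++ w ∷ post (g a b))) where

  -- The state `a` determines the registers around the drained one. `Inv k a` speaks of the moment
  -- when `k` bits are left, which lets a caller relate intermediate states to the input and bound
  -- them.
  tri-drain : ∀ w a → Inv (length w) a →
    Tri (drain i body) (pre a ++ w ∷ post a) (2 + length w * (2 + C)) tt (pre (foldl g a w) ++ post (foldl g a w))
  tri-drain [] a _ = tri-exit (tri-bind
    (tri-mach (cong deleteAt (len a)) (tri-remove (pre a) (post a))) (tri-ret (inj₂ tt) _))
  tri-drain (b ∷ w) a inv = weaken (≤-reflexive (arith (length w * (2 + C)) C)) (tri-next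
    (tri-bind (tri-mach (cong deleteAt (len a)) (tri-pop (pre a) b w (post a)))
      (tri-seq (spec (length w) a b w inv refl) (tri-ret (inj₁ tt) _)))
    (tri-drain w (g a b) (keep _ a b inv)))
    where
    arith : ∀ l c → (1 + (c + 1)) + (2 + l) ≡ 2 + (2 + c + l)
    arith = solve-∀

dropAt : ℕ → Machine ⊤
dropAt i = drain i (λ _ → ret tt)

tri-drop : ∀ pre w post → Tri (dropAt (length pre)) (pre ++ w ∷ post) (2 + length w * 3) tt (pre ++ post)
tri-drop pre w post = tri-drain (λ _ _ → ⊤) (λ _ → pre) (λ _ → post) (λ _ _ → tt) (length pre) 1 (λ _ → ret tt)
  (λ _ → refl) (λ _ _ _ _ → tt) (λ _ _ _ _ _ _ → tri-ret tt _) w tt tt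

-- Reading a register consumes it. Its bits go in reverse to a scratch register, whose draining
-- restores the order in two fresh registers at once, one on top and one at the old place.
copyAt : ℕ → Machine ⊤
copyAt i = new 0 >> drain (suc i) (push 0) >> new (suc i) >> new 0 >> drain 1 (λ b → push 0 b >> push (2 + i) b)

tri-copy : ∀ pre w post → Tri (copyAt (length pre)) (pre ++ w ∷ post) (7 + 7 * length w) tt (w ∷ pre ++ w ∷ post)
tri-copy pre w post = weaken (≤-reflexive count) (tri-to restored
  (tri-seq (tri-seq (tri-seq (tri-seq (tri-new [] _)
    (tri-drain (λ _ _ → ⊤) (λ a → a ∷ pre) (λ _ → post) (λ a b → b ∷ a) (suc (length pre)) 1 (push 0)
      (λ _ → refl) (λ _ _ _ _ → tt) (λ _ a b v _ _ → tri-push [] a (pre ++ v ∷ post) b) w [] tt))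
    (tri-new (u ∷ pre) post))
    (tri-new [] (u ∷ pre ++ [] ∷ post)))
    (tri-drain (λ _ _ → ⊤) (λ a → a ∷ []) (λ a → pre ++ a ∷ post) (λ a b → b ∷ a) 1 2 (λ b → push 0 b >> push (2 + length pre) b)
      (λ _ → refl) (λ _ _ _ _ → tt)
      (λ _ a b v _ _ → tri-seq (tri-push [] a (v ∷ pre ++ a ∷ post) b) (tri-push ((b ∷ a) ∷ v ∷ pre) a post b)) u [] tt)))
  where
  u : Str
  u = w ʳ++ []
  twice : u ʳ++ [] ≡ w
  twice = trans (ʳ++-ʳ++ w {[]}) (++-identityʳ w)
  restored : (u ʳ++ []) ∷ pre ++ (u ʳ++ []) ∷ post ≡ w ∷ pre ++ w ∷ post
  restored = cong (λ v → v ∷ pre ++ v ∷ post) twice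
  arith : ∀ l → (((1 + (2 + l * 3)) + 1) + 1) + (2 + l * 4) ≡ 7 + 7 * l
  arith = solve-∀
  count : (((1 + (2 + length w * 3)) + 1) + 1) + (2 + length u * 4) ≡ 7 + 7 * length w
  count = trans (cong (λ l → (((1 + (2 + length w * 3)) + 1) + 1) + (2 + l * 4)) (length-ʳ++[] w))
                (arith (length w))

-- Without subtraction all expressions are monotone, and composition `_⊙_` is a constructor because
-- the time of a chain of machines composes bounds.
data Poly : Set where
  const   : ℕ → Poly
  var     : Poly
  _⊕_ _⊗_ _⊙_ : Poly → Poly → Poly

infixl 6 _⊕_
infixl 7 _⊗_
infixr 8 _⊙_

⟦_⟧ : Poly → ℕ → ℕ
⟦ const c ⟧ n = c
⟦ var ⟧     n = n
⟦ p ⊕ q ⟧   n = ⟦ p ⟧ n + ⟦ q ⟧ n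
⟦ p ⊗ q ⟧   n = ⟦ p ⟧ n * ⟦ q ⟧ n
⟦ p ⊙ q ⟧   n = ⟦ p ⟧ (⟦ q ⟧ n)

⟦⟧-mono : ∀ p {m n} → m ≤ n → ⟦ p ⟧ m ≤ ⟦ p ⟧ n
⟦⟧-mono (const c) le = ≤-refl
⟦⟧-mono var       le = le
⟦⟧-mono (p ⊕ q)   le = +-mono-≤ (⟦⟧-mono p le) (⟦⟧-mono q le)
⟦⟧-mono (p ⊗ q)   le = *-mono-≤ (⟦⟧-mono p le) (⟦⟧-mono q le)
⟦⟧-mono (p ⊙ q)   le = ⟦⟧-mono p (⟦⟧-mono q le)

suc-power : ∀ d n l → suc (d * suc n ^ l) ≤ suc d * suc n ^ l
suc-power d n l = +-monoˡ-≤ (d * suc n ^ l) (m^n>0 (suc n) l)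

-- Powers of `suc n` are at least 1, so exponents may be raised freely and additive constants
-- absorbed; with base `n` this fails at `n = 0`.
shifted-bound : ∀ p → ∃ λ c → ∃ λ k → ∀ n → ⟦ p ⟧ n ≤ c * suc n ^ k
shifted-bound (const c) = c , 0 , λ n → ≤-reflexive (sym (*-identityʳ c))
shifted-bound var = 1 , 1 , λ n → ≤-trans (n≤1+n n) (≤-reflexive (sym (trans (+-identityʳ _) (*-identityʳ (suc n)))))
shifted-bound (p ⊕ q) with shifted-bound p | shifted-bound q
... | c , k , P | d , l , R = c + d , k + l , λ n → begin
  ⟦ p ⟧ n + ⟦ q ⟧ n                       ≤⟨ +-mono-≤ (P n) (R n) ⟩
  c * suc n ^ k + d * suc n ^ l           ≤⟨ +-mono-≤ (*-monoʳ-≤ c (^-monoʳ-≤ (suc n) (m≤m+n k l)))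
                                                       (*-monoʳ-≤ d (^-monoʳ-≤ (suc n) (m≤n+m l k))) ⟩
  c * suc n ^ (k + l) + d * suc n ^ (k + l) ≡⟨ *-distribʳ-+ _ c d ⟨
  (c + d) * suc n ^ (k + l) ∎
  where open ≤-Reasoning
shifted-bound (p ⊗ q) with shifted-bound p | shifted-bound q
... | c , k , P | d , l , R = c * d , k + l , λ n → begin
  ⟦ p ⟧ n * ⟦ q ⟧ n                     ≤⟨ *-mono-≤ (P n) (R n) ⟩
  (c * suc n ^ k) * (d * suc n ^ l)     ≡⟨ arith c d (suc n ^ k) (suc n ^ l) ⟩
  c * d * (suc n ^ k * suc n ^ l)       ≡⟨ cong (c * d *_) (^-distribˡ-+-* (suc n) k l) ⟨
  c * d * suc n ^ (k + l) ∎
  where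
  open ≤-Reasoning
  arith : ∀ c d x y → (c * x) * (d * y) ≡ c * d * (x * y)
  arith = solve-∀
shifted-bound (p ⊙ q) with shifted-bound p | shifted-bound q
... | c , k , P | d , l , R = c * suc d ^ k , l * k , λ n → begin
  ⟦ p ⟧ (⟦ q ⟧ n)                    ≤⟨ ⟦⟧-mono p (R n) ⟩
  ⟦ p ⟧ (d * suc n ^ l)              ≤⟨ P _ ⟩
  c * suc (d * suc n ^ l) ^ k        ≤⟨ *-monoʳ-≤ c (^-monoˡ-≤ k (suc-power d n l)) ⟩
  c * (suc d * suc n ^ l) ^ k        ≡⟨ cong (c *_) (^-distribʳ-* k (suc d) _) ⟩
  c * (suc d ^ k * (suc n ^ l) ^ k)  ≡⟨ *-assoc c _ _ ⟨
  c * suc d ^ k * (suc n ^ l) ^ k    ≡⟨ cong (c * suc d ^ k *_) (^-*-assoc (suc n) l k) ⟩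
  c * suc d ^ k * suc n ^ (l * k) ∎
  where
  open ≤-Reasoning
  ^-distribʳ-* : ∀ k x y → (x * y) ^ k ≡ x ^ k * y ^ k
  ^-distribʳ-* zero    x y = refl
  ^-distribʳ-* (suc k) x y = trans (cong (x * y *_) (^-distribʳ-* k x y)) (arith x y (x ^ k) (y ^ k))
    where
    arith : ∀ a b c d → a * b * (c * d) ≡ a * c * (b * d)
    arith = solve-∀

-- For positive `n` one has `suc n ≤ 2 * n`; the extra `2 ^ k` settles `n = 0` and gives the sum the
-- shape of `poly`.
suc^-bound : ∀ n k → suc n ^ k ≤ 2 ^ k * n ^ k + 2 ^ k
suc^-bound zero    k = ≤-trans (≤-reflexive (^-zeroˡ k)) (≤-trans (m^n>0 2 k) (m≤n+m (2 ^ k) _))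
suc^-bound (suc n) k = ≤-trans (^-monoˡ-≤ k double) (≤-trans (≤-reflexive (power k)) (m≤m+n _ (2 ^ k)))
  where
  double : suc (suc n) ≤ 2 * suc n
  double = s≤s (≤-trans (m≤m+n (suc n) n) (≤-reflexive (arith n)))
    where
    arith : ∀ n → suc n + n ≡ n + (suc n + 0)
    arith = solve-∀
  power : ∀ k → (2 * suc n) ^ k ≡ 2 ^ k * suc n ^ k
  power zero    = refl
  power (suc k) = trans (cong (2 * suc n *_) (power k)) (arith (suc n) (2 ^ k) (suc n ^ k))
    where
    arith : ∀ b c d → 2 * b * (c * d) ≡ 2 * c * (b * d)
    arith = solve-∀

opaque
  poly-bound : ∀ p → ∃ λ c → ∃ λ k → ∀ n → ⟦ p ⟧ n ≤ poly c k n
  poly-bound p =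
    let c , k , P = shifted-bound p
    in c * 2 ^ k , k , λ n → ≤-trans (P n) (≤-trans (*-monoʳ-≤ c (suc^-bound n k))
         (≤-reflexive (trans (*-distribˡ-+ c _ _) (cong (_+ c * 2 ^ k) (sym (*-assoc c _ _))))))

power : ℕ → Poly
power zero    = const 1
power (suc k) = var ⊗ power k

polyP : ℕ → ℕ → Poly
polyP c k = const c ⊗ power k ⊕ const c

⟦polyP⟧ : ∀ c k n → ⟦ polyP c k ⟧ n ≡ poly c k n
⟦polyP⟧ c k n = cong (λ x → c * x + c) (⟦power⟧ k)
  where
  ⟦power⟧ : ∀ k → ⟦ power k ⟧ n ≡ n ^ k
  ⟦power⟧ zero    = refl
  ⟦power⟧ (suc k) = cong (n *_) (⟦power⟧ k)

-- Polynomial-time maps between tuples of strings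

Env : ℕ → Set
Env zero    = ⊤
Env (suc k) = Str × Env k

st : ∀ k → Env k → List Str → List Str
st zero    _       r = r
st (suc k) (w , x) r = w ∷ st k x r

size : ∀ k → Env k → ℕ
size zero    _       = 0
size (suc k) (w , x) = suc (length w + size k x)

sz-st : ∀ k x r → sz (st k x r) ≡ size k x + sz r
sz-st zero    x       r = refl
sz-st (suc k) (w , x) r = cong suc (trans (cong (length w +_) (sz-st k x r)) (sym (+-assoc (length w) _ _)))

st-++ : ∀ k x r → st k x r ≡ st k x [] ++ r
st-++ zero    x       r = refl
st-++ (suc k) (w , x) r = cong (w ∷_) (st-++ k x r)

length-st : ∀ k x → length (st k x []) ≡ k
length-st zero    x       = refl
length-st (suc k) (w , x) = cong suc (length-st k x)

-- The machine replaces the top k registers by m registers and leaves those below untouched.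
record PF (k m : ℕ) (f : Env k → Env m) : Set₁ where
  field
    mach : Machine ⊤
    time : Poly
    spec : ∀ x r → Tri mach (st k x r) (⟦ time ⟧ (size k x)) tt (st m (f x) r)

open PF

-- An operation lengthens the tape by at most one cell, so the time bound is also a bound on the
-- output.
pf-size : ∀ {k m f} (F : PF k m f) x → size m (f x) ≤ size k x + ⟦ time F ⟧ (size k x)
pf-size {k} {m} {f} F x = subst₂ (λ a b → a ≤ b + ⟦ time F ⟧ (size k x))
  (trans (sz-st m (f x) []) (+-identityʳ _)) (trans (sz-st k x []) (+-identityʳ _)) (grow (spec F x []))

opaque
  -- `PF` is indexed by the function itself; this replaces an appeal to function extensionality.
  resp : ∀ {k m f g} → (∀ x → f x ≡ g x) → PF k m f → PF k m g
  resp {k} {m} eq F = record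
    { mach = mach F ; time = time F
    ; spec = λ x r → tri-to (cong (λ y → st m y r) (eq x)) (spec F x r) }

infixl 4 _▸_

opaque
  _▸_ : ∀ {k m l f g} → PF k m f → PF m l g → PF k l (λ x → g (f x))
  _▸_ {f = f} F G = record
    { mach = mach F >> mach G
    ; time = time F ⊕ time G ⊙ (var ⊕ time F)
    ; spec = λ x r → tri-seq (spec F x r) (weaken (⟦⟧-mono (time G) (pf-size F x)) (spec G (f x) r)) }

takeE : ∀ k {j} → Env (k + j) → Env k
takeE zero    _       = tt
takeE (suc k) (w , x) = w , takeE k x

dropE : ∀ k {j} → Env (k + j) → Env j
dropE zero    x       = x
dropE (suc k) (_ , x) = dropE k x

appE : ∀ k {j} → Env k → Env j → Env (k + j)
appE zero    _       y = y
appE (suc k) (w , x) y = w , appE k x y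

st-takeE : ∀ k j x r → st (k + j) x r ≡ st k (takeE k x) (st j (dropE k x) r)
st-takeE zero    j x       r = refl
st-takeE (suc k) j (w , x) r = cong (w ∷_) (st-takeE k j x r)

st-appE : ∀ k j x y r → st (k + j) (appE k x y) r ≡ st k x (st j y r)
st-appE zero    j x       y r = refl
st-appE (suc k) j (w , x) y r = cong (w ∷_) (st-appE k j x y r)

size-takeE : ∀ k j x → size k (takeE k {j} x) ≤ size (k + j) x
size-takeE zero    j x       = z≤n
size-takeE (suc k) j (w , x) = s≤s (+-monoʳ-≤ (length w) (size-takeE k j x))

opaque
  frame : ∀ j {k m f} → PF k m f → PF (k + j) (m + j) (λ x → appE m (f (takeE k x)) (dropE k x))
  frame j {k} {m} {f} F = record
    { mach = mach F ; time = time F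
    ; spec = λ x r → tri-from (sym (st-takeE k j x r)) (tri-to (sym (st-appE m j _ _ r))
        (weaken (⟦⟧-mono (time F) (size-takeE k j x)) (spec F (takeE k x) (st j (dropE k x) r)))) }

lookupE : ∀ k → Env k → Fin k → Str
lookupE (suc k) (w , x) Fin.zero    = w
lookupE (suc k) (w , x) (Fin.suc i) = lookupE k x i

renE : ∀ {k m} → Vec (Fin k) m → Env k → Env m
renE {k} []       x = tt
renE {k} (i ∷ is) x = lookupE k x i , renE is x

lookupE-split : ∀ k x i r → ∃ λ pre → ∃ λ post →
  st k x r ≡ pre ++ lookupE k x i ∷ post × length pre ≡ toℕ i × length (lookupE k x i) ≤ size k x
lookupE-split (suc k) (w , x) Fin.zero    r = [] , st k x r , refl , refl , m≤n⇒m≤1+n (m≤m+n _ _)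
lookupE-split (suc k) (w , x) (Fin.suc i) r with lookupE-split k x i r
... | pre , post , eq , len , le =
  w ∷ pre , post , cong (w ∷_) eq , cong suc len , m≤n⇒m≤1+n (≤-trans le (m≤n+m _ (length w)))

-- `d` registers lie above the environment. The entries are copied from last to first, and after `m`
-- copies the source lies `m` places deeper, hence the index `m + (d + toℕ i)`.
copyFrom : ∀ {k m} → ℕ → Vec (Fin k) m → Machine ⊤
copyFrom d []                 = ret tt
copyFrom d (_∷_ {n = m} i is) = copyFrom d is >> copyAt (m + (d + toℕ i))

tri-copyFrom : ∀ {k m} d (is : Vec (Fin k) m) P x r → length P ≡ d →
  Tri (copyFrom d is) (P ++ st k x r) (1 + m * (7 + 7 * size k x)) tt (st m (renE is x) (P ++ st k x r))
tri-copyFrom d [] P x r _ = tri-ret tt _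
tri-copyFrom {k} d (_∷_ {n = m} i is) P x r len with lookupE-split k x i r
... | pre , post , eq , leni , le = weaken count
  (tri-seq (tri-copyFrom d is P x r len)
    (tri-mach (cong copyAt index) (tri-from (sym whole) (tri-to (cong (lookupE k x i ∷_) (sym whole))
      (tri-copy (st m (renE is x) [] ++ P ++ pre) (lookupE k x i) post)))))
  where
  whole : st m (renE is x) (P ++ st k x r) ≡ (st m (renE is x) [] ++ P ++ pre) ++ lookupE k x i ∷ post
  whole = trans (st-++ m _ _) (trans (cong (λ s → st m (renE is x) [] ++ P ++ s) eq)
    (trans (cong (st m (renE is x) [] ++_) (sym (++-assoc P pre _))) (sym (++-assoc (st m (renE is x) []) _ _))))
  index : length (st m (renE is x) [] ++ P ++ pre) ≡ m + (d + toℕ i)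
  index = trans (length-++ (st m (renE is x) [])) (cong₂ _+_ (length-st m _) (trans (length-++ P) (cong₂ _+_ len leni)))
  count : 1 + m * (7 + 7 * size k x) + (7 + 7 * length (lookupE k x i)) ≤ 1 + suc m * (7 + 7 * size k x)
  count = s≤s (≤-trans (+-monoʳ-≤ (m * (7 + 7 * size k x)) (+-monoʳ-≤ 7 (*-monoʳ-≤ 7 le)))
                       (≤-reflexive (+-comm (m * (7 + 7 * size k x)) _)))

dropsAt : ℕ → ℕ → Machine ⊤
dropsAt d zero    = ret tt
dropsAt d (suc k) = dropAt d >> dropsAt d k

tri-drops : ∀ d k P x r → length P ≡ d → Tri (dropsAt d k) (P ++ st k x r) (1 + 3 * size k x) tt (P ++ r)
tri-drops d zero    P x       r len = tri-ret tt _
tri-drops d (suc k) P (w , x) r refl = weaken (≤-by 1 (arith (length w) (size k x)))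
  (tri-seq (tri-drop P w (st k x r)) (tri-drops d k P x r refl))
  where
  arith : ∀ a b → 2 + a * 3 + (1 + 3 * b) + 1 ≡ 1 + 3 * suc (a + b)
  arith = solve-∀

opaque
  ren : ∀ {k m} (is : Vec (Fin k) m) → PF k m (renE is)
  ren {k} {m} is = record
    { mach = copyFrom 0 is >> dropsAt m k
    ; time = const 1 ⊕ const m ⊗ (const 7 ⊕ const 7 ⊗ var) ⊕ (const 1 ⊕ const 3 ⊗ var)
    ; spec = λ x r → tri-seq (tri-copyFrom 0 is [] x r refl)
        (tri-from (sym (st-++ m (renE is x) (st k x r))) (tri-to (sym (st-++ m (renE is x) r))
          (tri-drops m k (st m (renE is x) []) x r (length-st m _)))) }

renE-suc : ∀ {k m} (is : Vec (Fin k) m) w x → renE (Vec.map Fin.suc is) (w , x) ≡ renE is x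
renE-suc []       w x = refl
renE-suc (i ∷ is) w x = cong (_ ,_) (renE-suc is w x)

vars : ∀ k → Vec (Fin k) k
vars zero    = []
vars (suc k) = Fin.zero ∷ Vec.map Fin.suc (vars k)

renE-vars : ∀ k x → renE (vars k) x ≡ x
renE-vars zero    x       = refl
renE-vars (suc k) (w , x) = cong (w ,_) (trans (renE-suc (vars k) w x) (renE-vars k x))

tri-dup : ∀ k d P x r → length P ≡ d →
  Tri (copyFrom d (vars k)) (P ++ st k x r) (1 + k * (7 + 7 * size k x)) tt (st k x (P ++ st k x r))
tri-dup k d P x r len = tri-to (cong (λ y → st k y (P ++ st k x r)) (renE-vars k x)) (tri-copyFrom d (vars k) P x r len)

infixr 5 _&_

opaque
  -- Both machines consume their arguments, so each gets its own copy of the environment. `F` runs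
  -- before `G` because its results belong below.
  _&_ : ∀ {k j m g f} → PF k j g → PF k m f → PF k (j + m) (λ x → appE j (g x) (f x))
  _&_ {k} {j} {m} {g} {f} G F = record
    { mach = copyFrom 0 (vars k) >> mach F >> copyFrom m (vars k) >> mach G >> dropsAt (j + m) k
    ; time = dup ⊕ time F ⊕ dup ⊕ time G ⊕ (const 1 ⊕ const 3 ⊗ var)
    ; spec = λ x r → let P = st m (f x) [] in
        tri-to (sym (trans (st-appE j m (g x) (f x) r) (trans (st-++ j (g x) _)
                 (trans (cong (st j (g x) [] ++_) (st-++ m (f x) r)) (sym (++-assoc (st j (g x) []) P r))))))
        (tri-seq (tri-seq (tri-seq (tri-seq
          (tri-dup k 0 [] x r refl)
          (tri-to (st-++ m (f x) (st k x r)) (spec F x (st k x r))))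
          (tri-dup k m P x r (length-st m (f x))))
          (tri-to (trans (st-++ j (g x) (P ++ st k x r)) (sym (++-assoc (st j (g x) []) P (st k x r))))
            (spec G x (P ++ st k x r))))
          (tri-drops (j + m) k (st j (g x) [] ++ P) x r
            (trans (length-++ (st j (g x) [])) (cong₂ _+_ (length-st j (g x)) (length-st m (f x)))))) }
    where
    dup : Poly
    dup = const 1 ⊕ const k ⊗ (const 7 ⊕ const 7 ⊗ var)

opaque
  idP : ∀ {k} → PF k k (λ x → x)
  idP = record { mach = ret tt ; time = const 1 ; spec = λ x r → tri-ret tt _ }

opaque
  nilP : PF 0 1 (λ _ → [] , tt)
  nilP = record { mach = new 0 ; time = const 1 ; spec = λ x r → tri-new [] r }

opaque
  consP : ∀ b → PF 1 1 (λ (w , _) → b ∷ w , tt)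
  consP b = record { mach = push 0 b ; time = const 1 ; spec = λ (w , _) r → tri-push [] w r b }

caseE : ∀ {A : Set} {k} → (Env k → A) → (Env (suc k) → A) → (Env (suc k) → A) → Env (suc k) → A
caseE e f g ([] , x)        = e x
caseE e f g (false ∷ w , x) = f (w , x)
caseE e f g (true ∷ w , x)  = g (w , x)

opaque
  caseP : ∀ {k m e f g} → PF k m e → PF (suc k) m f → PF (suc k) m g → PF (suc k) m (caseE e f g)
  caseP {k} {m} {e} {f} {g} E F G = record
    { mach = deleteAt 0 >>= branch
    ; time = const 1 ⊕ (time E ⊕ time F ⊕ time G)
    ; spec = correct }
    where
    branch : Maybe Bool → Machine ⊤
    branch nothing      = mach E
    branch (just false) = mach F
    branch (just true)  = mach G
    correct : ∀ x r → Tri (deleteAt 0 >>= branch) (st (suc k) x r)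
                (1 + (⟦ time E ⟧ (size (suc k) x) + ⟦ time F ⟧ (size (suc k) x) + ⟦ time G ⟧ (size (suc k) x)))
                tt (st m (caseE e f g x) r)
    correct ([] , x) r = tri-bind (tri-remove [] (st k x r)) (weaken
      (≤-trans (⟦⟧-mono (time E) (n≤1+n _)) (≤-trans (m≤m+n _ _) (m≤m+n _ _))) (spec E x r))
    correct (false ∷ w , x) r = tri-bind (tri-pop [] false w (st k x r)) (weaken
      (≤-trans (⟦⟧-mono (time F) (n≤1+n _)) (≤-trans (m≤n+m _ (⟦ time E ⟧ (size (suc k) (false ∷ w , x)))) (m≤m+n _ _)))
      (spec F (w , x) r))
    correct (true ∷ w , x) r = tri-bind (tri-pop [] true w (st k x r)) (weaken
      (≤-trans (⟦⟧-mono (time G) (n≤1+n _)) (m≤n+m _ _)) (spec G (w , x) r))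

foldE : ∀ {m} → (Bool → Env m → Env m) → Env m → Str → Env m
foldE g = foldl (λ a b → g b a)

opaque
  -- A polynomial-time body alone is not enough, since iteration could double the state each time.
  -- The bound `B` is applied to the prefixes `u` of the looped string, that is, to all intermediate
  -- states.
  loopP : ∀ {m} {g : Bool → Env m → Env m} (B : Poly) →
          (∀ x u → size m (foldE g x u) ≤ ⟦ B ⟧ (size m x + length u)) → (∀ b → PF m m (g b)) →
          PF (m + 1) m (λ x → foldE g (takeE m x) (proj₁ (dropE m x)))
  loopP {m} {g} B bounded body = record
    { mach = drain m (λ b → mach (body b))
    ; time = const 2 ⊕ var ⊗ (const 2 ⊕ C)
    ; spec = λ x r → tri-from (sym (trans (st-takeE m 1 x r) (st-++ m (takeE m x) _)))
        (tri-to (sym (st-++ m _ r)) (correct (takeE m x) (proj₁ (dropE m x)) r (size (m + 1) x) (total x))) }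
    where
    C : Poly
    C = (time (body false) ⊕ time (body true)) ⊙ B
    total : ∀ x → size m (takeE m x) + length (proj₁ (dropE m {1} x)) ≤ size (m + 1) x
    total x = ≤-trans (+-monoʳ-≤ (size m (takeE m x)) (≤-trans (m≤m+n _ 0) (n≤1+n _))) (≤-reflexive (sym (go m x)))
      where
      go : ∀ m (x : Env (m + 1)) → size (m + 1) x ≡ size m (takeE m x) + size 1 (dropE m {1} x)
      go zero    x       = refl
      go (suc m) (w , x) = cong suc (trans (cong (length w +_) (go m x)) (sym (+-assoc (length w) _ _)))
    branch-time : ∀ b n → ⟦ time (body b) ⟧ n ≤ ⟦ time (body false) ⊕ time (body true) ⟧ n
    branch-time false n = m≤m+n _ _
    branch-time true  n = m≤n+m _ _
    correct : ∀ x w r n → size m x + length w ≤ n →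
              Tri (drain m (λ b → mach (body b))) (st m x [] ++ w ∷ r)
                  (2 + n * (2 + ⟦ C ⟧ n)) tt (st m (foldE g x w) [] ++ r)
    correct x w r n le = weaken (+-monoʳ-≤ 2 (*-monoˡ-≤ _ (≤-trans (m≤n+m (length w) (size m x)) le)))
      (tri-drain Inv (λ a → st m a []) (λ _ → r) (λ a b → g b a) m (⟦ C ⟧ n) (λ b → mach (body b))
        (length-st m) keep
        (λ { _ a b v (u , refl , e) _ → tri-from (st-++ m a (v ∷ r)) (tri-to (st-++ m (g b a) (v ∷ r)) (weaken
          (≤-trans (branch-time b (size m a)) (⟦⟧-mono (time (body false) ⊕ time (body true)) (≤-trans (bounded x u)
            (⟦⟧-mono B (≤-trans (+-monoʳ-≤ (size m x) (≤-trans (m≤m+n _ _) (≤-reflexive e))) le)))))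
          (spec (body b) a (v ∷ r)))) })
        w x ([] , refl , refl))
      where
      Inv : ℕ → Env m → Set
      Inv k a = Σ Str λ u → (a ≡ foldE g x u) × length u + k ≡ length w
      keep : ∀ k a b → Inv (suc k) a → Inv k (g b a)
      keep k a b (u , refl , e) = u ++ b ∷ [] , sym (foldl-++ _ x u (b ∷ [])) ,
        trans (cong (_+ k) (trans (length-++ u) (+-comm _ 1))) (trans (sym (+-suc (length u) k)) e)

opaque
  loop-const : ∀ {m} {g : Bool → Env m → Env m} c → (∀ b x → size m (g b x) ≤ size m x + c) → (∀ b → PF m m (g b)) →
               PF (m + 1) m (λ x → foldE g (takeE m x) (proj₁ (dropE m x)))
  loop-const {m} {g} c le = loopP (const (suc c) ⊗ var) bounded
    where
    growth : ∀ u x → size m (foldE g x u) ≤ size m x + c * length u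
    growth []      x = m≤m+n _ _
    growth (b ∷ u) x = ≤-trans (growth u (g b x)) (≤-trans (+-monoˡ-≤ _ (le b x))
      (≤-reflexive (trans (+-assoc (size m x) c _) (cong (size m x +_) (sym (*-suc c (length u)))))))
    bounded : ∀ x u → size m (foldE g x u) ≤ suc c * (size m x + length u)
    bounded x u = ≤-trans (growth u x) (+-mono-≤ (m≤m+n (size m x) (length u)) (*-monoʳ-≤ c (m≤n+m (length u) (size m x))))

-- A library of polynomial-time functions

Fn : ∀ k → (Env k → Str) → Set₁
Fn k f = PF k 1 (λ x → f x , tt)

v : ∀ {k} (i : Fin k) → Fn k (λ x → lookupE k x i)
v i = ren (i ∷ [])

constP : ∀ {k} (w : Str) → Fn k (λ _ → w)
constP {k} []      = ren {k} [] ▸ nilP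
constP     (b ∷ w) = constP w ▸ consP b

-- Truth is coded by non-emptiness, so a test is one `caseP`, and the remainder of a string can
-- itself serve as a truth value.
toB : Str → Bool
toB []      = false
toB (_ ∷ _) = true

bs : Bool → Str
bs true  = true ∷ []
bs false = []

toB-bs : ∀ b → toB (bs b) ≡ b
toB-bs true  = refl
toB-bs false = refl

opaque
  tailP : ∀ {k} → PF (suc k) k proj₂
  tailP {k} = record
    { mach = dropAt 0 ; time = const 2 ⊕ const 3 ⊗ var
    ; spec = λ (w , x) r → weaken (+-monoʳ-≤ 2 (≤-trans (≤-reflexive (*-comm (length w) 3))
        (*-monoʳ-≤ 3 (≤-trans (m≤m+n (length w) (size k x)) (n≤1+n _))))) (tri-drop [] w (st k x r)) }

ifP : ∀ {k m c a b} → Fn k c → PF k m a → PF k m b → PF k m (λ x → if toB (c x) then a x else b x)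
ifP {c = c} C A B = resp (λ x → choose (c x) x) (C & idP ▸ caseP B (tailP ▸ A) (tailP ▸ A))
  where
  choose : ∀ w x → caseE _ _ _ (w , x) ≡ (if toB w then _ else _)
  choose []          x = refl
  choose (false ∷ w) x = refl
  choose (true ∷ w)  x = refl

testP : ∀ {k c} → Fn k c → Fn k (λ x → bs (toB (c x)))
testP {c = c} C = resp (λ x → cong (_, tt) (normal-form (c x))) (resp (λ x → push-if (toB (c x))) (ifP C (constP (bs true)) (constP (bs false))))
  where
  push-if : ∀ b → (if b then (bs true , tt) else (bs false , tt)) ≡ ((if b then bs true else bs false) , tt)
  push-if true  = refl
  push-if false = refl
  normal-form : ∀ w → (if toB w then bs true else bs false) ≡ bs (toB w)
  normal-form []      = refl
  normal-form (_ ∷ _) = refl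

andP : ∀ {k} {a b : Env k → Bool} → Fn k (λ x → bs (a x)) → Fn k (λ x → bs (b x)) → Fn k (λ x → bs (a x ∧ b x))
andP {a = a} {b} A B = resp (λ x → go (a x) (b x)) (ifP A B (constP []))
  where
  go : ∀ p q → (if toB (bs p) then (bs q , tt) else ([] , tt)) ≡ (bs (p ∧ q) , tt)
  go true  q = refl
  go false q = refl

orP : ∀ {k} {a b : Env k → Bool} → Fn k (λ x → bs (a x)) → Fn k (λ x → bs (b x)) → Fn k (λ x → bs (a x ∨ b x))
orP {a = a} {b} A B = resp (λ x → go (a x) (b x)) (ifP A (constP (bs true)) B)
  where
  go : ∀ p q → (if toB (bs p) then (bs true , tt) else (bs q , tt)) ≡ (bs (p ∨ q) , tt)
  go true  q = refl
  go false q = refl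

notP : ∀ {k} {a : Env k → Bool} → Fn k (λ x → bs (a x)) → Fn k (λ x → bs (not (a x)))
notP {a = a} A = resp (λ x → go (a x)) (ifP A (constP []) (constP (bs true)))
  where
  go : ∀ p → (if toB (bs p) then ([] , tt) else (bs true , tt)) ≡ (bs (not p) , tt)
  go true  = refl
  go false = refl

foldP : (h : Str → Bool → Str) → ∀ c → (∀ a b → length (h a b) ≤ length a + c) →
        (∀ b → Fn 1 (λ (a , _) → h a b)) → Fn 2 (λ (a , w , _) → foldl h a w)
foldP h c le H = resp (λ (a , w , _) → single a w) (loop-const c
  (λ b (a , _) → s≤s (subst₂ _≤_ (sym (+-identityʳ _)) (cong (_+ c) (sym (+-identityʳ _))) (le a b))) H)
  where
  single : ∀ a w → foldE (λ b (a , _) → h a b , tt) (a , tt) w ≡ (foldl h a w , tt)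
  single a []      = refl
  single a (b ∷ w) = single (h a b) w

revOntoP : Fn 2 (λ (a , w , _) → w ʳ++ a)
revOntoP = foldP (λ a b → b ∷ a) 1 (λ a b → ≤-reflexive (+-comm 1 (length a))) consP

revP : Fn 1 (λ (w , _) → w ʳ++ [])
revP = constP [] & v 0F ▸ revOntoP

pairP : Fn 2 (λ (x , y , _) → pair x y)
pairP = resp (λ (x , y , _) → cong (_, tt) (trans (foldl-ʳ++ _ _ x {[]}) (double x y)))
  ((v 1F ▸ consP true ▸ consP false) & (v 0F ▸ revP)
   ▸ foldP (λ a b → b ∷ b ∷ a) 2 (λ a b → ≤-reflexive (+-comm 2 (length a))) (λ b → consP b ▸ consP b))
  where
  double : ∀ x y → foldr (λ b a → b ∷ b ∷ a) (false ∷ true ∷ y) x ≡ pair x y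
  double []      y = refl
  double (b ∷ x) y = cong (λ w → b ∷ b ∷ w) (double x y)

tailS : Str → Str
tailS []      = []
tailS (_ ∷ w) = w

tailSP : Fn 1 (λ (w , _) → tailS w)
tailSP = resp (λ { ([] , _) → refl ; (false ∷ _ , _) → refl ; (true ∷ _ , _) → refl }) (caseP (constP []) idP idP)

dropBy : Str → Str → Str
dropBy w u = foldl (λ a _ → tailS a) w u

dropByP : Fn 2 (λ (w , u , _) → dropBy w u)
dropByP = foldP (λ a _ → tailS a) 0 shrink (λ _ → tailSP)
  where
  shrink : ∀ (a : Str) (b : Bool) → length (tailS a) ≤ length a + 0
  shrink []      b = z≤n
  shrink (_ ∷ a) b = m≤n⇒m≤1+n (m≤m+n _ 0)

-- The sentinel bit in front of `w` makes the remainder non-empty also when the lengths are equal.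
_≤ₗ_ : Str → Str → Bool
u ≤ₗ w = toB (dropBy (true ∷ w) u)

≤ₗP : Fn 2 (λ (u , w , _) → bs (u ≤ₗ w))
≤ₗP = testP ((v 1F ▸ consP true) & v 0F ▸ dropByP)

dropBy-empty : ∀ u → dropBy [] u ≡ []
dropBy-empty []      = refl
dropBy-empty (_ ∷ u) = dropBy-empty u

≤ₗ-sound : ∀ u w → u ≤ₗ w ≡ true → length u ≤ length w
≤ₗ-sound []          w       _  = z≤n
≤ₗ-sound (_ ∷ u)     (c ∷ w) eq = s≤s (≤ₗ-sound u w (trans (sentinel u c true w) eq))
  where
  sentinel : ∀ u c d w → toB (dropBy (d ∷ w) u) ≡ toB (dropBy (c ∷ w) u)
  sentinel []      c d w = refl
  sentinel (_ ∷ u) c d w = refl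
≤ₗ-sound (_ ∷ u)     []      eq = case trans (sym (cong toB (dropBy-empty u))) eq of λ ()

≤ₗ-complete : ∀ u w → length u ≤ length w → u ≤ₗ w ≡ true
≤ₗ-complete u w le = go u true w (s≤s le)
  where
  go : ∀ u c w → length u < suc (length w) → toB (dropBy (c ∷ w) u) ≡ true
  go []      c w       _         = refl
  go (_ ∷ u) c (d ∷ w) (s≤s lt) = go u d w lt

_<ₗ_ : Str → Str → Bool
[]          <ₗ []          = false
[]          <ₗ (_ ∷ _)     = true
(_ ∷ _)     <ₗ []          = false
(false ∷ a) <ₗ (true ∷ b)  = true
(true ∷ a)  <ₗ (false ∷ b) = false
(false ∷ a) <ₗ (false ∷ b) = a <ₗ b
(true ∷ a)  <ₗ (true ∷ b)  = a <ₗ b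

-- States of the comparison of a with b: false ∷ b′ while the prefixes read agree and b′ is
-- left of b, true ∷ _ once a < b is known, and [] once it is refuted.
ltStep : Str → Bool → Str
ltStep []                 _     = []
ltStep (true ∷ r)         _     = true ∷ r
ltStep (false ∷ [])       _     = []
ltStep (false ∷ false ∷ r) false = false ∷ r
ltStep (false ∷ false ∷ r) true  = []
ltStep (false ∷ true ∷ r)  false = true ∷ r
ltStep (false ∷ true ∷ r)  true  = false ∷ r

ltEnd : Str → Str
ltEnd []                = []
ltEnd (true ∷ _)        = bs true
ltEnd (false ∷ [])      = []
ltEnd (false ∷ _ ∷ _)   = bs true

<ₗP : Fn 2 (λ (a , b , _) → bs (a <ₗ b))
<ₗP = resp (λ (a , b , _) → cong (_, tt) (correct a b))
  ((v 1F ▸ consP false) & v 0F ▸ foldP ltStep 0 shrink step′ ▸ end)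
  where
  shrink : ∀ a b → length (ltStep a b) ≤ length a + 0
  shrink []                  b     = z≤n
  shrink (true ∷ r)          b     = s≤s (m≤m+n _ 0)
  shrink (false ∷ [])        b     = z≤n
  shrink (false ∷ false ∷ r) false = s≤s (m≤n⇒m≤1+n (m≤m+n _ 0))
  shrink (false ∷ false ∷ r) true  = z≤n
  shrink (false ∷ true ∷ r)  false = s≤s (m≤n⇒m≤1+n (m≤m+n _ 0))
  shrink (false ∷ true ∷ r)  true  = s≤s (m≤n⇒m≤1+n (m≤m+n _ 0))
  step′ : ∀ b → Fn 1 (λ (a , _) → ltStep a b)
  step′ false = resp (λ { ([] , _) → refl ; (true ∷ r , _) → refl ; (false ∷ [] , _) → refl
                        ; (false ∷ false ∷ r , _) → refl ; (false ∷ true ∷ r , _) → refl })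
    (caseP (constP []) (caseP (constP []) (consP false) (consP true)) (consP true))
  step′ true = resp (λ { ([] , _) → refl ; (true ∷ r , _) → refl ; (false ∷ [] , _) → refl
                       ; (false ∷ false ∷ r , _) → refl ; (false ∷ true ∷ r , _) → refl })
    (caseP (constP []) (caseP (constP []) (constP []) (consP false)) (consP true))
  end : Fn 1 (λ (a , _) → ltEnd a)
  end = resp (λ { ([] , _) → refl ; (true ∷ r , _) → refl ; (false ∷ [] , _) → refl
                ; (false ∷ false ∷ r , _) → refl ; (false ∷ true ∷ r , _) → refl })
    (caseP (constP []) (caseP (constP []) (constP (bs true)) (constP (bs true))) (constP (bs true)))
  known : ∀ a r → foldl ltStep (true ∷ r) a ≡ true ∷ r
  known []      r = refl
  known (_ ∷ a) r = known a r
  refuted : ∀ a → foldl ltStep [] a ≡ []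
  refuted []      = refl
  refuted (_ ∷ a) = refuted a
  correct : ∀ a b → ltEnd (foldl ltStep (false ∷ b) a) ≡ bs (a <ₗ b)
  correct []          []          = refl
  correct []          (_ ∷ _)     = refl
  correct (_ ∷ a)     []          = cong ltEnd (refuted a)
  correct (false ∷ a) (true ∷ b)  = cong ltEnd (known a b)
  correct (true ∷ a)  (false ∷ b) = cong ltEnd (refuted a)
  correct (false ∷ a) (false ∷ b) = correct a b
  correct (true ∷ a)  (true ∷ b)  = correct a b

_==ₗ_ : Str → Str → Bool
a ==ₗ b = not (a <ₗ b) ∧ not (b <ₗ a)

==ₗP : Fn 2 (λ (a , b , _) → bs (a ==ₗ b))
==ₗP = andP (notP <ₗP) (notP (v 1F & v 0F ▸ <ₗP))

-- Decoding is total, so guessed strings need no syntax check: every unequal pair of bits ends an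
-- item, and an unfinished item at the end is dropped. The current item is kept reversed in `cur`.
decode : Str → Str → List Str
decode cur []                  = []
decode cur (_ ∷ [])            = []
decode cur (false ∷ false ∷ w) = decode (false ∷ cur) w
decode cur (true ∷ true ∷ w)   = decode (true ∷ cur) w
decode cur (false ∷ true ∷ w)  = (cur ʳ++ []) ∷ decode [] w
decode cur (true ∷ false ∷ w)  = (cur ʳ++ []) ∷ decode [] w

decList : Str → List Str
decList = decode []

decode-pair : ∀ cur x y → decode cur (pair x y) ≡ ((x ʳ++ cur) ʳ++ []) ∷ decode [] y
decode-pair cur []          y = refl
decode-pair cur (false ∷ x) y = decode-pair (false ∷ cur) x y
decode-pair cur (true ∷ x)  y = decode-pair (true ∷ cur) x y

decList-pair : ∀ x y → decList (pair x y) ≡ x ∷ decList y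
decList-pair x y = trans (decode-pair [] x y) (cong (_∷ decList y) (trans (ʳ++-ʳ++ x {[]}) (++-identityʳ x)))

decList-encList : ∀ ys → decList (encList ys) ≡ ys
decList-encList []       = refl
decList-encList (y ∷ ys) = trans (decList-pair y (encList ys)) (cong (y ∷_) (decList-encList ys))

two-bits : ∀ (u w : Str) → suc (length u + length w) ≤ length u + suc (suc (length w))
two-bits u w = ≤-trans (n≤1+n _) (≤-reflexive (trans (cong suc (sym (+-suc (length u) (length w)))) (sym (+-suc (length u) (suc (length w))))))

sz-decode : ∀ cur w → sz (decode cur w) ≤ length cur + length w
sz-decode cur []                  = z≤n
sz-decode cur (_ ∷ [])            = z≤n
sz-decode cur (false ∷ false ∷ w) = ≤-trans (sz-decode (false ∷ cur) w) (two-bits cur w)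
sz-decode cur (true ∷ true ∷ w)   = ≤-trans (sz-decode (true ∷ cur) w) (two-bits cur w)
sz-decode cur (false ∷ true ∷ w)  = ≤-trans (s≤s (+-mono-≤ (≤-reflexive (length-ʳ++[] cur)) (sz-decode [] w))) (two-bits cur w)
sz-decode cur (true ∷ false ∷ w)  = ≤-trans (s≤s (+-mono-≤ (≤-reflexive (length-ʳ++[] cur)) (sz-decode [] w))) (two-bits cur w)

foldList : ∀ {m} → (Env (suc m) → Env m) → Env m → List Str → Env m
foldList h = foldl (λ a y → h (y , a))

-- One bit of an encoded list: the state holds the first bit of an unfinished pair, the
-- current item reversed, and the accumulators.
module _ {m : ℕ} (h : Env (suc m) → Env m) where

  listBit : Bool → Env (2 + m) → Env (2 + m)
  listBit b ([] , c , a)            = b ∷ [] , c , a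
  listBit false (false ∷ _ , c , a) = [] , false ∷ c , a
  listBit true (true ∷ _ , c , a)   = [] , true ∷ c , a
  listBit true (false ∷ _ , c , a)  = [] , [] , h (c ʳ++ [] , a)
  listBit false (true ∷ _ , c , a)  = [] , [] , h (c ʳ++ [] , a)

  -- Reachable states have at most one bit in `p`, but the size bound demanded by `loopP` concerns
  -- arbitrary states. Only the first bit of `p` is ever inspected, whence `take 1 p`.
  listBits-acc : ∀ p c a u → proj₂ (proj₂ (foldE listBit (p , c , a) u)) ≡ foldList h a (decode c (take 1 p ++ u))
  listBits-acc []          c a []          = refl
  listBits-acc []          c a (b ∷ u)     = listBits-acc (b ∷ []) c a u
  listBits-acc (_ ∷ _)     c a []          = refl
  listBits-acc (false ∷ _) c a (false ∷ u) = listBits-acc [] (false ∷ c) a u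
  listBits-acc (true ∷ _)  c a (true ∷ u)  = listBits-acc [] (true ∷ c) a u
  listBits-acc (false ∷ _) c a (true ∷ u)  = listBits-acc [] [] (h (c ʳ++ [] , a)) u
  listBits-acc (true ∷ _)  c a (false ∷ u) = listBits-acc [] [] (h (c ʳ++ [] , a)) u

  pending : Env (2 + m) → ℕ
  pending (p , c , _) = length p + length c

  listBit-pending : ∀ b x → pending (listBit b x) ≤ suc (pending x)
  listBit-pending b     ([] , c , a)        = ≤-refl
  listBit-pending false (false ∷ p , c , a) = s≤s (m≤n⇒m≤1+n (m≤n+m _ (length p)))
  listBit-pending true  (true ∷ p , c , a)  = s≤s (m≤n⇒m≤1+n (m≤n+m _ (length p)))
  listBit-pending true  (false ∷ p , c , a) = z≤n
  listBit-pending false (true ∷ p , c , a)  = z≤n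

  listBits-pending : ∀ u x → pending (foldE listBit x u) ≤ pending x + length u
  listBits-pending []      x = m≤m+n _ 0
  listBits-pending (b ∷ u) x = ≤-trans (listBits-pending u (listBit b x))
    (≤-trans (+-monoˡ-≤ (length u) (listBit-pending b x)) (≤-reflexive (sym (+-suc (pending x) (length u)))))

  listP : (B : Poly) → (∀ a ys → size m (foldList h a ys) ≤ ⟦ B ⟧ (size m a + sz ys)) → PF (suc m) m h →
          PF (m + 1) m (λ x → foldList h (takeE m x) (decList (proj₁ (dropE m x))))
  listP B bounded H = resp (λ x → listBits-acc [] [] (takeE m x) (proj₁ (dropE m x)))
    (constP [] & constP [] & idP ▸ loopP (const 2 ⊕ var ⊕ B ⊙ (const 1 ⊕ var)) bounded′ body ▸ tailP ▸ tailP)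
    where
    keepBit : ∀ b → PF (2 + m) (2 + m) (λ (p , c , a) → [] , b ∷ c , a)
    keepBit b = tailP ▸ frame m (consP b) ▸ constP [] & idP
    endItem : PF (2 + m) (2 + m) (λ (p , c , a) → [] , [] , h (c ʳ++ [] , a))
    endItem = tailP ▸ frame m revP ▸ H ▸ constP [] & constP [] & idP
    body : ∀ b → PF (2 + m) (2 + m) (listBit b)
    body false = resp (λ { ([] , c , a) → refl ; (false ∷ p , c , a) → refl ; (true ∷ p , c , a) → refl })
      (caseP (constP (false ∷ []) & idP) (keepBit false) endItem)
    body true  = resp (λ { ([] , c , a) → refl ; (false ∷ p , c , a) → refl ; (true ∷ p , c , a) → refl })
      (caseP (constP (true ∷ []) & idP) endItem (keepBit true))
    length-take1 : ∀ (p : Str) → length (take 1 p) ≤ 1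
    length-take1 []      = z≤n
    length-take1 (_ ∷ _) = ≤-refl
    bounded′ : ∀ x u → size (2 + m) (foldE listBit x u) ≤ 2 + (size (2 + m) x + length u) + ⟦ B ⟧ (1 + (size (2 + m) x + length u))
    bounded′ (p , c , a) u = begin
      size (2 + m) y                          ≡⟨ arith₁ (length (proj₁ y)) _ _ ⟩
      2 + pending y + size m (proj₂ (proj₂ y)) ≡⟨ cong (λ z → 2 + pending y + size m z) (listBits-acc p c a u) ⟩
      2 + pending y + size m (foldList h a (decode c (take 1 p ++ u)))
        ≤⟨ +-mono-≤ (+-monoʳ-≤ 2 (≤-trans (listBits-pending u (p , c , a)) (≤-by (2 + size m a) (arith₂ (length p) (length c) (size m a) (length u)))))
                    (≤-trans (bounded a (decode c (take 1 p ++ u))) (⟦⟧-mono B (≤-trans (+-monoʳ-≤ (size m a) (sz-decode c (take 1 p ++ u))) items))) ⟩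
      2 + (size (2 + m) (p , c , a) + length u) + ⟦ B ⟧ (1 + (size (2 + m) (p , c , a) + length u)) ∎
      where
      open ≤-Reasoning
      y : Env (2 + m)
      y = foldE listBit (p , c , a) u
      arith₁ : ∀ p c s → suc (p + suc (c + s)) ≡ 2 + (p + c) + s
      arith₁ = solve-∀
      arith₂ : ∀ p c s u → p + c + u + (2 + s) ≡ suc (p + suc (c + s)) + u
      arith₂ = solve-∀
      arith₃ : ∀ p c s u → s + (c + (1 + u)) + (2 + p) ≡ 1 + (suc (p + suc (c + s)) + u)
      arith₃ = solve-∀
      items : size m a + (length c + length (take 1 p ++ u)) ≤ 1 + (size (2 + m) (p , c , a) + length u)
      items = ≤-trans (+-monoʳ-≤ (size m a) (+-monoʳ-≤ (length c)
          (≤-trans (≤-reflexive (length-++ (take 1 p))) (+-monoˡ-≤ (length u) (length-take1 p)))))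
        (≤-by (2 + length p) (arith₃ (length p) (length c) (size m a) (length u)))

listP-const : ∀ {m} {h : Env (suc m) → Env m} c → (∀ y a → size m (h (y , a)) ≤ size m a + (c * suc (length y))) →
  PF (suc m) m h → PF (m + 1) m (λ x → foldList h (takeE m x) (decList (proj₁ (dropE m x))))
listP-const {m} {h} c le = listP h (const (suc c) ⊗ var) (λ a ys → ≤-trans (growth ys a)
    (+-mono-≤ (m≤m+n (size m a) (sz ys)) (*-monoʳ-≤ c (m≤n+m (sz ys) (size m a)))))
  where
  growth : ∀ ys a → size m (foldList h a ys) ≤ size m a + c * sz ys
  growth []       a = m≤m+n _ _
  growth (y ∷ ys) a = ≤-trans (growth ys (h (y , a))) (≤-trans (+-monoˡ-≤ _ (le y a)) (≤-reflexive (trans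
    (+-assoc (size m a) _ _) (cong (size m a +_) (sym (*-distribˡ-+ c (suc (length y)) (sz ys)))))))

-- The leading `true` distinguishes an item already found, possibly empty, from none.
firstItem : Str → List Str → Str
firstItem = foldl (λ a y → if toB a then a else true ∷ y)

fstS : Str → Str
fstS w = tailS (firstItem [] (decList w))

-- `pair (fstS w) []` is exactly as long as the part of a pair that precedes its second component.
sndS : Str → Str
sndS w = dropBy w (pair (fstS w) [])

fstP : Fn 1 (λ (w , _) → fstS w)
fstP = resp (λ (w , _) → cong (_, tt) (cong tailS (single [] (decList w))))
  (constP [] & idP ▸ listP-const {h = h} 1 small (resp (λ { (y , [] , _) → refl ; (y , _ ∷ _ , _) → refl }) pick) ▸ tailSP)
  where
  h : Env 2 → Env 1
  h (y , a , _) = (if toB a then a else true ∷ y) , tt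
  single : ∀ a ys → proj₁ (foldList h (a , tt) ys) ≡ firstItem a ys
  single a []       = refl
  single a (y ∷ ys) = single _ ys
  small : ∀ y a → size 1 (h (y , a)) ≤ size 1 a + (suc (length y) + 0)
  small y ([] , _)    = ≤-reflexive (arith (length y))
    where
    arith : ∀ y → suc (suc y + 0) ≡ 1 + (suc y + 0)
    arith = solve-∀
  small y (_ ∷ _ , _) = m≤m+n _ _
  pick : PF 2 1 (λ x → if toB (proj₁ (proj₂ x)) then (proj₁ (proj₂ x) , tt) else (true ∷ proj₁ x , tt))
  pick = ifP (v 1F) (v 1F) (v 0F ▸ consP true)

sndP : Fn 1 (λ (w , _) → sndS w)
sndP = idP & (fstP & constP [] ▸ pairP) ▸ dropByP

fstS-pair : ∀ x y → fstS (pair x y) ≡ x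
fstS-pair x y = trans (cong (λ l → tailS (firstItem [] l)) (decList-pair x y)) (cong tailS (found x (decList y)))
  where
  found : ∀ a ys → firstItem (true ∷ a) ys ≡ true ∷ a
  found a []       = refl
  found a (_ ∷ ys) = found a ys

sndS-pair : ∀ x y → sndS (pair x y) ≡ y
sndS-pair x y = trans (cong (λ z → dropBy (pair x y) (pair z [])) (fstS-pair x y)) (go x)
  where
  go : ∀ x → dropBy (pair x y) (pair x []) ≡ y
  go []      = refl
  go (_ ∷ x) = go x

-- Unary arithmetic and clocks

mulS : Str → Str → Str
mulS a b = foldl (λ c _ → b ʳ++ c) [] a

length-mulS : ∀ a b → length (mulS a b) ≡ length a * length b
length-mulS a b = trans (go a []) (+-identityʳ _)
  where
  go : ∀ a c → length (foldl (λ c _ → b ʳ++ c) c a) ≡ length a * length b + length c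
  go []      c = refl
  go (x ∷ a) c = trans (go a (b ʳ++ c)) (trans (cong (length a * length b +_) (length-ʳ++ b)) (arith (length a * length b) (length b) (length c)))
    where
    arith : ∀ p b c → p + (b + c) ≡ b + p + c
    arith = solve-∀

mulP : Fn 2 (λ (a , b , _) → mulS a b)
mulP = resp (λ (a , b , _) → cong (_, tt) (single [] b a))
  (constP [] & v 1F & v 0F
   ▸ loopP (var ⊕ var ⊗ var) bounded (λ _ → revOnto & v 1F)
   ▸ v 0F)
  where
  g : Bool → Env 2 → Env 2
  g _ (c , b , _) = b ʳ++ c , b , tt
  revOnto : Fn 2 (λ (c , b , _) → b ʳ++ c)
  revOnto = revOntoP
  single : ∀ c b a → proj₁ (foldE g (c , b , tt) a) ≡ foldl (λ c _ → b ʳ++ c) c a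
  single c b []      = refl
  single c b (_ ∷ a) = single (b ʳ++ c) b a
  exact : ∀ u c b → size 2 (foldE g (c , b , tt) u) ≡ size 2 (c , b , tt) + length u * length b
  exact []      c b = sym (+-identityʳ _)
  exact (_ ∷ u) c b = trans (exact u (b ʳ++ c) b) (trans
    (cong (λ l → suc (l + suc (length b + 0)) + length u * length b) (length-ʳ++ b)) (arith (length b) (length c) (length u * length b)))
    where
    arith : ∀ b c p → suc (b + c + suc (b + 0)) + p ≡ suc (c + suc (b + 0)) + (b + p)
    arith = solve-∀
  bounded : ∀ x u → size 2 (foldE g x u) ≤ (size 2 x + length u) + (size 2 x + length u) * (size 2 x + length u)
  bounded (c , b , tt) u = ≤-trans (≤-reflexive (exact u c b)) (+-mono-≤ (m≤m+n _ _)
    (*-mono-≤ (m≤n+m (length u) (size 2 (c , b , tt))) (≤-trans (≤-by (2 + length c) (arith (length b) (length c))) (m≤m+n _ (length u)))))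
    where
    arith : ∀ b c → b + (2 + c) ≡ suc (c + suc (b + 0))
    arith = solve-∀

powS : ℕ → Str → Str
powS zero    x = true ∷ []
powS (suc k) x = mulS x (powS k x)

length-powS : ∀ k x → length (powS k x) ≡ length x ^ k
length-powS zero    x = refl
length-powS (suc k) x = trans (length-mulS x (powS k x)) (cong (length x *_) (length-powS k x))

powP : ∀ k → Fn 1 (λ (x , _) → powS k x)
powP zero    = constP (true ∷ [])
powP (suc k) = idP & powP k ▸ mulP

unary : ℕ → Str
unary n = replicate n true

-- A polynomial bound is represented by a string of that length: it is the fuel of a simulation and
-- the yardstick for the length of a certificate.
clock : ℕ → ℕ → Str → Str
clock c k x = unary c ʳ++ mulS (unary c) (powS k x)

length-clock : ∀ c k x → length (clock c k x) ≡ poly c k (length x)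
length-clock c k x = trans (length-ʳ++ (unary c)) (trans (cong₂ _+_ (length-replicate c)
  (trans (length-mulS (unary c) (powS k x)) (cong₂ _*_ (length-replicate c) (length-powS k x)))) (+-comm c _))

clockP : ∀ c k → Fn 1 (λ (x , _) → clock c k x)
clockP c k = (constP (unary c) & powP k ▸ mulP) & constP (unary c) ▸ revOntoP

-- Simulating oracle machines

bit₁ bit₂ : Sym → Bool
bit₁ blank = false
bit₁ mark  = false
bit₁ b0    = true
bit₁ b1    = true
bit₂ blank = false
bit₂ mark  = true
bit₂ b0    = false
bit₂ b1    = true

fromBits : Bool → Bool → Sym
fromBits false false = blank
fromBits false true  = mark
fromBits true  false = b0
fromBits true  true  = b1

fromBits-bits : ∀ a → fromBits (bit₁ a) (bit₂ a) ≡ a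
fromBits-bits blank = refl
fromBits-bits mark  = refl
fromBits-bits b0    = refl
fromBits-bits b1    = refl

code : List Sym → Str
code []      = []
code (a ∷ l) = bit₁ a ∷ bit₂ a ∷ code l

length-code : ∀ l → length (code l) ≡ 2 * length l
length-code []      = refl
length-code (a ∷ l) = trans (cong (2 +_) (length-code l)) (sym (*-suc 2 (length l)))

pushSym : ℕ → Sym → Machine ⊤
pushSym i a = push i (bit₂ a) >> push i (bit₁ a)

tri-pushSym : ∀ pre l post a → Tri (pushSym (length pre) a) (pre ++ code l ∷ post) 2 tt (pre ++ code (a ∷ l) ∷ post)
tri-pushSym pre l post a = tri-seq (tri-push pre (code l) post (bit₂ a)) (tri-push pre (bit₂ a ∷ code l) post (bit₁ a))

popSecond : ℕ → Bool → Maybe Bool → Machine Sym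
popSecond i b nothing  = ret blank
popSecond i b (just c) = ret (fromBits b c)

popFirst : ℕ → Maybe Bool → Machine Sym
popFirst i nothing  = new i >> ret blank
popFirst i (just b) = deleteAt i >>= popSecond i b

-- An empty register stands for an endless stretch of blanks. Since popping from it removes the
-- register, `popFirst` has to create it anew.
popSym : ℕ → Machine Sym
popSym i = deleteAt i >>= popFirst i

tri-popSym : ∀ pre l post → Tri (popSym (length pre)) (pre ++ code l ∷ post) 3 (hd l) (pre ++ code (tl l) ∷ post)
tri-popSym pre [] post = tri-bind (tri-remove pre post) (tri-seq (tri-new pre post) (tri-ret blank _))
tri-popSym pre (a ∷ l) post = tri-bind (tri-pop pre (bit₁ a) (bit₂ a ∷ code l) post)
  (tri-bind (tri-pop pre (bit₂ a) (code l) post)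
    (subst (λ c → Tri (ret (fromBits (bit₁ a) (bit₂ a))) _ 1 c _) (fromBits-bits a) (tri-ret _ _)))

wordBranch : Sym → Machine (⊤ ⊎ ⊤)
wordBranch b0    = push 0 false >> ret (inj₁ tt)
wordBranch b1    = push 0 true >> ret (inj₁ tt)
wordBranch blank = ret (inj₂ tt)
wordBranch mark  = ret (inj₂ tt)

wordBody : ⊤ → Machine (⊤ ⊎ ⊤)
wordBody _ = popSym 1 >>= wordBranch

wordLoop-time : ∀ n → 5 + (4 + 5 * n) ≡ 4 + 5 * suc n
wordLoop-time = solve-∀

tri-wordLoop : ∀ l u r → ∃ λ l′ → length l′ ≤ length l ×
  Tri (iter wordBody tt) (u ∷ code l ∷ r) (4 + 5 * length l) tt ((bitsOf l ʳ++ u) ∷ code l′ ∷ r)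
tri-wordLoop [] u r = [] , z≤n , tri-exit (tri-bind (tri-popSym (u ∷ []) [] r) (tri-ret (inj₂ tt) _))
tri-wordLoop (blank ∷ l) u r = l , n≤1+n _ ,
  weaken (m≤m+n 4 _) (tri-exit (tri-bind (tri-popSym (u ∷ []) (blank ∷ l) r) (tri-ret (inj₂ tt) _)))
tri-wordLoop (mark ∷ l) u r = l , n≤1+n _ ,
  weaken (m≤m+n 4 _) (tri-exit (tri-bind (tri-popSym (u ∷ []) (mark ∷ l) r) (tri-ret (inj₂ tt) _)))
tri-wordLoop (b0 ∷ l) u r with tri-wordLoop l (false ∷ u) r
... | l′ , le , T = l′ , m≤n⇒m≤1+n le , weaken (≤-reflexive (wordLoop-time (length l)))
  (tri-next (tri-bind (tri-popSym (u ∷ []) (b0 ∷ l) r) (tri-seq (tri-push [] u (code l ∷ r) false) (tri-ret (inj₁ tt) _))) T)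
tri-wordLoop (b1 ∷ l) u r with tri-wordLoop l (true ∷ u) r
... | l′ , le , T = l′ , m≤n⇒m≤1+n le , weaken (≤-reflexive (wordLoop-time (length l)))
  (tri-next (tri-bind (tri-popSym (u ∷ []) (b1 ∷ l) r) (tri-seq (tri-push [] u (code l ∷ r) true) (tri-ret (inj₁ tt) _))) T)

wordM : Machine ⊤
wordM = new 0 >> iter wordBody tt >> dropAt 1 >> mach revP

wordTime : Poly
wordTime = const 1 ⊕ (const 4 ⊕ const 5 ⊗ var) ⊕ (const 2 ⊕ const 6 ⊗ var) ⊕ time revP ⊙ (const 1 ⊕ var)

length-bitsOf : ∀ l → length (bitsOf l) ≤ length l
length-bitsOf []          = z≤n
length-bitsOf (blank ∷ l) = z≤n
length-bitsOf (mark ∷ l)  = z≤n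
length-bitsOf (b0 ∷ l)    = s≤s (length-bitsOf l)
length-bitsOf (b1 ∷ l)    = s≤s (length-bitsOf l)

tri-word : ∀ l r → Tri wordM (code l ∷ r) (⟦ wordTime ⟧ (length l)) tt (bitsOf l ∷ r)
tri-word l r = finish (tri-wordLoop l [] r)
  where
  arith : ∀ n → 2 * n * 3 ≡ 6 * n
  arith = solve-∀
  length-rev : length (bitsOf l ʳ++ []) + 0 ≡ length (bitsOf l)
  length-rev = trans (+-identityʳ _) (length-ʳ++[] (bitsOf l))
  reversed : ⟦ time revP ⟧ (suc (length (bitsOf l ʳ++ []) + 0)) ≤ ⟦ time revP ⟧ (1 + length l)
  reversed = ⟦⟧-mono (time revP) (s≤s (≤-trans (≤-reflexive length-rev) (length-bitsOf l)))
  finish : (∃ λ l′ → length l′ ≤ length l ×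
              Tri (iter wordBody tt) ([] ∷ code l ∷ r) (4 + 5 * length l) tt ((bitsOf l ʳ++ []) ∷ code l′ ∷ r)) →
           Tri wordM (code l ∷ r) (⟦ wordTime ⟧ (length l)) tt (bitsOf l ∷ r)
  finish (l′ , le , T) = tri-to (cong (_∷ r) (trans (ʳ++-ʳ++ (bitsOf l) {[]}) (++-identityʳ _)))
    (tri-seq (tri-seq (tri-seq (tri-new [] (code l ∷ r)) T) (weaken dropped (tri-drop ((bitsOf l ʳ++ []) ∷ []) (code l′) r)))
      (weaken reversed (spec revP (bitsOf l ʳ++ [] , tt) r)))
    where
    dropped : 2 + length (code l′) * 3 ≤ 2 + 6 * length l
    dropped = +-monoʳ-≤ 2 (≤-trans (≤-reflexive (trans (cong (_* 3) (length-code l′)) (arith (length l′)))) (*-monoʳ-≤ 6 le))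

conf : Tape → List Str → List Str
conf (tape l h r) s = code l ∷ code (h ∷ r) ∷ s

tsize : Tape → ℕ
tsize (tape l h r) = length l + suc (length r)

readWord-length : ∀ t → length (readWord t) ≤ tsize t
readWord-length (tape l h r) = ≤-trans (length-bitsOf (h ∷ r)) (m≤n+m _ (length l))

apply-size : ∀ s m t → tsize (apply s m t) ≤ suc (tsize t)
apply-size s left  (tape []      h r) = ≤-refl
apply-size s left  (tape (a ∷ l) h r) = ≤-trans (≤-reflexive (+-suc (length l) _)) (n≤1+n _)
apply-size s right (tape l h [])      = ≤-refl
apply-size s right (tape l h (a ∷ r)) = ≤-trans (≤-reflexive (sym (+-suc (length l) _))) (n≤1+n _)
apply-size s stay  (tape l h r)       = n≤1+n _

stepK-normal : ∀ M O q t → let d = OTM.δ M q (Tape.here t) in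
  stepK M O normal (q , t) ≡ (proj₁ d , apply (proj₁ (proj₂ d)) (proj₂ (proj₂ d)) t)
stepK-normal M O q t with OTM.δ M q (Tape.here t)
... | _ , _ , _ = refl

stepK-size : ∀ M O K q t → tsize (proj₂ (stepK M O K (q , t))) ≤ suc (tsize t)
stepK-size M O normal q t = subst (λ c → tsize (proj₂ c) ≤ suc (tsize t)) (sym (stepK-normal M O q t))
  (let d = OTM.δ M q (Tape.here t) in apply-size (proj₁ (proj₂ d)) (proj₂ (proj₂ d)) t)
stepK-size M O accept q t = n≤1+n _
stepK-size M O reject q t = n≤1+n _
stepK-size M O query  q t = n≤1+n _

State : OTM → Set
State M = Fin (suc (OTM.nStates M))

-- The treatment of queries is a parameter because it varies: an answer may be computed on the spot,
-- or the fragment may be left in order to ask a real oracle.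
module Sim (M : OTM) {F : Set} (onQuery : Machine (State M ⊎ F)) (onEnd : State M → F) where

  moveM : State M × Sym × Move → Machine (State M ⊎ F)
  moveM (q , s , left)  = pushSym 1 s >> (popSym 0 >>= λ a → pushSym 1 a >> ret (inj₁ q))
  moveM (q , s , right) = pushSym 0 s >> (popSym 1 >>= λ a → pushSym 1 a >> ret (inj₁ q))
  moveM (q , s , stay)  = pushSym 1 s >> ret (inj₁ q)

  stepM : Kind → State M → Machine (State M ⊎ F)
  stepM normal q = popSym 1 >>= λ h → moveM (OTM.δ M q h)
  stepM accept q = ret (inj₁ q)
  stepM reject q = ret (inj₁ q)
  stepM query  q = onQuery

  tick : State M → Maybe Bool → Machine (State M ⊎ F)
  tick q nothing  = ret (inj₂ (onEnd q))
  tick q (just _) = stepM (OTM.kind M q) q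

  -- Registers 0 and 1 hold the two halves of the simulated tape, and register 2 is the clock, which
  -- loses one bit per simulated step. The state of `M` is the loop parameter.
  simBody : State M → Machine (State M ⊎ F)
  simBody q = deleteAt 2 >>= tick q

  sim : State M → Machine F
  sim = iter simBody

  tri-move : ∀ d l h r s → Tri (moveM d) (code l ∷ code r ∷ s) 8 (inj₁ (proj₁ d))
                                (conf (apply (proj₁ (proj₂ d)) (proj₂ (proj₂ d)) (tape l h r)) s)
  tri-move (q , a , left) l h r s = tri-to (cong (λ t → conf t s) (sym (move-left l a r)))
    (tri-seq (tri-pushSym (code l ∷ []) r s a)
      (tri-bind (tri-popSym [] l (code (a ∷ r) ∷ s))
        (tri-seq (tri-pushSym (code (tl l) ∷ []) (a ∷ r) s (hd l)) (tri-ret (inj₁ q) _))))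
  tri-move (q , a , right) l h r s = tri-to (cong (λ t → conf t s) (sym (move-right l a r)))
    (tri-seq (tri-pushSym [] l (code r ∷ s) a)
      (tri-bind (tri-popSym (code (a ∷ l) ∷ []) r s)
        (tri-seq (tri-pushSym (code (a ∷ l) ∷ []) (tl r) s (hd r)) (tri-ret (inj₁ q) _))))
  tri-move (q , a , stay) l h r s = weaken (m≤m+n 3 5) (tri-seq (tri-pushSym (code l ∷ []) r s a) (tri-ret (inj₁ q) _))

  tri-normal : ∀ O q t s → Tri (stepM normal q) (conf t s) 11 (inj₁ (proj₁ (stepK M O normal (q , t))))
                               (conf (proj₂ (stepK M O normal (q , t))) s)
  tri-normal O q t@(tape l h r) s =
    subst (λ c → Tri (stepM normal q) (conf t s) 11 (inj₁ (proj₁ c)) (conf (proj₂ c) s)) (sym (stepK-normal M O q t))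
      (tri-bind (tri-popSym (code l ∷ []) (h ∷ r) s) (tri-move (OTM.δ M q h) l h r s))

-- Two tape halves and the clock lie above the environment, hence the offset 3; once its `k` entries
-- are copied, the right half of the tape is register `k + 1`.
queryWord : ∀ k {g} → Fn (suc k) g → Machine ⊤
queryWord k G = copyFrom 3 (vars k) >> copyAt (suc k) >> wordM >> mach G

queryTime : ∀ k {g} → Fn (suc k) g → Poly
queryTime k G = (const 1 ⊕ const k ⊗ (const 7 ⊕ const 7 ⊗ var)) ⊕ (const 7 ⊕ const 14 ⊗ var) ⊕ wordTime ⊕ time G ⊙ (const 1 ⊕ var)

tri-queryWord : ∀ k {g} (G : Fn (suc k) g) t c e r {N} → tsize t + size k e ≤ N →
  Tri (queryWord k G) (conf t (c ∷ st k e r)) (⟦ queryTime k G ⟧ N) tt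
      (g (readWord t , e) ∷ conf t (c ∷ st k e r))
tri-queryWord k {g} G t@(tape l h u) c e r {N} le =
  tri-seq (tri-seq (tri-seq
    (weaken (+-monoʳ-≤ 1 (*-monoʳ-≤ k (+-monoʳ-≤ 7 (*-monoʳ-≤ 7 (≤-trans (m≤n+m _ (tsize t)) le)))))
      (tri-dup k 3 (conf t (c ∷ [])) e r refl))
    (weaken copy-cost (tri-mach (cong copyAt index) (tri-from (sym whole) (tri-to (cong (code (h ∷ u) ∷_) (sym whole))
      (tri-copy (st k e [] ++ code l ∷ []) (code (h ∷ u)) (c ∷ st k e r)))))))
    (weaken (⟦⟧-mono wordTime (≤-trans (m≤n+m _ (length l)) tape≤)) (tri-word (h ∷ u) _)))
    (weaken (⟦⟧-mono (time G) (s≤s (≤-trans (+-monoˡ-≤ (size k e) (readWord-length t)) le)))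
      (spec G (readWord t , e) (conf t (c ∷ st k e r))))
  where
  tape≤ : tsize t ≤ N
  tape≤ = ≤-trans (m≤m+n _ _) le
  whole : st k e (conf t (c ∷ st k e r)) ≡ (st k e [] ++ code l ∷ []) ++ code (h ∷ u) ∷ c ∷ st k e r
  whole = trans (st-++ k e _) (sym (++-assoc (st k e []) _ _))
  index : length (st k e [] ++ code l ∷ []) ≡ suc k
  index = trans (length-++ (st k e [])) (trans (cong (_+ 1) (length-st k e)) (+-comm k 1))
  copy-cost : 7 + 7 * length (code (h ∷ u)) ≤ 7 + 14 * N
  copy-cost = +-monoʳ-≤ 7 (≤-trans (≤-reflexive (trans (cong (7 *_) (length-code (h ∷ u))) (arith (length (h ∷ u)))))
    (*-monoʳ-≤ 14 (≤-trans (m≤n+m _ (length l)) tape≤)))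
    where
    arith : ∀ n → 7 * (2 * n) ≡ 14 * n
    arith = solve-∀

accepts : (M : OTM) → Config M → Bool
accepts M c with result M c
... | just true = true
... | _         = false

accepts-tape : ∀ M q t t′ → accepts M (q , t) ≡ accepts M (q , t′)
accepts-tape M q t t′ with resultK (OTM.kind M q)
... | just true  = refl
... | just false = refl
... | nothing    = refl

run-size : ∀ M O n c → tsize (proj₂ (run M O n c)) ≤ tsize (proj₂ c) + n
run-size M O zero    c       = m≤m+n _ 0
run-size M O (suc n) (q , t) = ≤-trans (run-size M O n (step M O (q , t)))
  (≤-trans (+-monoˡ-≤ n (stepK-size M O (OTM.kind M q) q t)) (≤-reflexive (sym (+-suc (tsize t) n))))

init-size : ∀ x → tsize (initTape x) ≤ suc (length x)
init-size []      = ≤-refl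
init-size (b ∷ x) = s≤s (≤-trans (≤-reflexive (length-map toSym x)) (n≤1+n _))

initTape-at : ∀ x → initTape x ≡ at [] (map toSym x)
initTape-at []      = refl
initTape-at (b ∷ x) = refl

codeBitsP : Fn 1 (λ (x , _) → code (map toSym x))
codeBitsP = resp (λ (x , _) → cong (_, tt) (trans (foldl-ʳ++ _ _ x {[]}) (double x)))
  (constP [] & revP ▸ foldP (λ a b → true ∷ b ∷ a) 2 (λ a b → ≤-reflexive (+-comm 2 (length a))) (λ b → consP b ▸ consP true))
  where
  double : ∀ x → foldr (λ b a → true ∷ b ∷ a) [] x ≡ code (map toSym x)
  double []          = refl
  double (false ∷ x) = cong (λ w → true ∷ false ∷ w) (double x)
  double (true ∷ x)  = cong (λ w → true ∷ true ∷ w) (double x)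

loadM : Machine ⊤
loadM = mach codeBitsP >> (popSym 0 >>= λ a → pushSym 0 a) >> new 0

loadTime : Poly
loadTime = time codeBitsP ⊕ const 6

tri-load : ∀ x r → Tri loadM (x ∷ r) (⟦ loadTime ⟧ (suc (length x))) tt (conf (initTape x) r)
tri-load x r = weaken (≤-reflexive (+-assoc (⟦ time codeBitsP ⟧ (suc (length x))) 5 1)) (tri-to (cong (λ t → conf t r) (sym (initTape-at x)))
  (tri-seq (tri-seq (weaken (≤-reflexive (cong (λ n → ⟦ time codeBitsP ⟧ (suc n)) (+-identityʳ (length x)))) (spec codeBitsP (x , tt) r))
    (tri-bind (tri-popSym [] (map toSym x) r) (tri-pushSym [] (tl (map toSym x)) r (hd (map toSym x)))))
    (tri-new [] _)))

module _ (M : OTM) {k : ℕ} (O : Env k → Lang) (Or : Fn (suc k) (λ (z , e) → bs (O e z))) where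

  answerNo : Maybe Bool → Machine (State M ⊎ State M)
  answerNo nothing  = ret (inj₁ (OTM.qNo M))
  -- Popping the single bit of `bs true` leaves an empty register, which a second deletion removes.
  answerNo (just _) = deleteAt 0 >>= λ _ → ret (inj₁ (OTM.qYes M))

  askOracle : Machine (State M ⊎ State M)
  askOracle = queryWord k Or >> (deleteAt 0 >>= answerNo)

  open Sim M askOracle id

  stepTime : Poly
  stepTime = queryTime k Or ⊕ const 11

  tri-answer : ∀ b s → Tri (deleteAt 0 >>= answerNo) (bs b ∷ s) 3 (inj₁ (if b then OTM.qYes M else OTM.qNo M)) s
  tri-answer true  s = tri-bind (tri-pop [] true [] s) (tri-bind (tri-remove [] s) (tri-ret _ _))
  tri-answer false s = weaken (n≤1+n 2) (tri-bind (tri-remove [] s) (tri-ret _ _))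

  tri-stepM : ∀ K q t c e r {N} → tsize t + size k e ≤ N → let next = stepK M (O e) K (q , t) in
    Tri (stepM K q) (conf t (c ∷ st k e r)) (⟦ stepTime ⟧ N) (inj₁ (proj₁ next)) (conf (proj₂ next) (c ∷ st k e r))
  tri-stepM normal q t c e r {N} le = weaken (m≤n+m 11 (⟦ queryTime k Or ⟧ N)) (tri-normal (O e) q t _)
  tri-stepM accept q t c e r {N} le = weaken (≤-trans (s≤s z≤n) (m≤n+m 11 (⟦ queryTime k Or ⟧ N))) (tri-ret _ _)
  tri-stepM reject q t c e r {N} le = weaken (≤-trans (s≤s z≤n) (m≤n+m 11 (⟦ queryTime k Or ⟧ N))) (tri-ret _ _)
  tri-stepM query  q t c e r {N} le =
    tri-seq (tri-queryWord k Or t c e r le) (weaken (m≤m+n 3 8) (tri-answer (O e (readWord t)) _))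

  tri-sim : ∀ clk q t e r {N} → tsize t + length clk + size k e ≤ N →
    let end = run M (O e) (length clk) (q , t) in
    Tri (sim q) (conf t (clk ∷ st k e r)) (2 + length clk * (1 + ⟦ stepTime ⟧ N)) (proj₁ end) (conf (proj₂ end) (st k e r))
  tri-sim [] q t@(tape l h u) e r le = tri-exit (tri-bind (tri-remove (conf t []) (st k e r)) (tri-ret _ _))
  tri-sim (b ∷ clk) q t@(tape l h u) e r {N} le =
    weaken (≤-reflexive (arith (⟦ stepTime ⟧ N) (length clk * (1 + ⟦ stepTime ⟧ N))))
      (tri-next (tri-bind (tri-pop (conf t []) b clk (st k e r)) (tri-stepM (OTM.kind M q) q t clk e r
          (≤-trans (+-monoˡ-≤ (size k e) (m≤m+n _ _)) le)))
        (tri-sim clk (proj₁ (step M (O e) (q , t))) (proj₂ (step M (O e) (q , t))) e r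
          (≤-trans (+-monoˡ-≤ (size k e) (≤-trans (+-monoˡ-≤ (length clk) (stepK-size M (O e) (OTM.kind M q) q t))
            (≤-reflexive (sym (+-suc (tsize t) (length clk)))))) le)))
    where
    arith : ∀ s c → (1 + s) + (2 + c) ≡ 2 + (1 + s + c)
    arith = solve-∀

  resultM : Bool → Machine ⊤
  resultM true  = push 0 true
  resultM false = ret tt

  tri-resultM : ∀ b r → Tri (resultM b) ([] ∷ r) 1 tt (bs b ∷ r)
  tri-resultM true  r = tri-push [] [] r true
  tri-resultM false r = tri-ret tt _

  finishM : State M → Machine ⊤
  finishM q = dropAt 0 >> wordM >> dropsAt 1 k >> new 0 >> resultM (accepts M (q , initTape []))

  finishTime : Poly
  finishTime = (const 2 ⊕ const 6 ⊗ var) ⊕ wordTime ⊕ (const 1 ⊕ const 3 ⊗ var) ⊕ const 1 ⊕ const 1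

  tri-finish : ∀ q t e r {N} → tsize t + size k e ≤ N →
    Tri (finishM q) (conf t (st k e r)) (⟦ finishTime ⟧ N) tt (bs (accepts M (q , t)) ∷ readWord t ∷ r)
  tri-finish q t@(tape l h u) e r {N} le =
    tri-to (cong (λ b → bs b ∷ readWord t ∷ r) (accepts-tape M q (initTape []) t))
    (tri-seq (tri-seq (tri-seq (tri-seq
      (weaken (+-monoʳ-≤ 2 (≤-trans (≤-reflexive (trans (cong (_* 3) (length-code l)) (arith (length l)))) (*-monoʳ-≤ 6 (≤-trans (m≤m+n (length l) _) tape≤))))
        (tri-drop [] (code l) (code (h ∷ u) ∷ st k e r)))
      (weaken (⟦⟧-mono wordTime (≤-trans (m≤n+m _ (length l)) tape≤)) (tri-word (h ∷ u) (st k e r))))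
      (weaken (+-monoʳ-≤ 1 (*-monoʳ-≤ 3 (≤-trans (m≤n+m _ (tsize t)) le))) (tri-drops 1 k (readWord t ∷ []) e r refl)))
      (tri-new [] _))
      (tri-resultM (accepts M (q , initTape [])) _))
    where
    tape≤ : tsize t ≤ N
    tape≤ = ≤-trans (m≤m+n _ _) le
    arith : ∀ n → 2 * n * 3 ≡ 6 * n
    arith = solve-∀

  simF : Env (2 + k) → Env 2
  simF (x , clk , e) = let end = run M (O e) (length clk) (initConfig M x) in bs (accepts M end) , readWord (proj₂ end) , tt

  -- The oracle is itself a polynomial-time function of the query and the parameters `e`. One
  -- construction thus serves machines run with the empty oracle and machines whose answers are
  -- computed from advice.
  simP : PF (2 + k) 2 simF
  simP = record
    { mach = loadM >> (sim Fin.zero >>= finishM)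
    ; time = loadTime ⊕ ((const 2 ⊕ var ⊗ (const 1 ⊕ stepTime)) ⊕ finishTime)
    ; spec = λ (x , clk , e) r →
        let n = size (2 + k) (x , clk , e)
            end = run M (O e) (length clk) (initConfig M x)
            fits : tsize (initTape x) + length clk + size k e ≤ n
            fits = ≤-trans (+-monoˡ-≤ (size k e) (+-monoˡ-≤ (length clk) (init-size x))) (≤-by 1 (arith (length x) (length clk) (size k e)))
        in tri-seq (weaken (⟦⟧-mono loadTime (s≤s (m≤m+n (length x) (size (1 + k) (clk , e))))) (tri-load x (clk ∷ st k e r)))
          (tri-bind (weaken (+-monoʳ-≤ 2 (*-monoˡ-≤ (1 + ⟦ stepTime ⟧ n) (≤-by (2 + length x + size k e) (arith′ (length x) (length clk) (size k e)))))
              (tri-sim clk Fin.zero (initTape x) e r fits))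
            (tri-finish (proj₁ end) (proj₂ end) e r (≤-trans (+-monoˡ-≤ (size k e) (run-size M (O e) (length clk) (initConfig M x))) fits))) }
    where
    arith : ∀ x c s → suc x + c + s + 1 ≡ suc (x + suc (c + s))
    arith = solve-∀
    arith′ : ∀ x c s → c + (2 + x + s) ≡ suc (x + suc (c + s))
    arith′ = solve-∀

-- Machines with an oracle

inputEnd : Sym → (⊤ ⊎ ⊤) × Sym × Move
inputEnd a = if isBlank a then (inj₂ tt , mark , stay) else (inj₁ tt , a , right)

-- The raw input becomes register 0: one mark is placed in front of it as the resting place of the
-- head, another at the first blank to close the register.
inputM : Machine ⊤
inputM = act (λ a → tt , a , left) >> act (λ _ → tt , mark , right) >> iter (λ _ → act inputEnd) tt >> home

inputEnd-runs : ∀ x l → RunTo (iter (λ _ → act inputEnd) tt) (at l (map toSym x)) (suc (length x)) tt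
                              (at (map toSym x ʳ++ l) (mark ∷ []))
inputEnd-runs []          l = iter-exit _ (act-stay inputEnd {l} {[]} refl)
inputEnd-runs (false ∷ x) l = iter-next _ (act-right inputEnd {l} {b0 ∷ map toSym x} refl) (inputEnd-runs x (b0 ∷ l))
inputEnd-runs (true ∷ x)  l = iter-next _ (act-right inputEnd {l} {b1 ∷ map toSym x} refl) (inputEnd-runs x (b1 ∷ l))

input-runs : ∀ x → ∃ λ t → RunTo inputM (initTape x) (2 + suc (length x) + (3 + length x)) tt t × Rep (x ∷ []) t
input-runs x = at (blank ∷ []) (mark ∷ map toSym x ++ mark ∷ []) ,
  refrom (sym (initTape-at x)) (recount (cong (λ n → 2 + suc (length x) + (3 + n)) (length-map toSym x))
    (bind-runs _ _ (bind-runs _ _ (bind-runs _ _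
      (act-left (λ a → tt , a , left) {[]} {map toSym x} refl)
      (act-right (λ _ → tt , mark , right) {[]} {blank ∷ hd (map toSym x) ∷ tl (map toSym x)} refl))
      (inputEnd-runs x (mark ∷ [])))
      (home-runs′ (mark ∷ map toSym x) mark [] (refl ∷ ++⁺ (map⁺ (All.universal toSym-nonBlank x)) (refl ∷ [])) []))) ,
  rep (refl ∷ []) [] (cong (λ l → at (blank ∷ []) (mark ∷ l)) (sym (++-identityʳ _)))

bitsOf-cells : ∀ z r → bitsOf (map toSym z ++ mark ∷ r) ≡ z
bitsOf-cells []          r = refl
bitsOf-cells (false ∷ z) r = cong (false ∷_) (bitsOf-cells z r)
bitsOf-cells (true ∷ z)  r = cong (true ∷_) (bitsOf-cells z r)

hd-tl-cells : ∀ z r → hd (map toSym z ++ mark ∷ r) ∷ tl (map toSym z ++ mark ∷ r) ≡ map toSym z ++ mark ∷ r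
hd-tl-cells []      r = refl
hd-tl-cells (b ∷ z) r = refl

run-+ : ∀ M O m n c → run M O (m + n) c ≡ run M O n (run M O m c)
run-+ M O zero    n c = refl
run-+ M O (suc m) n c = run-+ M O m n (step M O c)

-- A machine that may leave through inj₁ tt asks the oracle about register 0 and then
-- continues with P (just answer); P nothing is the initial part.
module Driver (P : Maybe Bool → Machine (⊤ ⊎ Bool)) where

  data DState : Set where
    input       : Q inputM → DState
    part        : ∀ i → Q (P i) → DState
    goAsk ask   : DState
    answered    : Bool → DState
    halted      : Bool → DState

  finite-DState : Finite DState
  finite-DState = record
    { enum = map input (enum (finite inputM)) ++ map (λ (i , q) → part i q) (enum parts) ++ rest
    ; complete = λ { (input q) → ∈-++⁺ˡ (∈-map⁺ input (complete (finite inputM) q))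
                   ; (part i q) → ∈-++⁺ʳ (map input (enum (finite inputM))) (∈-++⁺ˡ (∈-map⁺ (λ (i , q) → part i q) (complete parts (i , q))))
                   ; goAsk → skip (here refl) ; ask → skip (there (here refl))
                   ; (answered true) → skip (there (there (here refl)))
                   ; (answered false) → skip (there (there (there (here refl))))
                   ; (halted true) → skip (there (there (there (there (here refl)))))
                   ; (halted false) → skip (there (there (there (there (there (here refl)))))) } }
    where
    parts : Finite (Σ (Maybe Bool) (λ i → Q (P i)))
    parts = finite-Σ finite-Maybe (λ i → finite (P i))
    rest : List DState
    rest = goAsk ∷ ask ∷ answered true ∷ answered false ∷ halted true ∷ halted false ∷ []
    skip : ∀ {d} → d ∈ rest → d ∈ map input (enum (finite inputM)) ++ map (λ (i , q) → part i q) (enum parts) ++ rest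
    skip p = ∈-++⁺ʳ (map input (enum (finite inputM))) (∈-++⁺ʳ (map (λ (i , q) → part i q) (enum parts)) p)

  kindD : DState → Kind
  kindD ask            = query
  kindD (halted true)  = accept
  kindD (halted false) = reject
  kindD _              = normal

  leave : ⊤ ⊎ Bool → DState
  leave (inj₁ tt) = goAsk
  leave (inj₂ b)  = halted b

  begin : ⊤ → DState
  begin _ = part nothing (start (P nothing))

  deltaD : DState → Sym → DState × Sym × Move
  deltaD (input q)    s = map₁ [ input , begin ]′ (delta inputM q s)
  deltaD (part i q)   s = map₁ [ part i , leave ]′ (delta (P i) q s)
  -- The head rests on the leading mark. Register 0 starts one cell to the right, and its closing
  -- mark ends the word that the oracle sees.
  deltaD goAsk        s = ask , s , right
  deltaD (answered b) s = part (just b) (start (P (just b))) , s , left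
  deltaD d            s = d , s , stay

  states : List DState
  states = enum finite-DState

  -- An `OTM` must start in `Fin.zero`, so this index becomes an extra name of the initial state and
  -- the enumeration is shifted by one.
  dec : Fin (suc (length states)) → DState
  dec Fin.zero    = input (start inputM)
  dec (Fin.suc i) = lookup states i

  enc : DState → Fin (suc (length states))
  enc d = Fin.suc (Any.index (complete finite-DState d))

  dec-enc : ∀ d → dec (enc d) ≡ d
  dec-enc d = sym (lookup-index (complete finite-DState d))

  machine : OTM
  machine = record
    { nStates = length states
    ; kind    = λ i → kindD (dec i)
    ; δ       = λ i s → map₁ enc (deltaD (dec i) s)
    ; qYes    = enc (answered true)
    ; qNo     = enc (answered false) }

  module _ (O : Lang) where

    -- All indices that decode to `d` are considered, because `dec` is not injective: the initial
    -- state has at least two names.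
    record Leads (d : DState) (t : Tape) (n : ℕ) (d′ : DState) (t′ : Tape) : Set where
      constructor leads
      field
        lead : ∀ i → dec i ≡ d → ∃ λ i′ → run machine O n (i , t) ≡ (i′ , t′) × dec i′ ≡ d′

    open Leads

    leads-trans : ∀ {d t m d₁ t₁ n d₂ t₂} → Leads d t m d₁ t₁ → Leads d₁ t₁ n d₂ t₂ → Leads d t (m + n) d₂ t₂
    leads-trans {m = m} {n = n} A B = leads λ i eq →
      let i₁ , r₁ , eq₁ = lead A i eq
          i₂ , r₂ , eq₂ = lead B i₁ eq₁
      in i₂ , trans (run-+ machine O m n _) (trans (cong (run machine O n) r₁) r₂) , eq₂

    leads-step : ∀ {d t d′ s m} → kindD d ≡ normal → deltaD d (Tape.here t) ≡ (d′ , s , m) → Leads d t 1 d′ (apply s m t)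
    leads-step {t = t} {s = s} {m} kn eq = leads λ { i refl → _ ,
      trans (cong (λ K → stepK machine O K (i , t)) kn) (trans (stepK-normal machine O i t)
        (cong (λ d → proj₁ (map₁ enc d) , apply (proj₁ (proj₂ d)) (proj₂ (proj₂ d)) t) eq)) ,
      dec-enc _ }

    leads-ask : ∀ t → Leads ask t 1 (answered (O (readWord t))) t
    leads-ask t = leads λ i eq → _ , cong (λ d → stepK machine O (kindD d) (i , t)) eq , decoded (O (readWord t))
      where
      decoded : ∀ b → dec (if b then enc (answered true) else enc (answered false)) ≡ answered b
      decoded true  = dec-enc (answered true)
      decoded false = dec-enc (answered false)

    module _ {E : Set} (N : Machine E) (inside : Q N → DState) (outside : E → DState)
             (isNormal : ∀ q → kindD (inside q) ≡ normal)
             (agrees : ∀ q s → deltaD (inside q) s ≡ map₁ [ inside , outside ]′ (delta N q s)) where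

      leads-runs : ∀ {q t n e t′} → Runs N q t n e t′ → Leads (inside q) t n (outside e) t′
      leads-runs {q} (exit eq)   = leads-step (isNormal q) (trans (agrees q _) (cong (map₁ [ inside , outside ]′) eq))
      leads-runs {q} (next eq r) = leads-trans
        (leads-step (isNormal q) (trans (agrees q _) (cong (map₁ [ inside , outside ]′) eq))) (leads-runs r)

    -- A computation interrupted by queries. The control is lost at each query and only the
    -- registers and the answer survive. The unit in `n + (1 + m)` pays for the three machine steps
    -- of a query.
    data Eval (N : Machine (⊤ ⊎ Bool)) (s : List Str) (b : Bool) : ℕ → Set₁ where
      done  : ∀ {n s′} → Tri N s n (inj₂ b) s′ → Eval N s b n
      asked : ∀ {n z s′ m} → Tri N s n (inj₁ tt) (z ∷ s′) → Eval (P (just (O z))) (z ∷ s′) b m → Eval N s b (n + (1 + m))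

    eval-bind : ∀ {E} {{fin : Finite E}} {M : Machine E} {k : E → Machine (⊤ ⊎ Bool)} {s n e s₁ b m} →
                Tri M s n e s₁ → Eval (k e) s₁ b m → Eval (M >>= k) s b (n + m)
    eval-bind T (done T′) = done (tri-bind T T′)
    eval-bind {n = n} T (asked {n′} T′ ev) = subst (Eval _ _ _) (+-assoc n n′ _) (asked (tri-bind T T′) ev)

    eval-iter : ∀ {X} {{fin : Finite X}} {body : X → Machine (X ⊎ (⊤ ⊎ Bool))} {x y s n s₁ b m} →
                Tri (body x) s n (inj₁ y) s₁ → Eval (iter body y) s₁ b m → Eval (iter body x) s b (n + m)
    eval-iter T (done T′) = done (tri-next T T′)
    eval-iter {n = n} T (asked {n′} T′ ev) = subst (Eval _ _ _) (+-assoc n n′ _) (asked (tri-next T T′) ev)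

    leads-query : ∀ {z s t} → Rep (z ∷ s) t → Leads goAsk t 3 (part (just (O z)) (start (P (just (O z))))) t
    leads-query {z} {s} (rep {L} {Z} _ _ refl) =
      subst₂ (λ b t → Leads goAsk (at L (mark ∷ r)) 3 (part (just b) (start (P (just b)))) t) (cong O word) back
        (leads-trans (leads-trans (subst (Leads goAsk (at L (mark ∷ r)) 1 ask) (move-right L mark r) (leads-step refl refl))
            (leads-ask (at (mark ∷ L) r)))
          (leads-step refl refl))
      where
      r : List Sym
      r = cells (z ∷ s) ++ Z
      r-split : r ≡ map toSym z ++ mark ∷ cells s ++ Z
      r-split = ++-assoc (map toSym z) (mark ∷ cells s) Z
      nonempty : hd r ∷ tl r ≡ r
      nonempty = subst (λ r → hd r ∷ tl r ≡ r) (sym r-split) (hd-tl-cells z _)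
      word : readWord (at (mark ∷ L) r) ≡ z
      word = trans (cong bitsOf (trans nonempty r-split)) (bitsOf-cells z _)
      back : moveHead left (tape (mark ∷ L) (hd r) (tl r)) ≡ at L (mark ∷ r)
      back = cong (tape L mark) nonempty

    eval-leads : ∀ i {s b n t} → Eval (P i) s b n → Rep s t →
                 ∃ λ m → ∃ λ t′ → m ≤ cost (sz s) n × Leads (part i (start (P i))) t m (halted b) t′
    eval-leads i (done T) R = let m , t′ , le , rs , _ = runs T R in
      m , t′ , le , leads-runs (P i) (part i) leave (λ _ → refl) (λ _ _ → refl) rs
    eval-leads i {s} (asked {n} {z} {s′} {m′} T ev) R =
      let m₁ , t₁ , le₁ , rs , R₁ = runs T R
          m₂ , t₂ , le₂ , L₂ = eval-leads (just (O z)) ev R₁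
      in m₁ + (3 + m₂) , t₂ ,
         ≤-trans (+-mono-≤ le₁ (≤-trans (+-mono-≤ (three (sz (z ∷ s′))) le₂) (cost-+ {sz (z ∷ s′)} {sz (z ∷ s′)} 1 m′ (m≤m+n (sz (z ∷ s′)) 1))))
                 (cost-+ {sz s} n (1 + m′) (grow T)) ,
         leads-trans (leads-runs (P i) (part i) leave (λ _ → refl) (λ _ _ → refl) rs)
           (leads-trans (leads-query R₁) L₂)
      where
      three : ∀ S → 3 ≤ cost S 1
      three S = ≤-by (7 + 10 * S) (arith S)
        where
        arith : ∀ S → 3 + (7 + 10 * S) ≡ 1 * (10 * (S + 1))
        arith = solve-∀

    -- `P^` inspects the configuration after exactly `poly c k n` steps, so a computation that ends
    -- earlier has to idle.
    run-halted : ∀ b n i t → dec i ≡ halted b → run machine O n (i , t) ≡ (i , t)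
    run-halted b zero    i t eq = refl
    run-halted b (suc n) i t eq = trans (cong (run machine O n) (stuck b eq)) (run-halted b n i t eq)
      where
      stuck : ∀ b → dec i ≡ halted b → stepK machine O (kindD (dec i)) (i , t) ≡ (i , t)
      stuck true  eq = cong (λ d → stepK machine O (kindD d) (i , t)) eq
      stuck false eq = cong (λ d → stepK machine O (kindD d) (i , t)) eq

    result-halted : ∀ b i t → dec i ≡ halted b → result machine (i , t) ≡ just b
    result-halted true  i t eq = cong (λ d → resultK (kindD d)) eq
    result-halted false i t eq = cong (λ d → resultK (kindD d)) eq

    opaque
      driver-P^ : (A : Lang) (p : Poly) →
        (∀ x → ∃ λ n → n ≤ ⟦ p ⟧ (length x) × Eval (P nothing) (x ∷ []) (A x) n) → P^ O A
      driver-P^ A p ev = machine , c , k , correct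
        where
        -- `6 + 2 n` is the time of `inputM`; the last summand is `cost (1 + n)` of `p`, written as
        -- a polynomial.
        limit : ∃ λ c → ∃ λ k → ∀ n → ⟦ const 6 ⊕ const 2 ⊗ var ⊕ p ⊗ (const 10 ⊗ (const 1 ⊕ var ⊕ p)) ⟧ n ≤ poly c k n
        limit = poly-bound (const 6 ⊕ const 2 ⊗ var ⊕ p ⊗ (const 10 ⊗ (const 1 ⊕ var ⊕ p)))
        c k : ℕ
        c = proj₁ limit
        k = proj₁ (proj₂ limit)
        bound : ∀ n → ⟦ const 6 ⊕ const 2 ⊗ var ⊕ p ⊗ (const 10 ⊗ (const 1 ⊕ var ⊕ p)) ⟧ n ≤ poly c k n
        bound = proj₂ (proj₂ limit)
        correct : ∀ x → result machine (run machine O (poly c k (length x)) (initConfig machine x)) ≡ just (A x)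
        correct x = conclude (lead (leads-trans (leads-runs inputM input begin (λ _ → refl) (λ _ _ → refl) rs₀) L) Fin.zero refl)
          where
          m₀ : ℕ
          m₀ = 2 + suc (length x) + (3 + length x)
          n : ℕ
          n = proj₁ (ev x)
          n≤ : n ≤ ⟦ p ⟧ (length x)
          n≤ = proj₁ (proj₂ (ev x))
          rs₀ : RunTo inputM (initTape x) m₀ tt (proj₁ (input-runs x))
          rs₀ = proj₁ (proj₂ (input-runs x))
          main : ∃ λ m → ∃ λ t′ → m ≤ cost (sz (x ∷ [])) n ×
                   Leads (part nothing (start (P nothing))) (proj₁ (input-runs x)) m (halted (A x)) t′
          main = eval-leads nothing (proj₂ (proj₂ (ev x))) (proj₂ (proj₂ (input-runs x)))
          m : ℕ
          m = proj₁ main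
          L : Leads (part nothing (start (P nothing))) (proj₁ (input-runs x)) m (halted (A x)) (proj₁ (proj₂ main))
          L = proj₂ (proj₂ (proj₂ main))
          enough : m₀ + m ≤ poly c k (length x)
          enough = ≤-trans (+-mono-≤ (≤-reflexive (arith (length x))) (≤-trans (proj₁ (proj₂ (proj₂ main)))
              (≤-trans (cost-mono {sz (x ∷ [])} n≤) (≤-reflexive (cong (λ l → ⟦ p ⟧ (length x) * (10 * (suc l + ⟦ p ⟧ (length x)))) (+-identityʳ (length x)))))))
            (bound (length x))
            where
            arith : ∀ n → 2 + suc n + (3 + n) ≡ 6 + 2 * n
            arith = solve-∀
          conclude : (∃ λ i′ → run machine O (m₀ + m) (Fin.zero , initTape x) ≡ (i′ , proj₁ (proj₂ main)) × dec i′ ≡ halted (A x)) →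
                     result machine (run machine O (poly c k (length x)) (initConfig machine x)) ≡ just (A x)
          conclude (i′ , r , eq) = trans (cong (result machine) (trans
              (cong (λ N → run machine O N (initConfig machine x)) (sym (m+[n∸m]≡n enough)))
              (trans (run-+ machine O (m₀ + m) spare (initConfig machine x))
                (trans (cong (run machine O spare) r) (run-halted (A x) spare i′ (proj₁ (proj₂ main)) eq)))))
            (result-halted (A x) i′ (proj₁ (proj₂ main)) eq)
            where
            spare : ℕ
            spare = poly c k (length x) ∸ (m₀ + m)

verdict : Maybe Bool → Machine (⊤ ⊎ Bool)
verdict nothing  = ret (inj₂ false)
verdict (just _) = ret (inj₂ true)

module _ {f : Str → Bool} (F : Fn 1 (λ (x , _) → bs (f x))) where

  decideM : Maybe Bool → Machine (⊤ ⊎ Bool)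
  decideM _ = mach F >> (deleteAt 0 >>= verdict)

  tri-verdict : ∀ b → Tri (deleteAt 0 >>= verdict) (bs b ∷ []) 2 (inj₂ b) (if b then [] ∷ [] else [])
  tri-verdict true  = tri-bind (tri-pop [] true [] []) (tri-ret _ _)
  tri-verdict false = tri-bind (tri-remove [] []) (tri-ret _ _)

  decides : ∀ x → Tri (decideM nothing) (x ∷ []) (⟦ time F ⟧ (size 1 (x , tt)) + 2) (inj₂ (f x)) (if f x then [] ∷ [] else [])
  decides x = tri-seq (spec F (x , tt) []) (tri-verdict (f x))

  decideTime : Poly
  decideTime = time F ⊙ (const 1 ⊕ var) ⊕ const 2

  decides-time : ∀ x → ⟦ time F ⟧ (size 1 (x , tt)) + 2 ≤ ⟦ decideTime ⟧ (length x)
  decides-time x = +-monoˡ-≤ 2 (≤-reflexive (cong (λ n → ⟦ time F ⟧ (suc n)) (+-identityʳ (length x))))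

  open Driver decideM using (done; driver-P^)

  fn-P^ : ∀ O → P^ O f
  fn-P^ O = driver-P^ O f decideTime (λ x → ⟦ time F ⟧ (size 1 (x , tt)) + 2 , decides-time x , done (decides x))

-- Simulation with translated oracle queries

module Reduction (M : OTM) (O : Lang) {q₀ w clk a : Str → Str} {ok : Str → Bool} {g : Str → Str → Str}
  (OK : Fn 1 (λ (x , _) → bs (ok x))) (Q₀ : Fn 1 (λ (x , _) → q₀ x)) (W : Fn 1 (λ (x , _) → w x))
  (C : Fn 1 (λ (x , _) → clk x)) (A : Fn 1 (λ (x , _) → a x)) (G : Fn 2 (λ (z , y , _) → g z y)) where

  -- The intended reading: `ok` limits the guessed certificate, the query `q₀` excludes incomplete
  -- advice, and `g` attaches the advice to every query of `M`.
  lang : Lang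
  lang x = ok x ∧ (not (O (q₀ x)) ∧ accepts M (run M (λ z → O (g z (a x))) (length (clk x)) (initConfig M (w x))))

  -- Leaving the fragment forgets the state of `M`. This is harmless, as an `OTM` resumes in `qYes`
  -- or `qNo` whatever state asked. The non-empty register 1 marks the query as one of `M`.
  onQuery : Machine (State M ⊎ (⊤ ⊎ Bool))
  onQuery = queryWord 1 G >> new 1 >> push 1 true >> ret (inj₂ (inj₁ tt))

  onEnd : State M → ⊤ ⊎ Bool
  onEnd q = inj₂ (accepts M (q , initTape []))

  open Sim M onQuery onEnd

  -- Register 1 tells which query was answered: it is empty for the initial one.
  phase : Bool → Maybe Bool → Machine (⊤ ⊎ Bool)
  phase true  nothing  = ret (inj₂ false)
  phase false nothing  = loadM >> sim Fin.zero
  phase b     (just _) = deleteAt 0 >>= λ _ → sim (if b then OTM.qYes M else OTM.qNo M)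

  okBranch : Maybe Bool → Machine (⊤ ⊎ Bool)
  okBranch nothing  = ret (inj₂ false)
  okBranch (just _) = deleteAt 0 >>= λ _ → ret (inj₁ tt)

  prep : PF 1 6 (λ (x , _) → bs (ok x) , q₀ x , [] , w x , clk x , a x , tt)
  prep = OK & Q₀ & constP [] & W & C & A

  P : Maybe Bool → Machine (⊤ ⊎ Bool)
  P nothing  = mach prep >> (deleteAt 0 >>= okBranch)
  P (just b) = dropAt 0 >> (deleteAt 0 >>= phase b)

  open Driver P using (Eval; done; asked; eval-bind; eval-iter; driver-P^)

  wordSize : Poly
  wordSize = (var ⊕ time G) ⊙ (const 1 ⊕ var)

  tickTime : Poly
  tickTime = const 20 ⊕ queryTime 1 G ⊕ const 3 ⊗ wordSize

  query-length : ∀ t y {N} → tsize t + size 1 (y , tt) ≤ N → length (g (readWord t) y) ≤ ⟦ wordSize ⟧ N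
  query-length t y le = ≤-trans (≤-trans (m≤m+n _ 0) (n≤1+n _)) (≤-trans (pf-size G (readWord t , y , tt))
    (⟦⟧-mono (var ⊕ time G) (s≤s (≤-trans (+-monoˡ-≤ _ (readWord-length t)) le))))

  eval-tick : ∀ K q t b c y r {N v m} → tsize t + size 1 (y , tt) ≤ N → K ≡ OTM.kind M q →
    let c′ = stepK M (λ z → O (g z y)) K (q , t) in
    (∃ λ n → n ≤ m × Eval O (sim (proj₁ c′)) (conf (proj₂ c′) (c ∷ y ∷ r)) v n) →
    ∃ λ n → n ≤ ⟦ tickTime ⟧ N + m × Eval O (sim q) (conf t ((b ∷ c) ∷ y ∷ r)) v n
  eval-tick K q t@(tape l h u) b c y r {N} {v} {m} le eq (n , n≤m , ev) = go K eq refl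
    where
    pop : Tri (deleteAt 2) (conf t ((b ∷ c) ∷ y ∷ r)) 1 (just b) (conf t (c ∷ y ∷ r))
    pop = tri-pop (conf t []) b c (y ∷ r)
    small : ∀ i → i ≤ 20 → i + n ≤ ⟦ tickTime ⟧ N + m
    small i i≤20 = +-mono-≤ (≤-trans i≤20 (≤-trans (m≤m+n 20 (⟦ queryTime 1 G ⟧ N)) (m≤m+n _ (3 * ⟦ wordSize ⟧ N)))) n≤m
    go : ∀ K′ → K ≡ OTM.kind M q → K′ ≡ K → ∃ λ n → n ≤ ⟦ tickTime ⟧ N + m × Eval O (sim q) (conf t ((b ∷ c) ∷ y ∷ r)) v n
    go normal eq refl = _ , small 12 (m≤m+n 12 8) ,
      eval-iter O (tri-bind pop (tri-mach (cong (λ K → stepM K q) eq) (tri-normal (λ z → O (g z y)) q t (c ∷ y ∷ r)))) ev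
    go accept eq refl = _ , small 2 (m≤m+n 2 18) ,
      eval-iter O (tri-bind pop (tri-mach (cong (λ K → stepM K q) eq) (tri-ret _ _))) ev
    go reject eq refl = _ , small 2 (m≤m+n 2 18) ,
      eval-iter O (tri-bind pop (tri-mach (cong (λ K → stepM K q) eq) (tri-ret _ _))) ev
    go query eq refl = _ , count ,
      asked (tri-exit (tri-bind pop (tri-mach (cong (λ K → stepM K q) eq)
          (tri-seq (tri-seq (tri-seq (tri-queryWord 1 G t c (y , tt) r le) (tri-new (z ∷ []) _)) (tri-push (z ∷ []) [] _ true)) (tri-ret _ _)))))
        (eval-bind O (tri-drop [] z _) (eval-bind O (tri-pop [] true [] _)
          (resumed (O z) (eval-bind O {k = λ _ → sim (if O z then OTM.qYes M else OTM.qNo M)} (tri-remove [] _) ev))))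
      where
      z : Str
      z = g (readWord t) y
      resumed : ∀ b {s v n} → Eval O (deleteAt 0 >>= λ _ → sim (if b then OTM.qYes M else OTM.qNo M)) s v n →
                Eval O (phase b (just true)) s v n
      resumed true  e = e
      resumed false e = e
      arith : ∀ p z n → 1 + (p + 1 + 1 + 1) + (1 + ((2 + z * 3) + (1 + (1 + n)))) + 11 ≡ 20 + p + 3 * z + n
      arith = solve-∀
      count : 1 + (⟦ queryTime 1 G ⟧ N + 1 + 1 + 1) + (1 + ((2 + length z * 3) + (1 + (1 + n)))) ≤ ⟦ tickTime ⟧ N + m
      count = ≤-trans (≤-by 11 (arith (⟦ queryTime 1 G ⟧ N) (length z) n))
        (+-mono-≤ (+-monoʳ-≤ (20 + ⟦ queryTime 1 G ⟧ N) (*-monoʳ-≤ 3 (query-length t y le))) n≤m)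

  eval-sim : ∀ c q t y r {N} → tsize t + length c + size 1 (y , tt) ≤ N →
    ∃ λ n → n ≤ 2 + length c * ⟦ tickTime ⟧ N ×
      Eval O (sim q) (conf t (c ∷ y ∷ r)) (accepts M (run M (λ z → O (g z y)) (length c) (q , t))) n
  eval-sim [] q t@(tape l h u) y r le = 2 , ≤-refl ,
    done (tri-exit (tri-bind (tri-remove (conf t []) (y ∷ r))
      (subst (λ v → Tri (ret (inj₂ (onEnd q))) _ 1 (inj₂ (inj₂ v)) _) (accepts-tape M q (initTape []) t) (tri-ret _ _))))
  eval-sim (b ∷ c) q t y r {N} le = widen (eval-tick (OTM.kind M q) q t b c y r {N}
      (≤-trans (+-monoˡ-≤ (size 1 (y , tt)) (m≤m+n (tsize t) (suc (length c)))) le) refl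
      (eval-sim c (proj₁ (step M (λ z → O (g z y)) (q , t))) (proj₂ (step M (λ z → O (g z y)) (q , t))) y r {N}
        (≤-trans (+-monoˡ-≤ (size 1 (y , tt)) (≤-trans (+-monoˡ-≤ (length c) (stepK-size M (λ z → O (g z y)) (OTM.kind M q) q t))
            (≤-reflexive (sym (+-suc (tsize t) (length c)))))) le)))
    where
    arith : ∀ d c → d + (2 + c) ≡ 2 + (d + c)
    arith = solve-∀
    widen : ∀ {s v} → (∃ λ n → n ≤ ⟦ tickTime ⟧ N + (2 + length c * ⟦ tickTime ⟧ N) × Eval O (sim q) s v n) →
            ∃ λ n → n ≤ 2 + suc (length c) * ⟦ tickTime ⟧ N × Eval O (sim q) s v n
    widen (n , n≤ , ev) = n , ≤-trans n≤ (≤-reflexive (arith (⟦ tickTime ⟧ N) _)) , ev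

  reduction-P^ : P^ O lang
  reduction-P^ = driver-P^ O lang (total ⊙ (const 1 ⊕ var)) (λ x → evaluate x (ok x) (O (q₀ x)) refl refl)
    where
    S : Poly
    S = var ⊕ time prep
    total : Poly
    total = time prep ⊕ (const 10 ⊕ const 3 ⊗ S ⊕ loadTime ⊙ S ⊕ (const 2 ⊕ S ⊗ tickTime ⊙ S))
    evaluate : ∀ x p o → ok x ≡ p → O (q₀ x) ≡ o → ∃ λ n → n ≤ ⟦ total ⟧ (1 + length x) × Eval O (P nothing) (x ∷ [])
      (ok x ∧ (not (O (q₀ x)) ∧ accepts M (run M (λ z → O (g z (a x))) (length (clk x)) (initConfig M (w x))))) n
    evaluate x p o eqp eqo = go p o eqp eqo
      where
      N : ℕ
      N = ⟦ S ⟧ (1 + length x)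
      value : Bool
      value = accepts M (run M (λ z → O (g z (a x))) (length (clk x)) (initConfig M (w x)))
      registers : List Str
      registers = q₀ x ∷ [] ∷ w x ∷ clk x ∷ a x ∷ []
      prepared : ∀ p → ok x ≡ p → Tri (mach prep) (x ∷ []) (⟦ time prep ⟧ (1 + length x)) tt (bs p ∷ registers)
      prepared _ refl = weaken (≤-reflexive (cong (λ n → ⟦ time prep ⟧ (1 + n)) (+-identityʳ _))) (spec prep (x , tt) [])
      sizes : size 6 (bs (ok x) , q₀ x , [] , w x , clk x , a x , tt) ≤ N
      sizes = subst (λ n → size 6 (bs (ok x) , q₀ x , [] , w x , clk x , a x , tt) ≤ suc n + ⟦ time prep ⟧ (suc n)) (+-identityʳ (length x)) (pf-size prep (x , tt))
      arith₁ : ∀ p q w c y → q + (5 + p + w + c + y) ≤ suc (p + suc (q + suc (0 + suc (w + suc (c + suc (y + 0))))))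
      arith₁ p q w c y = ≤-by 1 (eq p q w c y)
        where
        eq : ∀ p q w c y → q + (5 + p + w + c + y) + 1 ≡ suc (p + suc (q + suc (0 + suc (w + suc (c + suc (y + 0))))))
        eq = solve-∀
      arith₂ : ∀ p q w c y → suc w + c + suc (y + 0) + (4 + p + q) ≡ suc (p + suc (q + suc (0 + suc (w + suc (c + suc (y + 0))))))
      arith₂ = solve-∀
      arith₃ : ∀ p q w c y → c + (6 + p + q + w + y) ≡ suc (p + suc (q + suc (0 + suc (w + suc (c + suc (y + 0))))))
      arith₃ = solve-∀
      arith₄ : ∀ p q w c y → suc w + (5 + p + q + c + y) ≡ suc (p + suc (q + suc (0 + suc (w + suc (c + suc (y + 0))))))
      arith₄ = solve-∀
      lp lq lw lc ly : ℕ
      lp = length (bs (ok x))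
      lq = length (q₀ x)
      lw = length (w x)
      lc = length (clk x)
      ly = length (a x)
      q≤ : lq ≤ N
      q≤ = ≤-trans (≤-trans (m≤m+n lq _) (arith₁ lp lq lw lc ly)) sizes
      fits : tsize (initTape (w x)) + lc + size 1 (a x , tt) ≤ N
      fits = ≤-trans (≤-trans (+-monoˡ-≤ _ (+-monoˡ-≤ lc (init-size (w x)))) (≤-by (4 + lp + lq) (arith₂ lp lq lw lc ly))) sizes
      c≤ : lc ≤ N
      c≤ = ≤-trans (≤-by (6 + lp + lq + lw + ly) (arith₃ lp lq lw lc ly)) sizes
      w≤ : suc lw ≤ N
      w≤ = ≤-trans (≤-by (5 + lp + lq + lc + ly) (arith₄ lp lq lw lc ly)) sizes
      bound : ∀ {i} → i ≤ 10 + 3 * N + ⟦ loadTime ⟧ N + (2 + N * ⟦ tickTime ⟧ N) → ⟦ time prep ⟧ (1 + length x) + i ≤ ⟦ total ⟧ (1 + length x)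
      bound le = +-monoʳ-≤ (⟦ time prep ⟧ (1 + length x)) le
      ask-first : ∀ {o v m} → O (q₀ x) ≡ o → Eval O (P (just o)) registers v m → ok x ≡ true →
        Eval O (P nothing) (x ∷ []) v (⟦ time prep ⟧ (1 + length x) + (1 + (1 + 1)) + (1 + m))
      ask-first refl ev eqp = asked (tri-seq (prepared true eqp) (tri-bind (tri-pop [] true [] registers)
        (tri-bind (tri-remove [] registers) (tri-ret _ _)))) ev
      settle : ∀ {p o n} → ok x ≡ p → O (q₀ x) ≡ o → Eval O (P nothing) (x ∷ []) (p ∧ (not o ∧ value)) n →
               Eval O (P nothing) (x ∷ []) (ok x ∧ (not (O (q₀ x)) ∧ value)) n
      settle refl refl ev = ev
      go : ∀ p o → ok x ≡ p → O (q₀ x) ≡ o → ∃ λ n → n ≤ ⟦ total ⟧ (1 + length x) ×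
             Eval O (P nothing) (x ∷ []) (ok x ∧ (not (O (q₀ x)) ∧ value)) n
      go false o eqp _ = _ , bound (≤-trans (m≤m+n 2 8) (≤-trans (m≤m+n 10 (3 * N))
          (≤-trans (m≤m+n _ (⟦ loadTime ⟧ N)) (m≤m+n _ (2 + N * ⟦ tickTime ⟧ N))))) ,
        settle eqp refl (done (tri-seq (prepared false eqp) (tri-bind (tri-remove [] registers) (tri-ret _ _))))
      go true true eqp eqo = _ , ≤-trans (≤-reflexive (+-assoc (⟦ time prep ⟧ (1 + length x)) 3 _)) (bound (≤-trans
            (≤-trans (≤-reflexive (arith lq)) (+-mono-≤ (m≤m+n 8 2) (*-monoʳ-≤ 3 q≤)))
            (≤-trans (m≤m+n _ (⟦ loadTime ⟧ N)) (m≤m+n _ (2 + N * ⟦ tickTime ⟧ N))))) ,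
        settle eqp eqo
          (ask-first eqo (eval-bind O (tri-drop [] (q₀ x) _) (eval-bind O (tri-remove [] _) (done (tri-ret _ _)))) eqp)
        where
        arith : ∀ q → 3 + (1 + ((2 + q * 3) + (1 + 1))) ≡ 8 + 3 * q
        arith = solve-∀
      go true false eqp eqo = let n , n≤ , ev = eval-sim (clk x) Fin.zero (initTape (w x)) (a x) [] {N} fits in
        _ , ≤-trans (≤-reflexive (+-assoc (⟦ time prep ⟧ (1 + length x)) 3 _)) (bound (≤-trans (≤-reflexive (arith lq (⟦ loadTime ⟧ (suc lw)) n))
            (+-mono-≤ (+-mono-≤ (+-mono-≤ (m≤m+n 7 3) (*-monoʳ-≤ 3 q≤)) (⟦⟧-mono loadTime w≤))
              (≤-trans n≤ (+-monoʳ-≤ 2 (*-monoˡ-≤ (⟦ tickTime ⟧ N) c≤)))))) ,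
        settle eqp eqo
          (ask-first eqo (eval-bind O (tri-drop [] (q₀ x) _) (eval-bind O (tri-remove [] _) (eval-bind O (tri-load (w x) _) ev))) eqp)
        where
        arith : ∀ q l n → 3 + (1 + ((2 + q * 3) + (1 + (l + n)))) ≡ 7 + 3 * q + l + n
        arith = solve-∀

-- Counting the sublists of a sorted list

∨-trueˡ : ∀ {a} b → a ≡ true → a ∨ b ≡ true
∨-trueˡ b refl = refl

∨-trueʳ : ∀ a {b} → b ≡ true → a ∨ b ≡ true
∨-trueʳ true  _  = refl
∨-trueʳ false eq = eq

∧-true : ∀ {a b} → a ≡ true → b ≡ true → a ∧ b ≡ true
∧-true refl refl = refl

∨-split : ∀ a {b} → a ∨ b ≡ true → a ≡ true ⊎ b ≡ true
∨-split true  _  = inj₁ refl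
∨-split false eq = inj₂ eq

∧-split : ∀ a {b} → a ∧ b ≡ true → a ≡ true × b ≡ true
∧-split true eq = refl , eq

not-true : ∀ a → not a ≡ true → a ≡ false
not-true false _ = refl

true⊎false : ∀ b → b ≡ true ⊎ b ≡ false
true⊎false true  = inj₁ refl
true⊎false false = inj₂ refl

<ₗ-lex : ∀ a b → a <ₗ b ≡ true → a <lex b
<ₗ-lex []          (_ ∷ b)     _  = []<∷
<ₗ-lex (false ∷ a) (true ∷ b)  _  = 0<1
<ₗ-lex (false ∷ a) (false ∷ b) lt = same (<ₗ-lex a b lt)
<ₗ-lex (true ∷ a)  (true ∷ b)  lt = same (<ₗ-lex a b lt)

<ₗ-trans : ∀ a b c → a <ₗ b ≡ true → b <ₗ c ≡ true → a <ₗ c ≡ true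
<ₗ-trans []          (_ ∷ b)     (_ ∷ c)     _ _ = refl
<ₗ-trans (false ∷ a) (false ∷ b) (false ∷ c) p q = <ₗ-trans a b c p q
<ₗ-trans (false ∷ a) (false ∷ b) (true ∷ c)  p q = refl
<ₗ-trans (false ∷ a) (true ∷ b)  (true ∷ c)  p q = refl
<ₗ-trans (true ∷ a)  (true ∷ b)  (true ∷ c)  p q = <ₗ-trans a b c p q

<ₗ-irrefl : ∀ a → a <ₗ a ≡ false
<ₗ-irrefl []          = refl
<ₗ-irrefl (false ∷ a) = <ₗ-irrefl a
<ₗ-irrefl (true ∷ a)  = <ₗ-irrefl a

<ₗ-asym : ∀ a b → a <ₗ b ≡ true → b <ₗ a ≡ false
<ₗ-asym []          (_ ∷ b)     _ = refl
<ₗ-asym (false ∷ a) (false ∷ b) p = <ₗ-asym a b p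
<ₗ-asym (false ∷ a) (true ∷ b)  p = refl
<ₗ-asym (true ∷ a)  (true ∷ b)  p = <ₗ-asym a b p

<ₗ-connected : ∀ a b → a <ₗ b ≡ false → b <ₗ a ≡ false → a ≡ b
<ₗ-connected []          []          _ _ = refl
<ₗ-connected (false ∷ a) (false ∷ b) p q = cong (false ∷_) (<ₗ-connected a b p q)
<ₗ-connected (true ∷ a)  (true ∷ b)  p q = cong (true ∷_) (<ₗ-connected a b p q)

==ₗ-sound : ∀ a b → a ==ₗ b ≡ true → a ≡ b
==ₗ-sound a b eq with ∧-split (not (a <ₗ b)) eq
... | p , q = <ₗ-connected a b (not-true _ p) (not-true _ q)

==ₗ-refl : ∀ a → a ==ₗ a ≡ true
==ₗ-refl a = cong (λ b → not b ∧ not b) (<ₗ-irrefl a)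

-- A left fold without early exit, the form in which `listP` processes an encoded list.
anyB : ∀ {A : Set} → (A → Bool) → List A → Bool
anyB p = foldl (λ a y → a ∨ p y) false

allB : ∀ {A : Set} → (A → Bool) → List A → Bool
allB p l = not (anyB (λ y → not (p y)) l)

module _ {A : Set} (p : A → Bool) where

  private
    keeps : ∀ l → foldl (λ a y → a ∨ p y) true l ≡ true
    keeps []      = refl
    keeps (_ ∷ l) = keeps l

  anyB-complete : ∀ {y l} → y ∈ l → p y ≡ true → anyB p l ≡ true
  anyB-complete {l = l} = go false l
    where
    go : ∀ a l {y} → y ∈ l → p y ≡ true → foldl (λ a y → a ∨ p y) a l ≡ true
    go a (y ∷ l) (here refl) eq = trans (cong (λ b → foldl (λ a y → a ∨ p y) b l) (∨-trueʳ a eq)) (keeps l)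
    go a (y ∷ l) (there q)   eq = go (a ∨ p y) l q eq

  anyB-sound : ∀ l → anyB p l ≡ true → ∃ λ y → y ∈ l × p y ≡ true
  anyB-sound (y ∷ l) eq with true⊎false (p y)
  ... | inj₁ py = y , here refl , py
  ... | inj₂ py with anyB-sound l (trans (cong (λ b → foldl (λ a y → a ∨ p y) b l) (sym py)) eq)
  ...   | z , z∈ , pz = z , there z∈ , pz

allB-sound : ∀ {A : Set} (p : A → Bool) l → allB p l ≡ true → ∀ {y} → y ∈ l → p y ≡ true
allB-sound p l eq {y} y∈ with true⊎false (p y)
... | inj₁ py = py
... | inj₂ py = case trans (sym eq) (cong not (anyB-complete (λ y → not (p y)) y∈ (cong not py))) of λ ()

allB-complete : ∀ {A : Set} (p : A → Bool) l → (∀ {y} → y ∈ l → p y ≡ true) → allB p l ≡ true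
allB-complete p l all with true⊎false (anyB (λ y → not (p y)) l)
... | inj₂ eq = cong not eq
... | inj₁ eq with anyB-sound (λ y → not (p y)) l eq
...   | y , y∈ , npy = case trans (sym (all y∈)) (not-true _ npy) of λ ()

_<<_ : Str → Str → Set
a << b = a <ₗ b ≡ true

Asc : List Str → Set
Asc = AllPairs _<<_

-- the previous item is kept behind a sentinel bit
sortStep : Str × Bool → Str → Str × Bool
sortStep (p , ok) t = true ∷ t , ok ∧ (not (toB p) ∨ (tailS p <ₗ t))

sortedB : List Str → Bool
sortedB l = proj₂ (foldl sortStep ([] , true) l)

sorted-stuck : ∀ p l → proj₂ (foldl sortStep (p , false) l) ≡ false
sorted-stuck p []      = refl
sorted-stuck p (t ∷ l) = sorted-stuck (true ∷ t) l

sortedB-sound : ∀ l → sortedB l ≡ true → Linked _<<_ l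
sortedB-sound []      _  = []
sortedB-sound (t ∷ l) eq = go t l eq
  where
  go : ∀ t l → proj₂ (foldl sortStep (true ∷ t , true) l) ≡ true → Linked _<<_ (t ∷ l)
  go t []      _  = [-]
  go t (u ∷ l) eq with true⊎false (t <ₗ u)
  ... | inj₁ lt = lt ∷ go u l (trans (cong (λ b → proj₂ (foldl sortStep (true ∷ u , b) l)) (sym lt)) eq)
  ... | inj₂ ge = case trans (sym (trans (cong (λ b → proj₂ (foldl sortStep (true ∷ u , b) l)) ge) (sorted-stuck _ l))) eq of λ ()

sortedB-complete : ∀ {l} → Asc l → sortedB l ≡ true
sortedB-complete []         = refl
sortedB-complete {t ∷ l} (lt ∷ asc) = go t l lt asc
  where
  go : ∀ t l → All (t <<_) l → Asc l → proj₂ (foldl sortStep (true ∷ t , true) l) ≡ true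
  go t []      _         _           = refl
  go t (u ∷ l) (lt ∷ _) (lt′ ∷ asc) =
    trans (cong (λ b → proj₂ (foldl sortStep (true ∷ u , b) l)) lt) (go u l lt′ asc)

countU : List Str → Str
countU = foldl (λ n _ → true ∷ n) []

length-countU : ∀ l → length (countU l) ≡ length l
length-countU l = trans (go [] l) (+-identityʳ _)
  where
  go : ∀ (n : Str) (l : List Str) → length (foldl (λ n _ → true ∷ n) n l) ≡ length l + length n
  go n []      = refl
  go n (_ ∷ l) = trans (go (true ∷ n) l) (+-suc (length l) (length n))

shortB : List Str → Bool
shortB l = allB (λ t → t ≤ₗ countU l) l

admB : List Str → Bool
admB l = sortedB l ∧ shortB l

Linked-lex : ∀ {l} → Linked _<<_ l → Linked _<lex_ l
Linked-lex = Linked.map (λ {a} {b} → <ₗ-lex a b)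

Asc-unique : ∀ {l} → Asc l → AllPairs _≢_ l
Asc-unique = AllPairs.map (λ {a} {b} lt eq → case trans (sym lt) (trans (cong (a <ₗ_) (sym eq)) (<ₗ-irrefl a)) of λ ())

admB-sound : ∀ l → 1 ≤ length l → admB l ≡ true → Admissible l
admB-sound l ne eq with ∧-split (sortedB l) eq
... | s , sh = ne , Asc-unique (Linked⇒AllPairs (λ {a} {b} {c} → <ₗ-trans a b c) linked) , Linked-lex linked ,
    All.tabulate (λ {t} t∈ → ≤-trans (≤ₗ-sound t (countU l) (allB-sound (λ t → t ≤ₗ countU l) l sh t∈)) (≤-reflexive (length-countU l)))
  where
  linked : Linked _<<_ l
  linked = sortedB-sound l s

admB-complete : ∀ {l} → Asc l → All (λ t → length t ≤ length l) l → admB l ≡ true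
admB-complete {l} asc short = ∧-true (sortedB-complete asc) (allB-complete (λ t → t ≤ₗ countU l) l
  (λ {t} t∈ → ≤ₗ-complete t (countU l) (≤-trans (All.lookup short t∈) (≤-reflexive (sym (length-countU l))))))

-- The smaller string is carried on and the larger one is emitted, so running through a list from
-- its largest element down yields ascending output. On an unsorted list the contents still survive,
-- and the test `sortedB` detects disorder.
bubble : Str → Str × List Str → Str × List Str
bubble s (c , out) = if c <ₗ s then (c , s ∷ out) else (s , c ∷ out)

consPair : Str × List Str → List Str
consPair (c , out) = c ∷ out

ins : Str → List Str → List Str
ins x l = consPair (foldr bubble (x , []) l)

-- Advice lists are kept in descending order: the left fold over them then emits ascending output.
insR : Str → List Str → List Str
insR x d = consPair (foldl (λ a s → bubble s a) (x , []) d)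

insR-reverse : ∀ x l → insR x (l ʳ++ []) ≡ ins x l
insR-reverse x l = cong consPair (foldl-ʳ++ (λ a s → bubble s a) (x , []) l {[]})

bubble-All : ∀ {P : Str → Set} s a → P s → All P (consPair a) → All P (consPair (bubble s a))
bubble-All s (c , out) ps (pc ∷ po) with c <ₗ s
... | true  = pc ∷ ps ∷ po
... | false = ps ∷ pc ∷ po

ins-All : ∀ {P : Str → Set} x l → P x → All P l → All P (ins x l)
ins-All x []      px []       = px ∷ []
ins-All x (s ∷ l) px (ps ∷ p) = bubble-All s (foldr bubble (x , []) l) ps (ins-All x l px p)

bubble-length : ∀ s a → length (consPair (bubble s a)) ≡ suc (length (consPair a))
bubble-length s (c , out) with c <ₗ s
... | true  = refl
... | false = refl

ins-length : ∀ x l → length (ins x l) ≡ suc (length l)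
ins-length x []      = refl
ins-length x (s ∷ l) = trans (bubble-length s (foldr bubble (x , []) l)) (cong suc (ins-length x l))

ins-smallest : ∀ r l → All (r <<_) l → ins r l ≡ r ∷ l
ins-smallest r l lt = cong consPair (go l lt)
  where
  go : ∀ l → All (r <<_) l → foldr bubble (r , []) l ≡ (r , l)
  go []      []        = refl
  go (s ∷ l) (lt ∷ ls) = trans (cong (bubble s) (go l ls)) (cong (λ b → if b then (r , s ∷ l) else (s , r ∷ l)) lt)

ins-larger : ∀ x r l → r << x → All (r <<_) l → ins x (r ∷ l) ≡ r ∷ ins x l
ins-larger x r l rx lt with foldr bubble (x , []) l | ins-All {P = r <<_} x l rx lt
... | c , out | rc ∷ _ = cong (λ b → consPair (if b then (c , r ∷ out) else (r , c ∷ out))) (<ₗ-asym r c rc)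

sumOver : ∀ {A : Set} → (A → ℕ) → List A → ℕ
sumOver f []      = 0
sumOver f (a ∷ l) = f a + sumOver f l

sumOver-++ : ∀ {A : Set} (f : A → ℕ) l l′ → sumOver f (l ++ l′) ≡ sumOver f l + sumOver f l′
sumOver-++ f []      l′ = refl
sumOver-++ f (a ∷ l) l′ = trans (cong (f a +_) (sumOver-++ f l l′)) (sym (+-assoc (f a) _ _))

sumOver-map : ∀ {A B : Set} (f : B → ℕ) (g : A → B) l → sumOver f (map g l) ≡ sumOver (λ a → f (g a)) l
sumOver-map f g []      = refl
sumOver-map f g (a ∷ l) = cong (f (g a) +_) (sumOver-map f g l)

sumOver-cong : ∀ {A : Set} {f g : A → ℕ} {l} → All (λ a → f a ≡ g a) l → sumOver f l ≡ sumOver g l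
sumOver-cong []       = refl
sumOver-cong (e ∷ es) = cong₂ _+_ e (sumOver-cong es)

sumOver-+ : ∀ {A : Set} (f g : A → ℕ) l → sumOver (λ a → f a + g a) l ≡ sumOver f l + sumOver g l
sumOver-+ f g []      = refl
sumOver-+ f g (a ∷ l) = trans (cong (f a + g a +_) (sumOver-+ f g l)) (arith (f a) (g a) _ _)
  where
  arith : ∀ a b c d → a + b + (c + d) ≡ a + c + (b + d)
  arith = solve-∀

sumOver-const : ∀ {A : Set} c (l : List A) → sumOver (λ _ → c) l ≡ c * length l
sumOver-const c []      = sym (*-zeroʳ c)
sumOver-const c (_ ∷ l) = trans (cong (c +_) (sumOver-const c l)) (sym (*-suc c (length l)))

sumOver-≥ : ∀ {A : Set} {f : A → ℕ} {l} → All (λ a → 1 ≤ f a) l → length l ≤ sumOver f l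
sumOver-≥ []       = z≤n
sumOver-≥ (p ∷ ps) = +-mono-≤ p (sumOver-≥ ps)

-- A maximum is at least the average; multiplying out avoids division.
best : ∀ {A : Set} (f : A → ℕ) a l → ∃ λ b → b ∈ a ∷ l × sumOver f (a ∷ l) ≤ f b * length (a ∷ l)
best f a []      = a , here refl , ≤-reflexive (trans (+-identityʳ _) (sym (*-identityʳ _)))
best f a (c ∷ l) with best f c l
... | b , b∈ , le with ≤-total (f a) (f b)
...   | inj₁ a≤b = b , there b∈ , ≤-trans (+-mono-≤ a≤b le) (≤-reflexive (sym (*-suc (f b) (suc (length l)))))
...   | inj₂ b≤a = a , here refl , ≤-trans (+-monoʳ-≤ (f a) (≤-trans le (*-monoˡ-≤ (suc (length l)) b≤a)))
                                           (≤-reflexive (sym (*-suc (f a) (suc (length l)))))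

-- the k-element sublists of a list, each with its complement
combs : ℕ → List Str → List (List Str × List Str)
combs zero    R       = ([] , R) ∷ []
combs (suc k) []      = []
combs (suc k) (r ∷ R) = map (λ (S , C) → r ∷ S , C) (combs k R) ++ map (λ (S , C) → S , r ∷ C) (combs (suc k) R)

module _ {Pr : List Str × List Str → Set} where

  combs-cons : ∀ k r R → All (λ (S , C) → Pr (r ∷ S , C)) (combs k R) → All (λ (S , C) → Pr (S , r ∷ C)) (combs (suc k) R) →
               All Pr (combs (suc k) (r ∷ R))
  combs-cons k r R p q = ++⁺ (map⁺ p) (map⁺ q)

combs-All : ∀ {P : Str → Set} k R → All P R → All (λ (S , C) → All P S × All P C) (combs k R)
combs-All zero    R       ps       = ([] , ps) ∷ []
combs-All (suc k) []      ps       = []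
combs-All (suc k) (r ∷ R) (p ∷ ps) = combs-cons k r R
  (All.map (λ (a , b) → p ∷ a , b) (combs-All k R ps)) (All.map (λ (a , b) → a , p ∷ b) (combs-All (suc k) R ps))

combs-length : ∀ k R → All (λ (S , C) → length S ≡ k × length C + k ≡ length R) (combs k R)
combs-length zero    R       = (refl , +-identityʳ _) ∷ []
combs-length (suc k) []      = []
combs-length (suc k) (r ∷ R) = combs-cons k r R
  (All.map (λ { (refl , b) → refl , trans (+-suc _ _) (cong suc b) }) (combs-length k R))
  (All.map (λ (a , b) → a , cong suc b) (combs-length (suc k) R))

combs-asc : ∀ k R → Asc R → All (λ (S , C) → Asc S) (combs k R)
combs-asc zero    R       _          = [] ∷ []
combs-asc (suc k) []      _          = []
combs-asc (suc k) (r ∷ R) (lt ∷ asc) = combs-cons k r R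
  (All.zipWith (λ ((a , _) , s) → a ∷ s) (combs-All k R lt , combs-asc k R asc)) (combs-asc (suc k) R asc)

-- Cases on the place of the least element `r`: if it lies in `S`, each `x` is inserted behind it;
-- if it lies in `C`, it goes to the front of `S`.
combs-ins-asc : ∀ k R → Asc R → All (λ (S , C) → All (λ x → Asc (ins x S)) C) (combs k R)
combs-ins-asc zero    R       _          = All.universal (λ _ → [] ∷ []) R ∷ []
combs-ins-asc (suc k) []      _          = []
combs-ins-asc (suc k) (r ∷ R) (lt ∷ asc) = combs-cons k r R
  (All.zipWith (λ { ((ltS , ltC) , h) → All.zipWith (λ { {x} (rx , h) →
      subst Asc (sym (ins-larger x r _ rx ltS)) (ins-All x _ rx ltS ∷ h) }) (ltC , h) })
    (combs-All k R lt , combs-ins-asc k R asc))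
  (All.zipWith (λ { ((ltS , _) , (s , h)) → subst Asc (sym (ins-smallest r _ ltS)) (ltS ∷ s) ∷ h })
    (combs-All (suc k) R lt , All.zip (combs-asc (suc k) R asc , combs-ins-asc (suc k) R asc)))

combs-count : ∀ (p : Lang) k R → All (λ (S , C) → countIn p R ≡ countIn p S + countIn p C) (combs k R)
combs-count p zero    R       = refl ∷ []
combs-count p (suc k) []      = []
combs-count p (suc k) (r ∷ R) = combs-cons k r R
  (All.map (λ e → trans (cong ((if p r then 1 else 0) +_) e) (sym (+-assoc (if p r then 1 else 0) _ _))) (combs-count p k R))
  (All.map (λ {(S , C)} e → trans (cong ((if p r then 1 else 0) +_) e) (swap (if p r then 1 else 0) (countIn p S) (countIn p C))) (combs-count p (suc k) R))
  where
  swap : ∀ a b c → a + (b + c) ≡ b + (a + c)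
  swap = solve-∀

combs-nonempty : ∀ k R → k ≤ length R → ∃ λ a → ∃ λ l → combs k R ≡ a ∷ l
combs-nonempty zero    R       _        = _ , _ , refl
combs-nonempty (suc k) (r ∷ R) (s≤s le) with combs k R | combs-nonempty k R le
... | _ | a , l , refl = _ , _ , refl

picks : (Str → List Str → ℕ) → ℕ → List Str → ℕ
picks ψ k R = sumOver (λ (T , _) → sumOver (λ x → ψ x T) T) (combs k R)

additions : (Str → List Str → ℕ) → ℕ → List Str → ℕ
additions ψ k R = sumOver (λ (S , C) → sumOver (λ x → ψ x (ins x S)) C) (combs k R)

-- Both sides count pairs x ∈ T with T a (k+1)-element sublist, the left one through S = T ∖ x.
double-counting : ∀ k R ψ → Asc R → additions ψ k R ≡ picks ψ (suc k) R
double-counting zero [] ψ asc = refl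
double-counting zero (r ∷ R) ψ (lt ∷ asc) = trans (+-identityʳ _)
  (cong₂ _+_ (sym (+-identityʳ (ψ r (r ∷ []))))
    (trans (sym (+-identityʳ _)) (trans (double-counting zero R ψ asc)
      (sym (sumOver-map (λ (T , _) → sumOver (λ x → ψ x T) T) (λ (S , C) → S , r ∷ C) (combs 1 R))))))
double-counting (suc k) [] ψ asc = refl
double-counting (suc k) (r ∷ R) ψ (lt ∷ asc) = begin
  sumOver addS (map left′ (combs k R) ++ map right′ (combs (suc k) R))
    ≡⟨ sumOver-++ addS (map left′ (combs k R)) _ ⟩
  sumOver addS (map left′ (combs k R)) + sumOver addS (map right′ (combs (suc k) R))
    ≡⟨ cong₂ _+_ (sumOver-map addS left′ (combs k R)) (sumOver-map addS right′ (combs (suc k) R)) ⟩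
  sumOver (λ a → addS (left′ a)) (combs k R) + sumOver (λ a → addS (right′ a)) (combs (suc k) R)
    ≡⟨ cong₂ _+_ (sumOver-cong (All.map (λ {(S , C)} (ltS , ltC) →
         sumOver-cong (All.map (λ {x} rx → cong (ψ x) (ins-larger x r S rx ltS)) ltC)) (combs-All k R lt)))
       (trans (sumOver-cong (All.map (λ {(S , C)} (ltS , ltC) →
         cong (λ T → ψ r T + sumOver (λ x → ψ x (ins x S)) C) (ins-smallest r S ltS)) (combs-All (suc k) R lt)))
         (sumOver-+ withR (λ (S , C) → sumOver (λ x → ψ x (ins x S)) C) (combs (suc k) R))) ⟩
  -- Three kinds of pairs: `r` lies in `S` (`ψ′`), `r` is the added string (`withR`), or `r` does
  -- not occur in the enlarged set. The induction hypothesis, general in `ψ`, settles the outer two.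
  additions ψ′ k R + (sumOver withR (combs (suc k) R) + additions ψ (suc k) R)
    ≡⟨ cong₂ (λ a b → a + (sumOver withR (combs (suc k) R) + b)) (double-counting k R ψ′ asc) (double-counting (suc k) R ψ asc) ⟩
  picks ψ′ (suc k) R + (sumOver withR (combs (suc k) R) + picks ψ (suc (suc k)) R)
    ≡⟨ swap (picks ψ′ (suc k) R) (sumOver withR (combs (suc k) R)) (picks ψ (suc (suc k)) R) ⟩
  (sumOver withR (combs (suc k) R) + picks ψ′ (suc k) R) + picks ψ (suc (suc k)) R
    ≡⟨ cong₂ _+_ (sym (sumOver-+ withR (λ (T , _) → sumOver (λ x → ψ′ x T) T) (combs (suc k) R))) refl ⟩
  sumOver (λ a → pickS (left′ a)) (combs (suc k) R) + sumOver (λ a → pickS (right′ a)) (combs (suc (suc k)) R)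
    ≡⟨ cong₂ _+_ (sumOver-map pickS left′ (combs (suc k) R)) (sumOver-map pickS right′ (combs (suc (suc k)) R)) ⟨
  sumOver pickS (map left′ (combs (suc k) R)) + sumOver pickS (map right′ (combs (suc (suc k)) R))
    ≡⟨ sumOver-++ pickS (map left′ (combs (suc k) R)) _ ⟨
  picks ψ (suc (suc k)) (r ∷ R) ∎
  where
  open ≡-Reasoning
  left′ right′ : List Str × List Str → List Str × List Str
  left′ (S , C)  = r ∷ S , C
  right′ (S , C) = S , r ∷ C
  addS pickS : List Str × List Str → ℕ
  addS (S , C)  = sumOver (λ x → ψ x (ins x S)) C
  pickS (T , _) = sumOver (λ x → ψ x T) T
  ψ′ : Str → List Str → ℕ
  ψ′ x T = ψ x (r ∷ T)
  withR : List Str × List Str → ℕ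
  withR (T , _) = ψ r (r ∷ T)
  swap : ∀ a b c → a + (b + c) ≡ (b + a) + c
  swap = solve-∀

-- Double counting with constant weight 1 gives `(k+1) C(m,k+1) = (m-k) C(m,k)`; the subtraction is
-- moved to the other side.
combs-ratio : ∀ k R → Asc R → suc k * length (combs (suc k) R) + k * length (combs k R) ≡ length R * length (combs k R)
combs-ratio k R asc = begin
  suc k * length (combs (suc k) R) + k * length (combs k R)
    ≡⟨ cong (_+ k * length (combs k R)) (trans (sym (sumOver-const (suc k) (combs (suc k) R)))
         (sumOver-cong (All.map (λ {(T , _)} (e , _) → sym (trans (ones T) e)) (combs-length (suc k) R)))) ⟩
  picks (λ _ _ → 1) (suc k) R + k * length (combs k R)
    ≡⟨ cong₂ _+_ (sym (double-counting k R (λ _ _ → 1) asc)) (sym (sumOver-const k (combs k R))) ⟩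
  additions (λ _ _ → 1) k R + sumOver (λ _ → k) (combs k R)
    ≡⟨ sumOver-+ (λ (_ , C) → sumOver (λ _ → 1) C) (λ _ → k) (combs k R) ⟨
  sumOver (λ (_ , C) → sumOver (λ _ → 1) C + k) (combs k R)
    ≡⟨ sumOver-cong (All.map (λ {(_ , C)} (_ , e) → trans (cong (_+ k) (ones C)) e) (combs-length k R)) ⟩
  sumOver (λ _ → length R) (combs k R)
    ≡⟨ sumOver-const (length R) (combs k R) ⟩
  length R * length (combs k R) ∎
  where
  open ≡-Reasoning
  ones : ∀ (l : List Str) → sumOver (λ _ → 1) l ≡ length l
  ones l = trans (sumOver-const 1 l) (+-identityʳ _)

sumOver-∈ : ∀ {A : Set} (f : A → ℕ) {a l} → a ∈ l → f a ≤ sumOver f l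
sumOver-∈ f (here refl)         = m≤m+n _ _
sumOver-∈ f {l = c ∷ _} (there p) = ≤-trans (sumOver-∈ f p) (m≤n+m _ (f c))

countIn-all : ∀ {L : Lang} {l} → All (_∈L L) l → countIn L l ≡ length l
countIn-all []               = refl
countIn-all {L} {y ∷ l} (e ∷ es) = cong₂ (λ b n → (if b then 1 else 0) + n) e (countIn-all es)

countIn-none : ∀ {L : Lang} {l} → All (λ x → L x ≡ false) l → countIn L l ≡ 0
countIn-none []               = refl
countIn-none {L} {y ∷ l} (e ∷ es) = cong₂ (λ b n → (if b then 1 else 0) + n) e (countIn-none es)

-- Filtering, and the strings up to a given length

keepB : Lang → List Str → List Str
keepB p []      = []
keepB p (x ∷ l) = if p x then x ∷ keepB p l else keepB p l

length-keepB : ∀ p l → length (keepB p l) ≡ countIn p l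
length-keepB p []      = refl
length-keepB p (x ∷ l) with p x
... | true  = cong suc (length-keepB p l)
... | false = length-keepB p l

keepB-All : ∀ {P : Str → Set} p {l} → All P l → All P (keepB p l)
keepB-All p []                     = []
keepB-All p {x ∷ l} (px ∷ ps) with p x
... | true  = px ∷ keepB-All p ps
... | false = keepB-All p ps

keepB-satisfies : ∀ p l → All (λ x → p x ≡ true) (keepB p l)
keepB-satisfies p []      = []
keepB-satisfies p (x ∷ l) with true⊎false (p x)
... | inj₁ e rewrite e = e ∷ keepB-satisfies p l
... | inj₂ e rewrite e = keepB-satisfies p l

keepB-asc : ∀ p {l} → Asc l → Asc (keepB p l)
keepB-asc p []                    = []
keepB-asc p {x ∷ l} (lt ∷ asc) with p x
... | true  = keepB-All p lt ∷ keepB-asc p asc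
... | false = keepB-asc p asc

keepB-∈ : ∀ p {x l} → x ∈ l → p x ≡ true → x ∈ keepB p l
keepB-∈ p {x} (here refl) e rewrite e = here refl
keepB-∈ p {l = y ∷ l} (there q) e with p y
... | true  = there (keepB-∈ p q e)
... | false = keepB-∈ p q e

strings : ℕ → List Str
strings zero    = [] ∷ []
strings (suc n) = [] ∷ map (false ∷_) (strings n) ++ map (true ∷_) (strings n)

strings-complete : ∀ n x → length x ≤ n → x ∈ strings n
strings-complete zero    []          _        = here refl
strings-complete (suc n) []          _        = here refl
strings-complete (suc n) (false ∷ x) (s≤s le) = there (∈-++⁺ˡ (∈-map⁺ (false ∷_) (strings-complete n x le)))
strings-complete (suc n) (true ∷ x)  (s≤s le) = there (∈-++⁺ʳ (map (false ∷_) (strings n)) (∈-map⁺ (true ∷_) (strings-complete n x le)))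

strings-short : ∀ n → All (λ x → length x ≤ n) (strings n)
strings-short zero    = z≤n ∷ []
strings-short (suc n) = z≤n ∷ ++⁺ (map⁺ (All.map s≤s (strings-short n))) (map⁺ (All.map s≤s (strings-short n)))

strings-asc : ∀ n → Asc (strings n)
strings-asc zero    = [] ∷ []
strings-asc (suc n) =
  ++⁺ {xs = map (false ∷_) (strings n)} (map⁺ (All.universal (λ _ → refl) (strings n))) (map⁺ (All.universal (λ _ → refl) (strings n))) ∷
  go (strings n) (strings-asc n)
  where
  true-asc : ∀ l → Asc l → Asc (map (true ∷_) l)
  true-asc []      []         = []
  true-asc (x ∷ l) (lt ∷ asc) = map⁺ lt ∷ true-asc l asc
  go : ∀ l → Asc l → Asc (map (false ∷_) l ++ map (true ∷_) (strings n))
  go []      []         = true-asc (strings n) (strings-asc n)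
  go (x ∷ l) (lt ∷ asc) = ++⁺ (map⁺ lt) (map⁺ (All.universal (λ _ → refl) _)) ∷ go l asc

-- The strict inequality matters: after all halvings fewer than `2 ^ 0` strings remain, hence none.
strings-length : ∀ n → length (strings n) < 2 ^ suc n
strings-length zero    = ≤-refl
strings-length (suc n) = begin
  suc (suc (length (map (false ∷_) (strings n) ++ map (true ∷_) (strings n))))
    ≡⟨ cong (2 +_) (trans (length-++ (map (false ∷_) (strings n))) (cong₂ _+_ (length-map _ (strings n)) (length-map _ (strings n)))) ⟩
  2 + (length (strings n) + length (strings n)) ≡⟨ arith (length (strings n)) ⟩
  2 * suc (length (strings n))                  ≤⟨ *-monoʳ-≤ 2 (strings-length n) ⟩
  2 * 2 ^ suc n ∎
  where
  open ≤-Reasoning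
  arith : ∀ n → 2 + (n + n) ≡ 2 * suc n
  arith = solve-∀

keepB-length-≤ : ∀ p l → length (keepB p l) ≤ length l
keepB-length-≤ p []      = z≤n
keepB-length-≤ p (x ∷ l) with p x
... | true  = s≤s (keepB-length-≤ p l)
... | false = m≤n⇒m≤1+n (keepB-length-≤ p l)

insR-length : ∀ D a → length (consPair (foldl (λ a s → bubble s a) a D)) ≡ length D + length (consPair a)
insR-length []      a = refl
insR-length (s ∷ D) a = trans (insR-length D (bubble s a)) (trans (cong (length D +_) (bubble-length s a)) (+-suc (length D) _))

bubble-count : ∀ L s a → countIn L (consPair (bubble s a)) ≡ (if L s then 1 else 0) + countIn L (consPair a)
bubble-count L s (c , out) with c <ₗ s
... | true  = swap (if L c then 1 else 0) (if L s then 1 else 0) (countIn L out)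
  where
  swap : ∀ a b c → a + (b + c) ≡ b + (a + c)
  swap = solve-∀
... | false = refl

insR-count : ∀ L D a → countIn L (consPair (foldl (λ a s → bubble s a) a D)) ≡ countIn L D + countIn L (consPair a)
insR-count L []      a = refl
insR-count L (s ∷ D) a = trans (insR-count L D (bubble s a)) (trans (cong (countIn L D +_) (bubble-count L s a)) (swap (countIn L D) (if L s then 1 else 0) _))
  where
  swap : ∀ a b c → a + (b + c) ≡ b + a + c
  swap = solve-∀

-- Covering a language by few certifying sets

module Cover (L : Lang) (F : List Str → List Str)
  (fair : ∀ ys → Admissible ys → All (λ z → z ∈ ys) (F ys) ×
            (length ys ∸ 1 ≤ countIn L ys → All (λ z → z ∈L L) (F ys) × 1 ≤ length (F ys))) where

  -- Members of `D` are tested separately, because inserting one of them gives a repetition and thus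
  -- no admissible tuple. The test `admB` guards the selector, as `D` may come from guessed advice.
  covB : List Str → Lang
  covB D x = anyB (x ==ₗ_) D ∨ (admB (insR x D) ∧ anyB (x ==ₗ_) (F (insR x D)))

  -- Only `x` can lie outside `L`, so the tuple meets the threshold `n - 1` whatever `x` is; the
  -- selector then returns members of `L` only, and an `x` outside `L` is never selected.
  covB-sound : ∀ D x → All (_∈L L) D → covB D x ≡ true → x ∈L L
  covB-sound D x inL eq with ∨-split (anyB (x ==ₗ_) D) eq
  ... | inj₁ found = let y , y∈ , e = anyB-sound (x ==ₗ_) D found in
    subst (_∈L L) (sym (==ₗ-sound x y e)) (All.lookup inL y∈)
  ... | inj₂ selected = let adm , found = ∧-split (admB (insR x D)) selected
                            y , y∈ , e = anyB-sound (x ==ₗ_) (F (insR x D)) found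
                            inF , _ = proj₂ (fair (insR x D) (admB-sound _ (s≤s z≤n) adm)) enough
                        in subst (_∈L L) (sym (==ₗ-sound x y e)) (All.lookup inF y∈)
    where
    enough : length (insR x D) ∸ 1 ≤ countIn L (insR x D)
    enough = begin
      length (insR x D) ∸ 1         ≡⟨ cong (_∸ 1) (trans (insR-length D (x , [])) (+-comm (length D) 1)) ⟩
      length D                      ≡⟨ countIn-all inL ⟨
      countIn L D                   ≤⟨ m≤m+n _ _ ⟩
      countIn L D + countIn L (x ∷ []) ≡⟨ insR-count L D (x , []) ⟨
      countIn L (insR x D) ∎
      where open ≤-Reasoning

  covers : List Str → Lang
  covers S x = covB (S ʳ++ []) x

  covers-member : ∀ {S x} → x ∈ S → covers S x ≡ true
  covers-member {S} {x} x∈ = ∨-trueˡ _ (anyB-complete (x ==ₗ_) (reverse⁺ x∈) (==ₗ-refl x))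

  module _ (k : ℕ) where

    Good : Str → Set
    Good x = x ∈L L × length x ≤ suc k

    ψ : Str → List Str → ℕ
    ψ x T = if anyB (x ==ₗ_) (F T) then 1 else 0

    asc-admissible : ∀ T → Asc T → length T ≡ suc k → All Good T → Admissible T
    asc-admissible T asc len good = admB-sound T (≤-trans (s≤s z≤n) (≤-reflexive (sym len)))
      (admB-complete asc (All.map (λ (_ , le) → ≤-trans le (≤-reflexive (sym len))) good))

    some-winner : ∀ T → Asc T → length T ≡ suc k → All Good T → 1 ≤ sumOver (λ x → ψ x T) T
    some-winner T asc len good = winner (F T) refl (proj₁ (fair T adm)) (proj₂ (proj₂ (fair T adm) enough))
      where
      adm : Admissible T
      adm = asc-admissible T asc len good
      enough : length T ∸ 1 ≤ countIn L T
      enough = ≤-trans (m∸n≤m (length T) 1) (≤-reflexive (sym (countIn-all (All.map proj₁ good))))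
      winner : ∀ zs → F T ≡ zs → All (λ z → z ∈ T) zs → 1 ≤ length zs → 1 ≤ sumOver (λ x → ψ x T) T
      winner (z ∷ zs) eq (z∈ ∷ _) _ = ≤-trans
        (≤-reflexive (cong (λ b → if b then 1 else 0) (sym (anyB-complete (z ==ₗ_) (subst (z ∈_) (sym eq) (here refl)) (==ₗ-refl z)))))
        (sumOver-∈ (λ x → ψ x T) z∈)

    uncovered : List Str → Lang
    uncovered S x = not (covers S x)

    -- A string selected beside `S` is covered by `S`, so no string contributes to both counts.
    one-each : ∀ S C → length S ≡ k → All Good S → All Good C → All (λ x → Asc (ins x S)) C →
               countIn (uncovered S) C + sumOver (λ x → ψ x (ins x S)) C ≤ length C
    one-each S [] _ _ _ _ = z≤n
    one-each S (x ∷ C) len gS (gx ∷ gC) (asc ∷ ascs) = ≤-trans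
      (≤-reflexive (swap (if uncovered S x then 1 else 0) (countIn (uncovered S) C) (ψ x (ins x S)) _))
      (+-mono-≤ (either (true⊎false (anyB (x ==ₗ_) (F (ins x S))))) (one-each S C len gS gC ascs))
      where
      swap : ∀ a b c d → (a + b) + (c + d) ≡ (a + c) + (b + d)
      swap = solve-∀
      bit≤1 : ∀ b → (if b then 1 else 0) ≤ 1
      bit≤1 true  = ≤-refl
      bit≤1 false = z≤n
      adm : admB (ins x S) ≡ true
      adm = admB-complete asc (All.map (λ (_ , le) → ≤-trans le (≤-reflexive (sym (trans (ins-length x S) (cong suc len))))) (ins-All x S gx gS))
      either : anyB (x ==ₗ_) (F (ins x S)) ≡ true ⊎ anyB (x ==ₗ_) (F (ins x S)) ≡ false →
               (if uncovered S x then 1 else 0) + ψ x (ins x S) ≤ 1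
      either (inj₁ e) = ≤-trans (≤-reflexive (cong (λ b → (if not b then 1 else 0) + ψ x (ins x S)) covered)) (bit≤1 _)
        where
        covered : covers S x ≡ true
        covered = ∨-trueʳ (anyB (x ==ₗ_) (S ʳ++ [])) (subst (λ T → admB T ∧ anyB (x ==ₗ_) (F T) ≡ true) (sym (insR-reverse x S)) (∧-true adm e))
      either (inj₂ e) = ≤-trans (≤-reflexive (trans (cong (λ b → (if uncovered S x then 1 else 0) + (if b then 1 else 0)) e) (+-identityʳ _))) (bit≤1 _)

    -- The conclusion says that `S` covers at least the fraction `1 / (k+1)` of `R`. It takes both
    -- the strings selected beside the best `S` and the `k` members of `S`, which cover themselves.
    averaging : ∀ R → Asc R → All Good R → k ≤ length R →
      ∃ λ S → length S ≡ k × All Good S × suc k * countIn (uncovered S) R + length R ≤ suc k * length R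
    averaging R asc good k≤ with combs-nonempty k R k≤
    ... | a , l , ne with best (λ (S , C) → sumOver (λ x → ψ x (ins x S)) C) a l
    ... | (S , C) , b∈ , avg = S , lenS , gS , final
      where
      sc∈ : (S , C) ∈ combs k R
      sc∈ = subst ((S , C) ∈_) (sym ne) b∈
      lenS : length S ≡ k
      lenS = proj₁ (All.lookup (combs-length k R) sc∈)
      lenC : length C + k ≡ length R
      lenC = proj₂ (All.lookup (combs-length k R) sc∈)
      gS : All Good S
      gS = proj₁ (All.lookup (combs-All k R good) sc∈)
      gC : All Good C
      gC = proj₂ (All.lookup (combs-All k R good) sc∈)
      cnt unc # : ℕ
      cnt = sumOver (λ x → ψ x (ins x S)) C
      unc = countIn (uncovered S) R
      # = length (combs k R)
      unc-split : unc + cnt ≤ length C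
      unc-split = ≤-trans (+-monoˡ-≤ cnt (≤-reflexive (trans (All.lookup (combs-count (uncovered S) k R) sc∈)
          (cong (_+ countIn (uncovered S) C) (countIn-none {uncovered S} {S} (All.tabulate (λ x∈ → cong not (covers-member x∈))))))))
        (one-each S C lenS gS gC (All.lookup (combs-ins-asc k R asc) sc∈))
      winners : length (combs (suc k) R) ≤ cnt * #
      winners = begin
        length (combs (suc k) R)      ≤⟨ sumOver-≥ (All.zipWith (λ { {T , _} (s , (len , _) , (g , _)) → some-winner T s len g })
                                            (combs-asc (suc k) R asc , All.zip (combs-length (suc k) R , combs-All (suc k) R good))) ⟩
        picks ψ (suc k) R             ≡⟨ double-counting k R ψ asc ⟨
        additions ψ k R               ≡⟨ cong (sumOver (λ (S , C) → sumOver (λ x → ψ x (ins x S)) C)) ne ⟩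
        sumOver _ (a ∷ l)             ≤⟨ avg ⟩
        cnt * length (a ∷ l)          ≡⟨ cong (λ c → cnt * length c) ne ⟨
        cnt * # ∎
        where open ≤-Reasoning
      -- By `combs-ratio` and `winners`, both sides multiplied by `#` compare as claimed; `#` is
      -- positive because `k ≤ length R`, so it cancels.
      m≤ : length R ≤ suc k * cnt + k
      m≤ = cancel (≤-trans (≤-reflexive (sym (combs-ratio k R asc)))
          (≤-trans (+-monoˡ-≤ (k * #) (*-monoʳ-≤ (suc k) winners)) (≤-reflexive (arith (suc k) cnt k #))))
        where
        arith : ∀ n c k h → n * (c * h) + k * h ≡ (n * c + k) * h
        arith = solve-∀
        cancel : length R * # ≤ (suc k * cnt + k) * # → length R ≤ suc k * cnt + k
        cancel = subst (λ h → length R * h ≤ (suc k * cnt + k) * h → length R ≤ suc k * cnt + k) (sym (cong length ne))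
          (*-cancelʳ-≤ (length R) (suc k * cnt + k) (suc (length l)))
      final : suc k * unc + length R ≤ suc k * length R
      final = begin
        suc k * unc + length R              ≤⟨ +-monoʳ-≤ (suc k * unc) m≤ ⟩
        -- The slack `k * k` arises because the members of `S` enter with weight `suc k` on the
        -- right, where weight 1 would do.
        suc k * unc + (suc k * cnt + k)     ≤⟨ ≤-by (k * k) (arith k unc cnt) ⟩
        suc k * (unc + cnt + k)             ≤⟨ *-monoʳ-≤ (suc k) (≤-trans (+-monoˡ-≤ k unc-split) (≤-reflexive lenC)) ⟩
        suc k * length R ∎
        where
        open ≤-Reasoning
        arith : ∀ k u c → suc k * u + (suc k * c + k) + k * k ≡ suc k * (u + c + k)
        arith = solve-∀

    Item : List Str → Set
    Item S = length S ≤ suc k × All Good S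

    Covered : List (List Str) → Str → Set
    Covered Ss x = Any (λ S → covers S x ≡ true) Ss

    -- As long as `h` strings remain, a round removes at least `h / (k+1)` of them. `progress` adds
    -- this up over `i` rounds, multiplied by `suc k` to avoid fractions, unless the remainder has
    -- dropped below `h`.
    record Rounds (i h : ℕ) (R : List Str) : Set where
      field
        items     : List (List Str)
        few       : length items ≤ i
        are-items : All Item items
        rest      : List Str
        rest-asc  : Asc rest
        rest-good : All Good rest
        covered   : ∀ {x} → x ∈ R → x ∈ rest ⊎ Covered items x
        progress  : length rest < h ⊎ suc k * length rest + i * h ≤ suc k * length R

    rounds : ∀ h i R → 0 < h → Asc R → All Good R → Rounds i h R
    rounds h zero R h>0 asc good = record
      { items = [] ; few = z≤n ; are-items = [] ; rest = R ; rest-asc = asc ; rest-good = good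
      ; covered = inj₁ ; progress = inj₂ (≤-reflexive (+-identityʳ _)) }
    rounds h (suc i) R h>0 asc good with h ≤? length R
    ... | no h≰ = record
      { items = [] ; few = z≤n ; are-items = [] ; rest = R ; rest-asc = asc ; rest-good = good
      ; covered = inj₁ ; progress = inj₁ (≰⇒> h≰) }
    ... | yes h≤ with k ≤? length R
    -- There are too few strings for a `k`-element subset; all of them form one item, which covers
    -- them as its members.
    ...   | no k≰ = record
      { items = R ∷ [] ; few = s≤s z≤n ; are-items = (≤-trans (<⇒≤ (≰⇒> k≰)) (n≤1+n k) , good) ∷ []
      ; rest = [] ; rest-asc = [] ; rest-good = []
      ; covered = λ x∈ → inj₂ (here (covers-member x∈)) ; progress = inj₁ h>0 }
    ...   | yes k≤ with averaging R asc good k≤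
    ...     | S , lenS , gS , drop′ = record
      { items = S ∷ items later ; few = s≤s (few later)
      ; are-items = (≤-trans (≤-reflexive lenS) (n≤1+n k) , gS) ∷ are-items later
      ; rest = rest later ; rest-asc = rest-asc later ; rest-good = rest-good later
      ; covered = λ {x} x∈ → classify x x∈ (true⊎false (covers S x)) ; progress = more (progress later) }
      where
      open Rounds
      R′ : List Str
      R′ = keepB (uncovered S) R
      later : Rounds i h R′
      later = rounds h i R′ h>0 (keepB-asc (uncovered S) asc) (keepB-All (uncovered S) good)
      classify : ∀ x → x ∈ R → covers S x ≡ true ⊎ covers S x ≡ false → x ∈ rest later ⊎ Covered (S ∷ items later) x
      classify x x∈ (inj₁ e) = inj₂ (here e)
      classify x x∈ (inj₂ e) with covered later (keepB-∈ (uncovered S) x∈ (cong not e))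
      ... | inj₁ r = inj₁ r
      ... | inj₂ c = inj₂ (there c)
      more : length (rest later) < h ⊎ suc k * length (rest later) + i * h ≤ suc k * length R′ →
             length (rest later) < h ⊎ suc k * length (rest later) + suc i * h ≤ suc k * length R
      more (inj₁ small) = inj₁ small
      more (inj₂ le)    = inj₂ (begin
        suc k * length (rest later) + (h + i * h) ≡⟨ swap (suc k * length (rest later)) h (i * h) ⟩
        suc k * length (rest later) + i * h + h   ≤⟨ +-mono-≤ le h≤ ⟩
        suc k * length R′ + length R              ≡⟨ cong (λ n → suc k * n + length R) (length-keepB (uncovered S) R) ⟩
        suc k * countIn (uncovered S) R + length R ≤⟨ drop′ ⟩
        suc k * length R ∎)
        where
        open ≤-Reasoning
        swap : ∀ a b c → a + (b + c) ≡ a + c + b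
        swap = solve-∀

    -- suc k rounds halve the number of uncovered strings
    cover : ∀ j R → Asc R → All Good R → length R < 2 ^ j →
      ∃ λ Ss → length Ss ≤ j * suc k × All Item Ss × (∀ {x} → x ∈ R → Covered Ss x)
    cover zero    []      _   _    _  = [] , z≤n , [] , λ ()
    cover zero    (_ ∷ _) _   _    (s≤s ())
    cover (suc j) R       asc good lt with rounds (2 ^ j) (suc k) R (m^n>0 2 j) asc good
    ... | ro with cover j (Rounds.rest ro) (Rounds.rest-asc ro) (Rounds.rest-good ro) (halved (Rounds.progress ro))
      where
      halved : length (Rounds.rest ro) < 2 ^ j ⊎ suc k * length (Rounds.rest ro) + suc k * 2 ^ j ≤ suc k * length R → length (Rounds.rest ro) < 2 ^ j
      halved (inj₁ small) = small
      -- With `suc k` rounds the factor `suc k` cancels, leaving `length rest + 2 ^ j ≤ length R < 2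
      -- ^ (j + 1)`.
      halved (inj₂ le)    = +-cancelʳ-≤ (2 ^ j) (suc (length (Rounds.rest ro))) (2 ^ j)
        (≤-trans (s≤s (*-cancelˡ-≤ (suc k) (≤-trans (≤-reflexive (*-distribˡ-+ (suc k) (length (Rounds.rest ro)) (2 ^ j))) le)))
          (≤-trans lt (≤-reflexive (cong (2 ^ j +_) (+-identityʳ _)))))
    ... | Ss , few , its , cov = Rounds.items ro ++ Ss ,
      ≤-trans (≤-reflexive (length-++ (Rounds.items ro))) (+-mono-≤ (Rounds.few ro) few) ,
      ++⁺ (Rounds.are-items ro) its ,
      λ x∈ → [ (λ r → AnyP.++⁺ʳ (Rounds.items ro) (cov r)) , AnyP.++⁺ˡ ]′ (Rounds.covered ro x∈)

    -- There are fewer than `2 ^ (2 + k)` strings of length at most `suc k`, hence `2 + k` halvings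
    -- of `suc k` rounds each.
    advice : ∃ λ Ss → length Ss ≤ (2 + k) * suc k × All Item Ss × (∀ x → x ∈L L → length x ≤ suc k → Covered Ss x)
    advice with cover (2 + k) (keepB L (strings (suc k))) (keepB-asc L (strings-asc (suc k)))
                  (All.zip (keepB-satisfies L (strings (suc k)) , keepB-All L (strings-short (suc k))))
                  (≤-trans (s≤s (keepB-length-≤ L (strings (suc k)))) (strings-length (suc k)))
    ... | Ss , few , its , cov = Ss , few , its , λ x inL le → cov (keepB-∈ L (strings-complete (suc k) x le) inL)

-- Deciding membership from advice

accepts-result : ∀ M c {b} → result M c ≡ just b → accepts M c ≡ b
accepts-result M c eq with result M c
accepts-result M c {true}  refl | just true  = refl
accepts-result M c {false} refl | just false = refl

noOracle : Fn 1 (λ _ → bs false)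
noOracle = constP []

opaque
  langP : ∀ {B} → P^ emptyLang B → Fn 1 (λ (x , _) → bs (B x))
  langP {B} (M , c , k , correct) = resp (λ (x , _) → cong (λ b → bs b , tt)
      (trans (cong (λ n → accepts M (run M emptyLang n (initConfig M x))) (length-clock c k x)) (accepts-result M (run M emptyLang (poly c k (length x)) (initConfig M x)) (correct x))))
    (idP & clockP c k ▸ simP M {0} (λ _ → emptyLang) noOracle ▸ v 0F)

  fpP : ∀ {f} → FP f → Fn 1 (λ (x , _) → f x)
  fpP {f} (M , c , k , correct) = resp (λ (x , _) → cong (_, tt)
      (trans (cong (λ n → output M (run M emptyLang n (initConfig M x))) (length-clock c k x)) (proj₂ (correct x))))
    (idP & clockP c k ▸ simP M {0} (λ _ → emptyLang) noOracle ▸ v 1F)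

opaque
  dropSecondP : ∀ {k} → PF (2 + k) (1 + k) (λ (y , a , e) → y , e)
  dropSecondP {k} = record
    { mach = dropAt 1 ; time = const 2 ⊕ const 3 ⊗ var
    ; spec = λ (y , a , e) r → weaken (+-monoʳ-≤ 2 (≤-trans (≤-reflexive (*-comm (length a) 3))
        (*-monoʳ-≤ 3 (≤-by (2 + length y + size k e) (arith (length y) (length a) (size k e)))))) (tri-drop (y ∷ []) a (st k e r)) }
    where
    arith : ∀ y a e → a + (2 + y + e) ≡ suc (y + suc (a + e))
    arith = solve-∀

takeE-appE : ∀ k {j} x (y : Env j) → takeE k (appE k x y) ≡ x
takeE-appE zero    x       y = refl
takeE-appE (suc k) (w , x) y = cong (w ,_) (takeE-appE k x y)

dropE-appE : ∀ k {j} x (y : Env j) → dropE k (appE k x y) ≡ y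
dropE-appE zero    x       y = refl
dropE-appE (suc k) (w , x) y = dropE-appE k x y

bs-length : ∀ b → length (bs b) ≤ 1
bs-length true  = ≤-refl
bs-length false = z≤n

opaque
  anyP : ∀ {k} {p : Str → Env k → Bool} → Fn (suc k) (λ (y , e) → bs (p y e)) →
         Fn (suc k) (λ (w , e) → bs (anyB (λ y → p y e) (decList w)))
  anyP {k} {p} P = resp (λ (w , e) → cong (_, tt) (trans
      (cong₂ (λ a u → proj₁ (foldList h a (decList (proj₁ u)))) (cong ([] ,_) (takeE-appE k e (w , tt))) (dropE-appE k e (w , tt)))
      (folded false e (decList w))))
    ((constP [] & tailP) & v 0F ▸ listP-const {h = h} 1 small body ▸ v 0F)
    where
    h : Env (2 + k) → Env (1 + k)
    h (y , a , e) = bs (toB a ∨ p y e) , e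
    body : PF (2 + k) (1 + k) h
    body = orP (testP (v 1F)) (dropSecondP ▸ P) & (tailP ▸ tailP)
    small : ∀ y a → size (1 + k) (h (y , a)) ≤ size (1 + k) a + 1 * suc (length y)
    small y (a , e) = s≤s (≤-trans (+-monoˡ-≤ (size k e) (bs-length (toB a ∨ p y e)))
      (≤-by (length a + length y) (arith (length a) (size k e) (length y))))
      where
      arith : ∀ a e y → 1 + e + (a + y) ≡ a + e + (1 * suc y)
      arith = solve-∀
    folded : ∀ b e ys → proj₁ (foldList h (bs b , e) ys) ≡ bs (foldl (λ a y → a ∨ p y e) b ys)
    folded b e []       = refl
    folded b e (y ∷ ys) = trans (cong (λ b′ → proj₁ (foldList h (bs (b′ ∨ p y e) , e) ys)) (toB-bs b)) (folded (b ∨ p y e) e ys)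

  allP : ∀ {k} {p : Str → Env k → Bool} → Fn (suc k) (λ (y , e) → bs (p y e)) →
         Fn (suc k) (λ (w , e) → bs (allB (λ y → p y e) (decList w)))
  allP P = notP (anyP (notP P))

firstItem-length : ∀ a ys → length (firstItem a ys) ≤ length a + sz ys
firstItem-length a       []       = m≤m+n _ 0
firstItem-length []      (y ∷ ys) = ≤-trans (firstItem-length (true ∷ y) ys) ≤-refl
firstItem-length (b ∷ a) (y ∷ ys) = ≤-trans (firstItem-length (b ∷ a) ys) (+-monoʳ-≤ (length (b ∷ a)) (≤-trans (m≤n+m (sz ys) (length y)) (n≤1+n _)))

fstS-length : ∀ w → length (fstS w) ≤ length w
fstS-length w = ≤-trans (tail-length (firstItem [] (decList w))) (≤-trans (firstItem-length [] (decList w)) (sz-decode [] w))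
  where
  tail-length : ∀ (w : Str) → length (tailS w) ≤ length w
  tail-length []      = z≤n
  tail-length (_ ∷ w) = n≤1+n _

length-pair : ∀ x y → length (pair x y) ≡ 2 * length x + (2 + length y)
length-pair []      y = refl
length-pair (b ∷ x) y = trans (cong (2 +_) (length-pair x y)) (arith (length x) (length y))
  where
  arith : ∀ x y → 2 + (2 * x + (2 + y)) ≡ 2 * suc x + (2 + y)
  arith = solve-∀

-- An item of the advice is an encoded list of pairs of a string and an NP witness for it.
names : Str → List Str
names it = map fstS (decList it)

anyB-map : ∀ {A B : Set} (p : B → Bool) (g : A → B) l → anyB p (map g l) ≡ anyB (λ y → p (g y)) l
anyB-map p g l = go false l
  where
  go : ∀ a l → foldl (λ a y → a ∨ p y) a (map g l) ≡ foldl (λ a y → a ∨ p (g y)) a l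
  go a []      = refl
  go a (y ∷ l) = go (a ∨ p (g y)) l

opaque
  memberP : Fn 2 (λ (w , x , _) → bs (anyB (x ==ₗ_) (decList w)))
  memberP = anyP (v 1F & v 0F ▸ ==ₗP)

  nameP : Fn 2 (λ (it , x , _) → bs (anyB (x ==ₗ_) (names it)))
  nameP = resp (λ (it , x , _) → cong (λ b → bs b , tt) (sym (anyB-map (x ==ₗ_) fstS (decList it))))
    (anyP (v 1F & (v 0F ▸ fstP) ▸ ==ₗP))

  insertP : Fn 2 (λ (it , x , _) → encList (insR x (names it)))
  insertP = resp (λ (it , x , _) → cong (_, tt) (folded (decList it) (x , [])))
    (v 1F & constP [] & v 0F ▸ listP h (const 2 ⊕ const 3 ⊗ var) bounded body ▸ pairP)
    where
    h : Env 3 → Env 2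
    h (y , c , o , _) = if c <ₗ fstS y then (c , pair (fstS y) o , tt) else (fstS y , pair c o , tt)
    body : PF 3 2 h
    body = resp (λ (y , c , o , _) → cong (if_then (c , pair (fstS y) o , tt) else (fstS y , pair c o , tt)) (toB-bs (c <ₗ fstS y)))
      (ifP (v 1F & (v 0F ▸ fstP) ▸ <ₗP)
        (v 1F & ((v 0F ▸ fstP) & v 2F ▸ pairP))
        ((v 0F ▸ fstP) & (v 1F & v 2F ▸ pairP)))
    Φ : Env 2 → ℕ
    Φ (c , o , _) = 3 * length c + length o
    step-Φ : ∀ y a → Φ (h (y , a)) ≤ Φ a + 3 * suc (length y)
    step-Φ y (c , o , _) with c <ₗ fstS y
    ... | true = begin
      3 * length c + length (pair (fstS y) o)          ≡⟨ cong (3 * length c +_) (length-pair (fstS y) o) ⟩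
      3 * length c + (2 * length (fstS y) + (2 + length o)) ≤⟨ +-monoʳ-≤ (3 * length c) (+-monoˡ-≤ _ (*-monoʳ-≤ 2 (fstS-length y))) ⟩
      3 * length c + (2 * length y + (2 + length o))    ≤⟨ ≤-by (1 + length y) (arith (length c) (length y) (length o)) ⟩
      3 * length c + length o + 3 * suc (length y) ∎
      where
      open ≤-Reasoning
      arith : ∀ c y o → 3 * c + (2 * y + (2 + o)) + (1 + y) ≡ 3 * c + o + 3 * suc y
      arith = solve-∀
    ... | false = begin
      3 * length (fstS y) + length (pair c o)          ≡⟨ cong (3 * length (fstS y) +_) (length-pair c o) ⟩
      3 * length (fstS y) + (2 * length c + (2 + length o)) ≤⟨ +-monoˡ-≤ _ (*-monoʳ-≤ 3 (fstS-length y)) ⟩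
      3 * length y + (2 * length c + (2 + length o))    ≤⟨ ≤-by (1 + length c) (arith (length c) (length y) (length o)) ⟩
      3 * length c + length o + 3 * suc (length y) ∎
      where
      open ≤-Reasoning
      arith : ∀ c y o → 3 * y + (2 * c + (2 + o)) + (1 + c) ≡ 3 * c + o + 3 * suc y
      arith = solve-∀
    steps-Φ : ∀ ys a → Φ (foldList h a ys) ≤ Φ a + 3 * sz ys
    steps-Φ []       a = m≤m+n _ _
    steps-Φ (y ∷ ys) a = ≤-trans (steps-Φ ys (h (y , a))) (≤-trans (+-monoˡ-≤ _ (step-Φ y a))
      (≤-reflexive (trans (+-assoc (Φ a) _ _) (cong (Φ a +_) (sym (*-distribˡ-+ 3 (suc (length y)) (sz ys)))))))
    size-Φ : ∀ a → size 2 a ≤ 2 + Φ a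
    size-Φ (c , o , _) = ≤-by (2 * length c) (arith (length c) (length o))
      where
      arith : ∀ c o → suc (c + suc (o + 0)) + 2 * c ≡ 2 + (3 * c + o)
      arith = solve-∀
    Φ-size : ∀ a → Φ a ≤ 3 * size 2 a
    Φ-size (c , o , _) = ≤-by (6 + 2 * length o) (arith (length c) (length o))
      where
      arith : ∀ c o → 3 * c + o + (6 + 2 * o) ≡ 3 * suc (c + suc (o + 0))
      arith = solve-∀
    bounded : ∀ a ys → size 2 (foldList h a ys) ≤ 2 + 3 * (size 2 a + sz ys)
    bounded a ys = ≤-trans (size-Φ (foldList h a ys)) (+-monoʳ-≤ 2 (≤-trans (steps-Φ ys a)
      (≤-trans (+-monoˡ-≤ (3 * sz ys) (Φ-size a)) (≤-reflexive (sym (*-distribˡ-+ 3 (size 2 a) (sz ys)))))))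
    encPair : Str × List Str → Env 2
    encPair (c , out) = c , encList out , tt
    bubbled : ∀ y a → h (y , encPair a) ≡ encPair (bubble (fstS y) a)
    bubbled y (c , out) with c <ₗ fstS y
    ... | true  = refl
    ... | false = refl
    finish : Env 2 → Str
    finish (c , o , _) = pair c o
    folded : ∀ ys a → finish (foldList h (encPair a) ys) ≡ encList (consPair (foldl (λ a s → bubble s a) a (map fstS ys)))
    folded []       a = refl
    folded (y ∷ ys) a = trans (cong (λ e → finish (foldList h e ys)) (bubbled y a)) (folded ys (bubble (fstS y) a))

  sortedP : Fn 1 (λ (w , _) → bs (sortedB (decList w)))
  sortedP = resp (λ (w , _) → cong (_, tt) (folded (decList w) ([] , true)))
    (constP [] & constP (bs true) & idP ▸ listP-const {h = h} 2 small body ▸ v 1F)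
    where
    h : Env 3 → Env 2
    h (t , p , ok , _) = true ∷ t , bs (toB ok ∧ (not (toB p) ∨ (tailS p <ₗ t))) , tt
    body : PF 3 2 h
    body = (v 0F ▸ consP true) & andP (testP (v 2F)) (orP (notP (testP (v 1F))) ((v 1F ▸ tailSP) & v 0F ▸ <ₗP))
    small : ∀ y a → size 2 (h (y , a)) ≤ size 2 a + 2 * suc (length y)
    small y (p , ok , _) = begin
      suc (suc (length y) + suc (length (bs (toB ok ∧ (not (toB p) ∨ (tailS p <ₗ y)))) + 0))
        ≤⟨ s≤s (+-monoʳ-≤ (suc (length y)) (s≤s (+-monoˡ-≤ 0 (bs-length (toB ok ∧ (not (toB p) ∨ (tailS p <ₗ y))))))) ⟩
      suc (suc (length y) + suc (1 + 0))  ≤⟨ ≤-by (length p + length ok + length y) (arith (length p) (length ok) (length y)) ⟩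
      suc (length p + suc (length ok + 0)) + 2 * suc (length y) ∎
      where
      open ≤-Reasoning
      arith : ∀ p o y → suc (suc y + suc (1 + 0)) + (p + o + y) ≡ suc (p + suc (o + 0)) + 2 * suc y
      arith = solve-∀
    folded : ∀ ys a → proj₁ (proj₂ (foldList h (proj₁ a , bs (proj₂ a) , tt) ys)) ≡ bs (proj₂ (foldl sortStep a ys))
    folded []       a        = refl
    folded (y ∷ ys) (p , ok) = trans
      (cong (λ b → proj₁ (proj₂ (foldList h (true ∷ y , bs (b ∧ (not (toB p) ∨ (tailS p <ₗ y))) , tt) ys))) (toB-bs ok))
      (folded ys (sortStep (p , ok) y))

  countP : Fn 1 (λ (w , _) → countU (decList w))
  countP = resp (λ (w , _) → cong (_, tt) (folded (decList w) []))
    (constP [] & idP ▸ listP-const {h = λ (y , n , _) → true ∷ n , tt} 1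
      (λ y (n , _) → ≤-by (length y) (arith (length n) (length y))) (v 1F ▸ consP true))
    where
    arith : ∀ n y → suc (suc n + 0) + y ≡ suc (n + 0) + 1 * suc y
    arith = solve-∀
    folded : ∀ ys n → proj₁ (foldList (λ (y , n , _) → true ∷ n , tt) (n , tt) ys) ≡ foldl (λ n _ → true ∷ n) n ys
    folded []       n = refl
    folded (y ∷ ys) n = folded ys (true ∷ n)

  admP : Fn 1 (λ (w , _) → bs (admB (decList w)))
  admP = andP sortedP (idP & countP ▸ allP ≤ₗP)

bool-ext : ∀ {a b} → (a ≡ true → b ≡ true) → (b ≡ true → a ≡ true) → a ≡ b
bool-ext {true}  {b}     f g = sym (f refl)
bool-ext {false} {true}  f g = g refl
bool-ext {false} {false} f g = refl

stepK-agree : ∀ M O O′ K q t → O (readWord t) ≡ O′ (readWord t) → stepK M O K (q , t) ≡ stepK M O′ K (q , t)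
stepK-agree M O O′ normal q t eq = trans (stepK-normal M O q t) (sym (stepK-normal M O′ q t))
stepK-agree M O O′ accept q t eq = refl
stepK-agree M O O′ reject q t eq = refl
stepK-agree M O O′ query  q t eq = cong (λ b → (if b then OTM.qYes M else OTM.qNo M) , t) eq

-- A query is a word on the tape, which grows by at most one cell per step. So an oracle may be
-- replaced by anything that is correct up to a suitable length.
run-agree : ∀ M O O′ n c → (∀ z → length z ≤ tsize (proj₂ c) + n → O z ≡ O′ z) → run M O n c ≡ run M O′ n c
run-agree M O O′ zero    c       agree = refl
run-agree M O O′ (suc n) (q , t) agree = trans
  (cong (run M O n) (stepK-agree M O O′ (OTM.kind M q) q t (agree (readWord t) (≤-trans (readWord-length t) (m≤m+n _ _)))))
  (run-agree M O O′ n (step M O′ (q , t)) (λ z le → agree z (≤-trans le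
    (≤-trans (+-monoˡ-≤ n (stepK-size M O′ (OTM.kind M q) q t)) (≤-reflexive (sym (+-suc (tsize t) n)))))))

accepts-agree : ∀ M O O′ x n b → (∀ z → length z ≤ suc (length x) + n → O z ≡ O′ z) →
  result M (run M O′ n (initConfig M x)) ≡ just b → accepts M (run M O n (initConfig M x)) ≡ b
accepts-agree M O O′ x n b agree res = trans
  (cong (accepts M) (run-agree M O O′ n (initConfig M x) (λ z le → agree z (≤-trans le (+-monoˡ-≤ n (init-size x))))))
  (accepts-result M (run M O′ n (initConfig M x)) res)

length-encList-≤ : ∀ {m ys} → All (λ y → length y ≤ m) ys → length (encList ys) ≤ length ys * (2 * m + 2)
length-encList-≤ []                       = z≤n
length-encList-≤ {m} {y ∷ ys} (le ∷ les) = begin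
  length (pair y (encList ys))                ≡⟨ length-pair y (encList ys) ⟩
  2 * length y + (2 + length (encList ys))    ≤⟨ +-mono-≤ (*-monoʳ-≤ 2 le) (+-monoʳ-≤ 2 (length-encList-≤ les)) ⟩
  2 * m + (2 + length ys * (2 * m + 2))       ≡⟨ +-assoc (2 * m) 2 _ ⟨
  2 * m + 2 + length ys * (2 * m + 2) ∎
  where open ≤-Reasoning

pairSize : Poly → Poly → Poly
pairSize p q = const 2 ⊗ p ⊕ (const 2 ⊕ q)

pair-≤ : ∀ x y {m n} → length x ≤ m → length y ≤ n → length (pair x y) ≤ 2 * m + (2 + n)
pair-≤ x y lx ly = ≤-trans (≤-reflexive (length-pair x y)) (+-mono-≤ (*-monoʳ-≤ 2 lx) (+-monoʳ-≤ 2 ly))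

clock-≤ : ∀ c k x {n} → length x ≤ n → length (clock c k x) ≤ ⟦ polyP c k ⟧ n
clock-≤ c k x le = ≤-trans (≤-reflexive (trans (length-clock c k x) (sym (⟦polyP⟧ c k (length x))))) (⟦⟧-mono (polyP c k) le)

module Advice (L W : Lang) (W∈P : P^ emptyLang W) (c₁ k₁ : ℕ)
  (npL : ∀ x → (x ∈L L) ⇔ (Σ Str λ y → length y ≤ poly c₁ k₁ (length x) × pair x y ∈L W))
  (F : List Str → List Str) {f : Str → Str} (f∈FP : FP f) (f-enc : ∀ ys → f (encList ys) ≡ encList (F ys))
  (fair : ∀ ys → Admissible ys → All (λ z → z ∈ ys) (F ys) ×
            (length ys ∸ 1 ≤ countIn L ys → All (λ z → z ∈L L) (F ys) × 1 ≤ length (F ys))) where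

  open Cover L F fair public

  witB : Lang
  witB e = (sndS e ≤ₗ clock c₁ k₁ (fstS e)) ∧ W (pair (fstS e) (sndS e))

  itemB : Str → Lang
  itemB it x = allB witB (decList it) ∧ covB (names it) x

  accB : Str → Lang
  accB ad x = anyB (λ it → itemB it x) (decList ad)

  opaque
    witP : Fn 1 (λ (e , _) → bs (witB e))
    witP = andP (sndP & (fstP ▸ clockP c₁ k₁) ▸ ≤ₗP) (fstP & sndP ▸ pairP ▸ langP W∈P)

    itemP : Fn 2 (λ (it , x , _) → bs (itemB it x))
    itemP = andP (v 0F ▸ allP {0} witP) (orP nameP (andP
      (resp (λ (it , x , _) → cong (λ l → bs (admB l) , tt) (decList-encList (insR x (names it)))) (insertP ▸ admP))
      (resp (λ (it , x , _) → cong (λ l → bs (anyB (x ==ₗ_) l) , tt)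
          (trans (cong decList (f-enc (insR x (names it)))) (decList-encList (F (insR x (names it))))))
        ((insertP ▸ fpP f∈FP) & v 1F ▸ memberP))))

    accP : Fn 2 (λ (ad , x , _) → bs (accB ad x))
    accP = anyP itemP

  witB-sound : ∀ e → witB e ≡ true → fstS e ∈L L
  witB-sound e eq = let le , inW = ∧-split (sndS e ≤ₗ clock c₁ k₁ (fstS e)) eq in
    Equivalence.from (npL (fstS e)) (sndS e , ≤-trans (≤ₗ-sound (sndS e) _ le) (≤-reflexive (length-clock c₁ k₁ (fstS e))) , inW)

  witB-complete : ∀ x w → length w ≤ poly c₁ k₁ (length x) → pair x w ∈L W → witB (pair x w) ≡ true
  witB-complete x w le inW = ∧-true
    (≤ₗ-complete (sndS (pair x w)) _ (subst₂ (λ a b → length a ≤ length (clock c₁ k₁ b)) (sym (sndS-pair x w)) (sym (fstS-pair x w))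
      (≤-trans le (≤-reflexive (sym (length-clock c₁ k₁ x))))))
    (trans (cong₂ (λ a b → W (pair a b)) (fstS-pair x w) (sndS-pair x w)) inW)

  -- This holds for arbitrary `ad`: `itemB` verifies the witness of every listed string, which
  -- supplies the hypothesis of `covB-sound`.
  accB-sound : ∀ ad x → accB ad x ≡ true → x ∈L L
  accB-sound ad x eq =
    let it , _ , ok = anyB-sound (λ it → itemB it x) (decList ad) eq
        wits , cov = ∧-split (allB witB (decList it)) ok
    in covB-sound (names it) x (map⁺ (All.tabulate (λ {e} e∈ → witB-sound e (allB-sound witB (decList it) wits e∈)))) cov

  -- `L` is a Boolean function, so membership can be decided by cases; outside `L` the value is a
  -- dummy.
  witness : Str → Str
  witness x with true⊎false (L x)
  ... | inj₁ inL = proj₁ (Equivalence.to (npL x) inL)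
  ... | inj₂ _   = []

  witness-correct : ∀ x → x ∈L L → length (witness x) ≤ poly c₁ k₁ (length x) × pair x (witness x) ∈L W
  witness-correct x inL with true⊎false (L x)
  ... | inj₁ e = proj₂ (Equivalence.to (npL x) e)
  ... | inj₂ e = case trans (sym inL) e of λ ()

  withWitness : Str → Str
  withWitness x = pair x (witness x)

  itemStr : List Str → Str
  itemStr S = encList (map withWitness (S ʳ++ []))

  adviceStr : List (List Str) → Str
  adviceStr Ss = encList (map itemStr Ss)

  names-itemStr : ∀ S → names (itemStr S) ≡ S ʳ++ []
  names-itemStr S = trans (cong (map fstS) (decList-encList (map withWitness (S ʳ++ [])))) (go (S ʳ++ []))
    where
    go : ∀ l → map fstS (map withWitness l) ≡ l
    go []      = refl
    go (x ∷ l) = cong₂ _∷_ (fstS-pair x (witness x)) (go l)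

  itemB-complete : ∀ {S x} → All (_∈L L) S → covers S x ≡ true → itemB (itemStr S) x ≡ true
  itemB-complete {S} {x} inL cov = ∧-true
    (subst (λ l → allB witB l ≡ true) (sym (decList-encList (map withWitness (S ʳ++ []))))
      (allB-complete witB _ (λ y∈ → let s , s∈ , eq = ∈-map⁻ withWitness y∈ in
        subst (λ y → witB y ≡ true) (sym eq) (let le , inW = witness-correct s (All.lookup inL (reverse⁻ s∈)) in
          witB-complete s (witness s) le inW))))
    (trans (cong (λ D → covB D x) (names-itemStr S)) cov)
    where
    reverse⁻ : ∀ {s} → s ∈ S ʳ++ [] → s ∈ S
    reverse⁻ = AnyP.reverse⁻

  accB-complete : ∀ k {Ss x} → All (Item k) Ss → Covered k Ss x → accB (adviceStr Ss) x ≡ true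
  accB-complete k {Ss} {x} its cov = subst (λ l → anyB (λ it → itemB it x) l ≡ true) (sym (decList-encList (map itemStr Ss)))
    (go its cov)
    where
    go : ∀ {Ss} → All (Item k) Ss → Covered k Ss x → anyB (λ it → itemB it x) (map itemStr Ss) ≡ true
    go {Ss} its cov =
      let S , S∈ , e = find cov
      in anyB-complete (λ it → itemB it x) (∈-map⁺ itemStr S∈) (itemB-complete (All.map proj₁ (proj₂ (All.lookup its S∈))) e)

  -- In terms of `N = suc k`: at most `(1 + N) * N` items with at most `N` pairs each, where
  -- encoding a list entry of length `l` takes `2 * l + 2` bits.
  witnessedSize itemSize adviceSize : Poly
  witnessedSize = pairSize var (polyP c₁ k₁)
  itemSize      = var ⊗ (const 2 ⊗ witnessedSize ⊕ const 2)
  adviceSize    = (const 1 ⊕ var) ⊗ var ⊗ (const 2 ⊗ itemSize ⊕ const 2)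

  itemStr-length : ∀ k S → Item k S → length (itemStr S) ≤ ⟦ itemSize ⟧ (suc k)
  itemStr-length k S (few , good) = ≤-trans
    (length-encList-≤ {⟦ witnessedSize ⟧ (suc k)} (map⁺ (All-ʳ++-Str (All.map short good))))
    (*-monoˡ-≤ (2 * ⟦ witnessedSize ⟧ (suc k) + 2) (≤-trans (≤-reflexive (trans (length-map withWitness (S ʳ++ []))
      (length-ʳ++[] S))) few))
    where
    short : ∀ {x} → Good k x → length (withWitness x) ≤ ⟦ witnessedSize ⟧ (suc k)
    short {x} (inL , le) = pair-≤ x (witness x) le (≤-trans (proj₁ (witness-correct x inL))
      (≤-trans (≤-reflexive (sym (⟦polyP⟧ c₁ k₁ (length x)))) (⟦⟧-mono (polyP c₁ k₁) le)))
    All-ʳ++-Str : ∀ {P : Str → Set} {l} → All P l → All P (l ʳ++ [])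
    All-ʳ++-Str {l = l} ps = All.tabulate (λ x∈ → All.lookup ps (AnyP.reverse⁻ x∈))

  Complete : ℕ → Str → Set
  Complete N ad = ∀ x → length x ≤ N → accB ad x ≡ L x

  good-advice : ∀ k → ∃ λ ad → length ad ≤ ⟦ adviceSize ⟧ (suc k) × Complete (suc k) ad
  good-advice k =
    let Ss , few , its , cov = advice k
    in adviceStr Ss ,
       ≤-trans (length-encList-≤ {⟦ itemSize ⟧ (suc k)} (map⁺ (All.map (λ {S} it → itemStr-length k S it) its)))
         (*-monoˡ-≤ (2 * ⟦ itemSize ⟧ (suc k) + 2) (≤-trans (≤-reflexive (length-map itemStr Ss)) few)) ,
       λ x le → bool-ext (accB-sound (adviceStr Ss) x) (λ inL → accB-complete k its (cov x inL le))

  -- Replacing the oracle in NP^L by one in NP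

  module Simulation (A B V U : Lang)
    (MV : OTM) (cV kV : ℕ) (V-correct : ∀ x → result MV (run MV L (poly cV kV (length x)) (initConfig MV x)) ≡ just (V x))
    (c₂ k₂ : ℕ) (npB : ∀ x → (x ∈L B) ⇔ (Σ Str λ y → length y ≤ poly c₂ k₂ (length x) × pair x y ∈L V))
    (MU : OTM) (cU kU : ℕ) (U-correct : ∀ x → result MU (run MU B (poly cU kU (length x)) (initConfig MU x)) ≡ just (U x))
    (c₃ k₃ : ℕ) (npA : ∀ x → (x ∈L A) ⇔ (Σ Str λ y → length y ≤ poly c₃ k₃ (length x) × pair x y ∈L U)) where

    -- y shows that the advice ad misses a member of L of length at most |z|
    badB : Str → Str → Lang
    badB z ad y = (fstS y ≤ₗ z) ∧ (witB y ∧ not (accB ad (fstS y)))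

    simB : Str → Str → Lang
    simB z ad y = (y ≤ₗ clock c₂ k₂ z) ∧
      accepts MV (run MV (accB ad) (length (clock cV kV (pair z y))) (initConfig MV (pair z y)))

    -- `NP^` allows one oracle only, while two kinds of questions arise; a tag bit merges the search
    -- for a missed member of `L` (`false`) with the advised membership in `B` (`true`).
    verify : Str → Lang
    verify []          y = false
    verify (false ∷ u) y = badB (fstS u) (sndS u) y
    verify (true ∷ u)  y = simB (fstS u) (sndS u) y

    V′ : Lang
    V′ s = verify (fstS s) (sndS s)

    opaque
      badP : Fn 3 (λ (z , ad , y , _) → bs (badB z ad y))
      badP = andP ((v 2F ▸ fstP) & v 0F ▸ ≤ₗP) (andP (v 2F ▸ witP) (notP (v 1F & (v 2F ▸ fstP) ▸ accP)))

      oracleP : Fn 2 (λ (q , ad , _) → bs (accB ad q))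
      oracleP = v 1F & v 0F ▸ accP

      simBP : Fn 3 (λ (z , ad , y , _) → bs (simB z ad y))
      simBP = andP (v 2F & (v 0F ▸ clockP c₂ k₂) ▸ ≤ₗP)
        ((v 0F & v 2F ▸ pairP) & (v 0F & v 2F ▸ pairP ▸ clockP cV kV) & v 1F
          ▸ simP MV {1} (λ (ad , _) → accB ad) oracleP ▸ v 0F)

      verifyP : Fn 2 (λ (u , y , _) → bs (verify u y))
      verifyP = resp (λ { ([] , y , _) → refl ; (false ∷ u , y , _) → refl ; (true ∷ u , y , _) → refl })
        (caseP (constP [])
          ((v 0F ▸ fstP) & (v 0F ▸ sndP) & v 1F ▸ badP)
          ((v 0F ▸ fstP) & (v 0F ▸ sndP) & v 1F ▸ simBP))

      V′P : Fn 1 (λ (s , _) → bs (V′ s))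
      V′P = fstP & sndP ▸ verifyP

    certSize : Poly
    certSize = polyP c₂ k₂ ⊕ pairSize var (polyP c₁ k₁)

    certBound : ∃ λ c → ∃ λ k → ∀ n → ⟦ certSize ⟧ n ≤ poly c k n
    certBound = poly-bound certSize

    cB kB : ℕ
    cB = proj₁ certBound
    kB = proj₁ (proj₂ certBound)

    -- Languages are Boolean functions, so the existential over certificates becomes an exhaustive
    -- search. Its running time is irrelevant: `B′` is an oracle and only has to satisfy `NP`.
    B′ : Lang
    B′ u = anyB (λ y → V′ (pair u y)) (strings (poly cB kB (length u)))

    V′-pair : ∀ u y → V′ (pair u y) ≡ verify u y
    V′-pair u y = cong₂ verify (fstS-pair u y) (sndS-pair u y)

    B′-intro : ∀ u y → length y ≤ ⟦ certSize ⟧ (length u) → verify u y ≡ true → B′ u ≡ true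
    B′-intro u y le ok = anyB-complete (λ y → V′ (pair u y))
      (strings-complete _ y (≤-trans le (proj₂ (proj₂ certBound) (length u)))) (trans (V′-pair u y) ok)

    B′-elim : ∀ u → B′ u ≡ true → ∃ λ y → verify u y ≡ true
    B′-elim u eq = let y , _ , ok = anyB-sound (λ y → V′ (pair u y)) (strings (poly cB kB (length u))) eq in
      y , trans (sym (V′-pair u y)) ok

    B′∈NP : NP B′
    B′∈NP = V′ , fn-P^ V′P emptyLang , cB , kB , λ u → mk⇔
      (λ eq → let y , y∈ , ok = anyB-sound (λ y → V′ (pair u y)) (strings (poly cB kB (length u))) eq in
              y , All.lookup (strings-short (poly cB kB (length u))) y∈ , ok)
      (λ (y , le , ok) → anyB-complete (λ y → V′ (pair u y)) (strings-complete _ y le) ok)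

    tag : Bool → Str → Str → Str
    tag b z ad = b ∷ pair z ad

    verify-false : ∀ z ad y → verify (tag false z ad) y ≡ badB z ad y
    verify-false z ad y = cong₂ (λ a b → badB a b y) (fstS-pair z ad) (sndS-pair z ad)

    verify-true : ∀ z ad y → verify (tag true z ad) y ≡ simB z ad y
    verify-true z ad y = cong₂ (λ a b → simB a b y) (fstS-pair z ad) (sndS-pair z ad)

    z≤tag : ∀ b z ad → length z ≤ length (tag b z ad)
    z≤tag b z ad = ≤-trans (≤-by (2 + length z + length ad) (arith (length z) (length ad)))
      (≤-trans (≤-reflexive (sym (length-pair z ad))) (n≤1+n _))
      where
      arith : ∀ z a → z + (2 + z + a) ≡ 2 * z + (2 + a)
      arith = solve-∀

    -- A missed member of `L`, paired with its witness, would be a certificate for a positive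
    -- answer; that `accB ad` accepts nothing else is `accB-sound`.
    B′-bad : ∀ z ad → B′ (tag false z ad) ≡ false → Complete (length z) ad
    B′-bad z ad eq x le = bool-ext (accB-sound ad x) (λ inL → accepted inL (true⊎false (accB ad x)))
      where
      accepted : x ∈L L → accB ad x ≡ true ⊎ accB ad x ≡ false → accB ad x ≡ true
      accepted inL (inj₁ e) = e
      accepted inL (inj₂ e) = case trans (sym (B′-intro (tag false z ad) y short bad)) eq of λ ()
        where
        y : Str
        y = pair x (witness x)
        short : length y ≤ ⟦ certSize ⟧ (length (tag false z ad))
        short = ≤-trans (pair-≤ x (witness x) x≤ (≤-trans (proj₁ (witness-correct x inL))
            (≤-trans (≤-reflexive (sym (⟦polyP⟧ c₁ k₁ (length x)))) (⟦⟧-mono (polyP c₁ k₁) x≤))))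
          (m≤n+m (⟦ pairSize var (polyP c₁ k₁) ⟧ (length (tag false z ad))) (⟦ polyP c₂ k₂ ⟧ (length (tag false z ad))))
          where
          x≤ : length x ≤ length (tag false z ad)
          x≤ = ≤-trans le (z≤tag false z ad)
        bad : verify (tag false z ad) y ≡ true
        bad = trans (verify-false z ad y) (∧-true
          (≤ₗ-complete (fstS y) z (≤-trans (≤-reflexive (cong length (fstS-pair x (witness x)))) le))
          (∧-true (let w≤ , inW = witness-correct x inL in witB-complete x (witness x) w≤ inW)
            (cong not (trans (cong (accB ad) (fstS-pair x (witness x))) e))))

    B′-good : ∀ z ad → Complete (length z) ad → B′ (tag false z ad) ≡ false
    B′-good z ad complete = notTrue (true⊎false (B′ (tag false z ad)))
      where
      notTrue : B′ (tag false z ad) ≡ true ⊎ B′ (tag false z ad) ≡ false → B′ (tag false z ad) ≡ false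
      notTrue (inj₂ e) = e
      notTrue (inj₁ e) =
        let y , ok = B′-elim (tag false z ad) e
            le , rest = ∧-split (fstS y ≤ₗ z) (trans (sym (verify-false z ad y)) ok)
            wit , rej = ∧-split (witB y) rest
        in case trans (sym (witB-sound y wit))
             (trans (sym (complete (fstS y) (≤ₗ-sound (fstS y) z le))) (not-true (accB ad (fstS y)) rej)) of λ ()

    p₂ p₃ pV pU : Poly
    p₂ = polyP c₂ k₂
    p₃ = polyP c₃ k₃
    pV = polyP cV kV
    pU = polyP cU kU

    -- For an input x: ℓ₁ bounds the certified input of MU, ℓ₂ its queries, ℓ₃ the certified
    -- inputs of MV these lead to, and ℓ₄ the queries of MV.
    ℓ₁ ℓ₂ ℓ₃ ℓ₄ : Poly
    ℓ₁ = pairSize var p₃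
    ℓ₂ = const 1 ⊕ ℓ₁ ⊕ pU ⊙ ℓ₁
    ℓ₃ = pairSize ℓ₂ (p₂ ⊙ ℓ₂)
    ℓ₄ = const 1 ⊕ ℓ₃ ⊕ pV ⊙ ℓ₃

    module _ {n : ℕ} {ad : Str} (complete : Complete (⟦ ℓ₄ ⟧ n) ad) where

      simB-correct : ∀ z y → length z ≤ ⟦ ℓ₂ ⟧ n → simB z ad y ≡ (y ≤ₗ clock c₂ k₂ z) ∧ V (pair z y)
      simB-correct z y lz = go (true⊎false (y ≤ₗ clock c₂ k₂ z))
        where
        t : ℕ
        t = length (clock cV kV (pair z y))
        machine-correct : y ≤ₗ clock c₂ k₂ z ≡ true → accepts MV (run MV (accB ad) t (initConfig MV (pair z y))) ≡ V (pair z y)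
        machine-correct ok = accepts-agree MV (accB ad) L (pair z y) t (V (pair z y))
          (λ q lq → complete q (≤-trans lq (+-mono-≤ (s≤s pair≤) (clock-≤ cV kV (pair z y) pair≤))))
          (subst (λ N → result MV (run MV L N (initConfig MV (pair z y))) ≡ just (V (pair z y))) (sym (length-clock cV kV (pair z y))) (V-correct (pair z y)))
          where
          pair≤ : length (pair z y) ≤ ⟦ ℓ₃ ⟧ n
          pair≤ = pair-≤ z y lz (≤-trans (≤ₗ-sound y _ ok) (clock-≤ c₂ k₂ z lz))
        go : y ≤ₗ clock c₂ k₂ z ≡ true ⊎ y ≤ₗ clock c₂ k₂ z ≡ false → simB z ad y ≡ (y ≤ₗ clock c₂ k₂ z) ∧ V (pair z y)
        go (inj₁ ok) = cong ((y ≤ₗ clock c₂ k₂ z) ∧_) (machine-correct ok)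
        go (inj₂ long) = trans (cong (_∧ accepts MV (run MV (accB ad) t (initConfig MV (pair z y)))) long) (cong (_∧ V (pair z y)) (sym long))

      B′-correct : ∀ z → length z ≤ ⟦ ℓ₂ ⟧ n → B′ (tag true z ad) ≡ B z
      B′-correct z lz = bool-ext
        (λ e → let y , ok = B′-elim (tag true z ad) e
                   le , inV = ∧-split (y ≤ₗ clock c₂ k₂ z) (trans (sym (simB-correct z y lz)) (trans (sym (verify-true z ad y)) ok))
               in Equivalence.from (npB z) (y , ≤-trans (≤ₗ-sound y _ le) (≤-reflexive (length-clock c₂ k₂ z)) , inV))
        (λ e → let y , le , inV = Equivalence.to (npB z) e in
          B′-intro (tag true z ad) y
            (≤-trans le (≤-trans (≤-reflexive (sym (⟦polyP⟧ c₂ k₂ (length z))))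
              (≤-trans (⟦⟧-mono p₂ (z≤tag true z ad)) (m≤m+n (⟦ p₂ ⟧ (length (tag true z ad))) _))))
            (trans (verify-true z ad y) (trans (simB-correct z y lz)
              (∧-true (≤ₗ-complete y _ (≤-trans le (≤-reflexive (sym (length-clock c₂ k₂ z))))) inV))))

      U-simulated : ∀ x y → length x ≡ n → length y ≤ poly c₃ k₃ (length x) →
        accepts MU (run MU (λ z → B′ (tag true z ad)) (length (clock cU kU (pair x y))) (initConfig MU (pair x y))) ≡ U (pair x y)
      U-simulated x y refl ly = accepts-agree MU (λ z → B′ (tag true z ad)) B (pair x y) (length (clock cU kU (pair x y))) (U (pair x y))
        (λ z lz → B′-correct z (≤-trans lz (+-mono-≤ (s≤s pair≤) (clock-≤ cU kU (pair x y) pair≤))))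
        (subst (λ N → result MU (run MU B N (initConfig MU (pair x y))) ≡ just (U (pair x y))) (sym (length-clock cU kU (pair x y))) (U-correct (pair x y)))
        where
        pair≤ : length (pair x y) ≤ ⟦ ℓ₁ ⟧ n
        pair≤ = pair-≤ x y ≤-refl (≤-trans ly (≤-reflexive (sym (⟦polyP⟧ c₃ k₃ (length x)))))

    lengthBound : ∃ λ c → ∃ λ k → ∀ n → ⟦ ℓ₄ ⟧ n ≤ poly c k n
    lengthBound = poly-bound ℓ₄

    cN kN : ℕ
    cN = proj₁ lengthBound
    kN = proj₁ (proj₂ lengthBound)

    -- The input is `pair x (pair y ad)`: the certificate guessed for `x` consists of one for `U`
    -- and an advice.
    certOf adviceOf : Str → Str
    certOf s   = fstS (sndS s)
    adviceOf s = sndS (sndS s)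

    open Reduction MU B′
      {q₀ = λ s → tag false (clock cN kN (fstS s)) (adviceOf s)}
      {w = λ s → pair (fstS s) (certOf s)}
      {clk = λ s → clock cU kU (pair (fstS s) (certOf s))}
      {a = adviceOf}
      {ok = λ s → certOf s ≤ₗ clock c₃ k₃ (fstS s)}
      {g = tag true}
      ((sndP ▸ fstP) & (fstP ▸ clockP c₃ k₃) ▸ ≤ₗP)
      ((fstP ▸ clockP cN kN) & (sndP ▸ sndP) ▸ pairP ▸ consP false)
      (fstP & (sndP ▸ fstP) ▸ pairP)
      (fstP & (sndP ▸ fstP) ▸ pairP ▸ clockP cU kU)
      (sndP ▸ sndP)
      (pairP ▸ consP true)
      using (lang; reduction-P^)

    lang-pair : ∀ x y′ → lang (pair x y′) ≡ (fstS y′ ≤ₗ clock c₃ k₃ x) ∧ (not (B′ (tag false (clock cN kN x) (sndS y′))) ∧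
      accepts MU (run MU (λ z → B′ (tag true z (sndS y′))) (length (clock cU kU (pair x (fstS y′)))) (initConfig MU (pair x (fstS y′)))))
    lang-pair x y′ = cong₂ (λ a b → (fstS b ≤ₗ clock c₃ k₃ a) ∧ (not (B′ (tag false (clock cN kN a) (sndS b))) ∧
      accepts MU (run MU (λ z → B′ (tag true z (sndS b))) (length (clock cU kU (pair a (fstS b)))) (initConfig MU (pair a (fstS b))))))
      (fstS-pair x y′) (sndS-pair x y′)

    weaken-complete : ∀ {m N ad} → m ≤ N → Complete N ad → Complete m ad
    weaken-complete le complete x lx = complete x (≤-trans lx le)

    certSizeA : Poly
    certSizeA = pairSize p₃ (adviceSize ⊙ polyP cN kN)

    A∈NP^B′ : NP^ B′ A
    A∈NP^B′ = lang , reduction-P^ , proj₁ (poly-bound certSizeA) , proj₁ (proj₂ (poly-bound certSizeA)) , λ x → mk⇔ (forward x) (backward x)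
      where
      N≥ : ∀ x → ⟦ ℓ₄ ⟧ (length x) ≤ length (clock cN kN x)
      N≥ x = ≤-trans (proj₂ (proj₂ lengthBound) (length x)) (≤-reflexive (sym (length-clock cN kN x)))
      -- `good-advice` speaks of lengths `suc k`; the summand `const 1` in `ℓ₄` makes the length
      -- used here positive.
      advised : ∀ N → 1 ≤ N → ∃ λ ad → length ad ≤ ⟦ adviceSize ⟧ N × Complete N ad
      advised (suc k) _ = good-advice k
      forward : ∀ x → x ∈L A → Σ Str λ y → length y ≤ poly (proj₁ (poly-bound certSizeA)) (proj₁ (proj₂ (poly-bound certSizeA))) (length x) × pair x y ∈L lang
      forward x inA =
        let y , ly , inU = Equivalence.to (npA x) inA
            ad , lad , complete = advised (length (clock cN kN x)) (≤-trans (s≤s z≤n) (N≥ x))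
        in pair y ad ,
           ≤-trans (pair-≤ y ad (≤-trans ly (≤-reflexive (sym (⟦polyP⟧ c₃ k₃ (length x)))))
               (≤-trans lad (⟦⟧-mono adviceSize (clock-≤ cN kN x ≤-refl))))
             (proj₂ (proj₂ (poly-bound certSizeA)) (length x)) ,
           trans (lang-pair x (pair y ad)) (trans (cong₂ (λ a b → (a ≤ₗ clock c₃ k₃ x) ∧ (not (B′ (tag false (clock cN kN x) b)) ∧
               accepts MU (run MU (λ z → B′ (tag true z b)) (length (clock cU kU (pair x a))) (initConfig MU (pair x a)))))
               (fstS-pair y ad) (sndS-pair y ad))
             (∧-true (≤ₗ-complete y _ (≤-trans ly (≤-reflexive (sym (length-clock c₃ k₃ x)))))
               (∧-true (cong not (B′-good (clock cN kN x) ad complete))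
                 (trans (U-simulated {ad = ad} (weaken-complete {ad = ad} (N≥ x) complete) x y refl ly) inU))))
      backward : ∀ x → (Σ Str λ y → length y ≤ poly (proj₁ (poly-bound certSizeA)) (proj₁ (proj₂ (poly-bound certSizeA))) (length x) × pair x y ∈L lang) → x ∈L A
      backward x (y′ , _ , inLang) =
        let ly , rest = ∧-split (fstS y′ ≤ₗ clock c₃ k₃ x) (trans (sym (lang-pair x y′)) inLang)
            good , acc = ∧-split (not (B′ (tag false (clock cN kN x) (sndS y′)))) rest
            -- The advice here is whatever was guessed; its completeness comes from the negative
            -- answer to the preliminary query.
            complete = B′-bad (clock cN kN x) (sndS y′) (not-true _ good)
            ly′ = ≤-trans (≤ₗ-sound (fstS y′) _ ly) (≤-reflexive (length-clock c₃ k₃ x))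
        in Equivalence.from (npA x) (fstS y′ , ly′ ,
             trans (sym (U-simulated {ad = sndS y′} (weaken-complete {ad = sndS y′} (N≥ x) complete) x (fstS y′) refl ly′)) acc)

theorem3p17 : (L : Lang) → NP L → FairS L → Low₂ L
theorem3p17 L L∈NP@(W , W∈P , c₁ , k₁ , npL) (F , f , f∈FP , f-enc , fair) =
  L∈NP , λ A → mk⇔ (down A) (up A)
  where
  open Advice L W W∈P c₁ k₁ npL F f∈FP f-enc fair
  down : ∀ A → Σ₂ᵖ^ L A → Σ₂ᵖ A
  down A (B , (V , (MV , cV , kV , V-correct) , c₂ , k₂ , npB) , (U , (MU , cU , kU , U-correct) , c₃ , k₃ , npA)) =
    S.B′ , S.B′∈NP , S.A∈NP^B′
    where
    module S = Simulation A B V U MV cV kV V-correct c₂ k₂ npB MU cU kU U-correct c₃ k₃ npA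
  -- `NP ⊆ NP^L`: a polynomial-time verifier can be decided in the presence of any oracle, so the
  -- same `B` serves.
  up : ∀ A → Σ₂ᵖ A → Σ₂ᵖ^ L A
  up A (B , (V , V∈P , c , k , npB) , A∈NP) = B , (V , fn-P^ (langP V∈P) L , c , k , npB) , A∈NP
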